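{- Let $\Delta_n$ be a uniform flag triangulation of the boundary $\partial P_n$ of the root polytope in the lex class, i.e. pairs of arrows of types $THTH$ and $HTHT$ both do not nest, and pairs of types $THHT$ and $HTTH$ both do not cross. Then for $0\le i\le k$, the number of $(k-1)$-dimensional faces of $\Delta_n$ consisting of $i$ forward arrows and $k-i$ backward arrows is $$f(\Delta_n,i,k-i)=\frac{f_{k-1}(\Delta_n)}{k+1}=\frac{1}{k+1}\binom{n+k}{k}\binom{n}{k},$$ which in particular is independent of $i$.
   Context: $P_n$ is the convex hull of $e_j-e_i$ ($i\ne j$) in $\mathbb{R}^{n+1}$. An arrow $(i,j)$, $i\ne j\in\{1,\dots,n+1\}$, with tail $i$ and head $j$, is identified with $e_j-e_i$; forward if $i<j$, backward if $i>j$; $V_n$ is the set of arrows. A uniform flag triangulation of $\partial P_n$ is a flag simplicial complex on $V_n$ representing a triangulation of $\partial P_n$ (no new vertices) in which whether a pair $\{(i_1,j_1),(i_2,j_2)\}$ is an edge depends only on the equalities and inequalities among $i_1,i_2,j_1,j_2$. For two arrows with four distinct endpoints $p_1<\dots<p_4$ the type is the $T/H$ word of tails/heads at $p_1,\dots,p_4$; the pair nests if it joins $\{p_1,p_4\},\{p_2,p_3\}$, crosses if it joins $\{p_1,p_3\},\{p_2,p_4\}$; "does not nest"/"does not cross" means such pairs are not edges. $f(\Delta_n,i,j)$ is the number of faces with $i$ forward and $j$ backward arrows, and $f_{k-1}(\Delta_n)$ is the number of $(k-1)$-dimensional faces. -}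

module Defs where

open import Data.Nat as ℕ using (ℕ; zero; suc; _<ᵇ_; _≡ᵇ_)
open import Data.Fin as Fin using (Fin; toℕ)
open import Data.Fin.Base using (_<_)
open import Data.Bool using (Bool; true; false; _∧_; _∨_; not; if_then_else_)
open import Data.List using (List; []; _∷_; map; concatMap; length; filterᵇ; allFin; cartesianProduct; foldr)
open import Data.Product using (Σ; _×_; _,_; proj₁; proj₂)
open import Data.Rational as ℚ using (ℚ; 0ℚ; 1ℚ)
open import Relation.Binary.PropositionalEquality using (_≡_)
open import Relation.Nullary using (¬_)

-- Arrows.  A pair (i , j) of elements of {0..n} (= {1..n+1}, shifted)
-- is the arrow with tail i and head j, i.e. the vector e_j - e_i in
-- ℚ^{n+1}.  It is an arrow (element of V_n) iff i ≠ j.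

Pt : ℕ → Set
Pt n = Fin (suc n) × Fin (suc n)

tl hd : ∀ {n} → Pt n → Fin (suc n)
tl = proj₁
hd = proj₂

isArrow : ∀ {n} → Pt n → Bool
isArrow (i , j) = not (toℕ i ≡ᵇ toℕ j)

isForward : ∀ {n} → Pt n → Bool
isForward (i , j) = toℕ i <ᵇ toℕ j

isBackward : ∀ {n} → Pt n → Bool
isBackward (i , j) = toℕ j <ᵇ toℕ i

samePt : ∀ {n} → Pt n → Pt n → Bool
samePt (i , j) (k , l) = (toℕ i ≡ᵇ toℕ k) ∧ (toℕ j ≡ᵇ toℕ l)

pts : (n : ℕ) → List (Pt n)
pts n = cartesianProduct (allFin (suc n)) (allFin (suc n))

Sub : ℕ → Set
Sub n = Pt n → Bool

consF : ∀ {a} {X : Set a} {m} → X → (Fin m → X) → Fin (suc m) → X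
consF x f Fin.zero    = x
consF x f (Fin.suc i) = f i

allFnsOf : ∀ {X : Set} → List X → (m : ℕ) → List (Fin m → X)
allFnsOf xs zero    = (λ ()) ∷ []
allFnsOf xs (suc m) = concatMap (λ x → map (consF x) (allFnsOf xs m)) xs

allSubs : (n : ℕ) → List (Sub n)
allSubs n = map (λ g → λ p → g (proj₁ p) (proj₂ p))
                (allFnsOf (allFnsOf (true ∷ false ∷ []) (suc n)) (suc n))

allᵇ : ∀ {A : Set} → (A → Bool) → List A → Bool
allᵇ p = foldr (λ a b → p a ∧ b) true

EdgeRel : ℕ → Set
EdgeRel n = Pt n → Pt n → Bool

isFace : ∀ {n} → EdgeRel n → Sub n → Bool
isFace {n} E S =
  allᵇ (λ p → not (S p) ∨ isArrow p) (pts n) ∧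
  allᵇ (λ p → allᵇ (λ q → not (S p) ∨ not (S q) ∨ samePt p q ∨ E p q) (pts n)) (pts n)

card : ∀ {n} → (Pt n → Bool) → ℕ
card {n} P = length (filterᵇ P (pts n))

fFB : ∀ {n} → EdgeRel n → ℕ → ℕ → ℕ
fFB {n} E i j = length (filterᵇ
  (λ S → isFace E S ∧ (card (λ p → S p ∧ isForward p) ≡ᵇ i)
                    ∧ (card (λ p → S p ∧ isBackward p) ≡ᵇ j))
  (allSubs n))

-- f_{k-1}(Δ): faces with k vertices
fK : ∀ {n} → EdgeRel n → ℕ → ℕ
fK {n} E k = length (filterᵇ (λ S → isFace E S ∧ (card S ≡ᵇ k)) (allSubs n))

four : ∀ {n} → Pt n → Pt n → Fin 4 → ℕ
four (i₁ , j₁) (i₂ , j₂) = consF (toℕ i₁) (consF (toℕ j₁) (consF (toℕ i₂) (consF (toℕ j₂) (λ ()))))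

sameOrderType : ∀ {n} → Pt n → Pt n → Pt n → Pt n → Set
sameOrderType p q p′ q′ =
  ∀ (r s : Fin 4) → (four p q r <ᵇ four p q s) ≡ (four p′ q′ r <ᵇ four p′ q′ s)

IsUniform : ∀ {n} → EdgeRel n → Set
IsUniform E = ∀ p q p′ q′ →
  isArrow p ≡ true → isArrow q ≡ true → isArrow p′ ≡ true → isArrow q′ ≡ true →
  sameOrderType p q p′ q′ → E p q ≡ E p′ q′

IsSymmetric : ∀ {n} → EdgeRel n → Set
IsSymmetric E = ∀ p q → E p q ≡ E q p

Vec𝐐 : ℕ → Set
Vec𝐐 n = Fin (suc n) → ℚ

sumℚ : List ℚ → ℚ
sumℚ = foldr ℚ._+_ 0ℚ

δ : ∀ {n} → Fin (suc n) → Fin (suc n) → ℚ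
δ a b = if toℕ a ≡ᵇ toℕ b then 1ℚ else 0ℚ

vec : ∀ {n} → Pt n → Vec𝐐 n
vec (i , j) t = δ t j ℚ.- δ t i

combo : ∀ {n} → (Pt n → ℚ) → Vec𝐐 n
combo {n} c t = sumℚ (map (λ p → c p ℚ.* vec p t) (pts n))

supportedIn : ∀ {n} → Sub n → (Pt n → ℚ) → Set
supportedIn S c = ∀ p → S p ≡ false → c p ≡ 0ℚ

InConv : ∀ {n} → Sub n → Vec𝐐 n → Set
InConv {n} S x = Σ (Pt n → ℚ) λ c →
  (∀ p → 0ℚ ℚ.≤ c p) × supportedIn S c × (sumℚ (map c (pts n)) ≡ 1ℚ) ×
  (∀ t → combo c t ≡ x t)

AffInd : ∀ {n} → Sub n → Set
AffInd {n} S = ∀ (c : Pt n → ℚ) → supportedIn S c → sumℚ (map c (pts n)) ≡ 0ℚ →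
  (∀ t → combo c t ≡ 0ℚ) → ∀ p → c p ≡ 0ℚ

InP : ∀ {n} → Vec𝐐 n → Set
InP x = InConv isArrow x

-- relative interior of P_n (Rockafellar, Thm 6.4):
-- x ∈ P and for every y ∈ P, x + ε (x - y) ∈ P for some ε > 0
InRelInt : ∀ {n} → Vec𝐐 n → Set
InRelInt {n} x = InP x × (∀ (y : Vec𝐐 n) → InP y →
  Σ ℚ λ ε → (0ℚ ℚ.< ε) × InP (λ t → x t ℚ.+ ε ℚ.* (x t ℚ.- y t)))

InBoundary : ∀ {n} → Vec𝐐 n → Set
InBoundary x = InP x × ¬ InRelInt x

inter : ∀ {n} → Sub n → Sub n → Sub n
inter S T p = S p ∧ T p

IsTriangulationOfBoundary : ∀ {n} → EdgeRel n → Set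
IsTriangulationOfBoundary {n} E =
  (∀ S → isFace E S ≡ true → AffInd S) ×
  (∀ S → isFace E S ≡ true → ∀ x → InConv S x → InBoundary x) ×
  (∀ (x : Vec𝐐 n) → InBoundary x → Σ (Sub n) λ S → (isFace E S ≡ true) × InConv S x) ×
  (∀ S T → isFace E S ≡ true → isFace E T ≡ true →
     ∀ x → InConv S x → InConv T x → InConv (inter S T) x)

record UniformFlagTriangulation (n : ℕ) : Set where
  field
    edge      : EdgeRel n
    symmetric : IsSymmetric edge
    uniform   : IsUniform edge
    triang    : IsTriangulationOfBoundary edge

InLexClass : ∀ {n} → EdgeRel n → Set
InLexClass {n} E = ∀ (p₁ p₂ p₃ p₄ : Fin (suc n)) → p₁ < p₂ → p₂ < p₃ → p₃ < p₄ →
  (E (p₁ , p₄) (p₃ , p₂) ≡ false) ×   -- THTH nesting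
  (E (p₄ , p₁) (p₂ , p₃) ≡ false) ×   -- HTHT nesting
  (E (p₁ , p₃) (p₄ , p₂) ≡ false) ×   -- THHT crossing
  (E (p₃ , p₁) (p₂ , p₄) ≡ false)     -- HTTH crossing

{-# OPTIONS --safe #-}
-- The midpoint of an arrow into j and an arrow out of j is interior, so they are not joined.  For tails a, b and
-- heads x, y, the functional that is 1 on {x , y} and −1 on {a , b} exposes the face of P_n spanned by the arrows
-- from {a , b} to {x , y}; it contains the midpoint of a → x and b → y, so a simplex covering that point uses only
-- these arrows.  Hence arrows sharing a head or a tail are joined, and exactly one of the two matchings of {a , b}
-- with {x , y} is an edge.  With the lex conditions only the choices at TTHH and HHTT remain free.
-- When nodes are added from right to left, the ways to add a node depend only on the numbers of available heads and
-- tails, by the same law whichever choices are made.  The resulting recursion is solved by the kernel method: with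
-- Yᵤ = u + xYᵤ(1 + Yᵤ), the generating function of f(Δ_n, i, j)xⁿuⁱvʲ satisfies B = 1 + xB(1 + Yᵤ + Yᵥ), and its
-- solution B = (Yᵤ − Yᵥ)/(u − v) has coefficients depending on i + j only, as in the Chung–Feller theorem.
module Submission where

open import Defs
open import Data.Nat as ℕ using (ℕ; zero; suc; _≡ᵇ_; _<ᵇ_; z≤n; s≤s)
import Data.Nat.Properties as ℕₚ
open import Data.Bool using (Bool; true; false; _∧_; _∨_; not; if_then_else_)
open import Data.Bool.Properties using (∧-zeroʳ; ∧-identityʳ; ∨-zeroʳ; ¬-not; T-≡)
open import Data.Product using (_×_; _,_; proj₁; proj₂; swap; Σ; ∃)
open import Relation.Binary.PropositionalEquality as ≡ using (_≡_; _≢_)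
open import Relation.Nullary using (yes; no)

-- Why two numbers suffice as a state: the arrows joining a new node to older ones all leave it or
-- all enter it. If they leave, the lex conditions imply that, among the nodes present, only this
-- node can still be the tail of an arrow entering a node further left, so the number of tails drops
-- to one. The heads are cut down to those weakly above the highest, or weakly below the lowest, of
-- the heads just used, according as TTHH pairs nest or cross. Counting ranks from the other end
-- exchanges these two cases, so both obey one law. Reversal of all arrows preserves the lex
-- conditions and gives the dual law for arrows that enter the node.
--
-- The series have natural coefficients, so subtraction and division are avoided throughout:
-- differences of powers are written as geometric sums, and the divided difference B is given by its
-- coefficients. The recursion is verified rather than solved: a closed form for the completions of
-- every state is checked against it, using only the equations of Yᵤ, Yᵥ and B.

module Series where
  open import Level using (0ℓ)
  open import Algebra using (CommutativeSemiring)
  open import Algebra.Structures using (IsCommutativeSemiring)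
  open import Data.Nat using (_≤_; _<_; _∸_; _!; NonZero)
  open import Data.Nat.Combinatorics using (_C_; nCk≡n!/k![n-k]!; k![n∸k]!∣n!)
  open import Data.Nat.Combinatorics.Specification using (k>n⇒nCk≡0)
  open import Data.Nat.DivMod using (m/n*n≡m)
  open import Data.Nat.Tactic.RingSolver using (solve-∀)
  import Relation.Binary.Reasoning.Setoid as SetoidReasoning
  import Algebra.Solver.Ring.NaturalCoefficients.Default as SemiringSolver

  -- Formal power series over a commutative semiring.

  module PowerSeries (R : CommutativeSemiring 0ℓ 0ℓ) where
    open CommutativeSemiring R
    open SemiringSolver R using (solve; _:+_; _:*_; _:=_)
    open SetoidReasoning setoid

    Series : Set
    Series = ℕ → Carrier

    infix  4 _≈ₛ_
    infixl 6 _+ₛ_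
    infixl 7 _*ₛ_

    _≈ₛ_ : Series → Series → Set
    f ≈ₛ g = ∀ n → f n ≈ g n

    _+ₛ_ : Series → Series → Series
    (f +ₛ g) n = f n + g n

    tail : Series → Series
    tail f n = f (suc n)

    _*ₛ_ : Series → Series → Series
    (f *ₛ g) zero    = f 0 * g 0
    (f *ₛ g) (suc n) = f 0 * g (suc n) + (tail f *ₛ g) n

    const : Carrier → Series
    const c zero    = c
    const c (suc n) = 0#

    var : Series
    var zero          = 0#
    var (suc zero)    = 1#
    var (suc (suc n)) = 0#

    *ₛ-cong : ∀ {f g h k} → f ≈ₛ g → h ≈ₛ k → f *ₛ h ≈ₛ g *ₛ k
    *ₛ-cong p q zero    = *-cong (p 0) (q 0)
    *ₛ-cong p q (suc n) = +-cong (*-cong (p 0) (q (suc n))) (*ₛ-cong (λ m → p (suc m)) q n)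

    -- The convolution peeled at the end opposite to the defining clause; the two together give
    -- commutativity.
    *ₛ-suc : ∀ f g n → (f *ₛ g) (suc n) ≈ (f *ₛ tail g) n + f (suc n) * g 0
    *ₛ-suc f g zero    = refl
    *ₛ-suc f g (suc n) = trans (+-congˡ (*ₛ-suc (tail f) g n)) (sym (+-assoc _ _ _))

    *ₛ-comm : ∀ f g → f *ₛ g ≈ₛ g *ₛ f
    *ₛ-comm f g zero    = *-comm _ _
    *ₛ-comm f g (suc n) = begin
      f 0 * g (suc n) + (tail f *ₛ g) n ≈⟨ +-cong (*-comm _ _) (*ₛ-comm (tail f) g n) ⟩
      g (suc n) * f 0 + (g *ₛ tail f) n ≈⟨ +-comm _ _ ⟩
      (g *ₛ tail f) n + g (suc n) * f 0 ≈⟨ *ₛ-suc g f n ⟨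
      (g *ₛ f) (suc n)                  ∎

    const-0# : ∀ n → const 0# n ≈ 0#
    const-0# zero    = refl
    const-0# (suc n) = refl

    zero-*ₛ : ∀ f g → (∀ n → f n ≈ 0#) → ∀ n → (f *ₛ g) n ≈ 0#
    zero-*ₛ f g p zero    = trans (*-congʳ (p 0)) (zeroˡ _)
    zero-*ₛ f g p (suc n) = trans (+-cong (trans (*-congʳ (p 0)) (zeroˡ _))
                                           (zero-*ₛ (tail f) g (λ m → p (suc m)) n)) (+-identityˡ _)

    const-*ₛ : ∀ c f n → (const c *ₛ f) n ≈ c * f n
    const-*ₛ c f zero    = refl
    const-*ₛ c f (suc n) = trans (+-congˡ (zero-*ₛ (tail (const c)) f (λ _ → refl) n)) (+-identityʳ _)

    var-*ₛ-zero : ∀ f → (var *ₛ f) 0 ≈ 0#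
    var-*ₛ-zero f = zeroˡ _

    var-*ₛ-suc : ∀ f n → (var *ₛ f) (suc n) ≈ f n
    var-*ₛ-suc f n = begin
      0# * f (suc n) + (tail var *ₛ f) n  ≈⟨ +-cong (zeroˡ _) (*ₛ-cong {g = const 1#} {h = f} tail-var (λ _ → refl) n) ⟩
      0# + (const 1# *ₛ f) n              ≈⟨ +-identityˡ _ ⟩
      (const 1# *ₛ f) n                   ≈⟨ const-*ₛ 1# f n ⟩
      1# * f n                            ≈⟨ *-identityˡ _ ⟩
      f n                                 ∎
      where
      tail-var : tail var ≈ₛ const 1#
      tail-var zero    = refl
      tail-var (suc m) = refl

    *ₛ-distribʳ : ∀ h f g → (f +ₛ g) *ₛ h ≈ₛ f *ₛ h +ₛ g *ₛ h
    *ₛ-distribʳ h f g zero    = distribʳ _ _ _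
    *ₛ-distribʳ h f g (suc n) = begin
      (f 0 + g 0) * h (suc n) + ((tail f +ₛ tail g) *ₛ h) n
        ≈⟨ +-congˡ (*ₛ-distribʳ h (tail f) (tail g) n) ⟩
      (f 0 + g 0) * h (suc n) + ((tail f *ₛ h) n + (tail g *ₛ h) n)
        ≈⟨ solve 5 (λ a b c d e → (a :+ b) :* c :+ (d :+ e) := (a :* c :+ d) :+ (b :* c :+ e)) refl _ _ _ _ _ ⟩
      (f *ₛ h) (suc n) + (g *ₛ h) (suc n) ∎

    scale-*ₛ : ∀ c f g n → ((λ m → c * f m) *ₛ g) n ≈ c * (f *ₛ g) n
    scale-*ₛ c f g zero    = *-assoc _ _ _
    scale-*ₛ c f g (suc n) = trans (+-cong (*-assoc _ _ _) (scale-*ₛ c (tail f) g n)) (sym (distribˡ _ _ _))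

    *ₛ-assoc : ∀ f g h → (f *ₛ g) *ₛ h ≈ₛ f *ₛ (g *ₛ h)
    *ₛ-assoc f g h zero    = *-assoc _ _ _
    *ₛ-assoc f g h (suc n) = begin
      f 0 * g 0 * h (suc n) + (((λ m → f 0 * g (suc m)) +ₛ tail f *ₛ g) *ₛ h) n
        ≈⟨ +-congˡ (*ₛ-distribʳ h _ _ n) ⟩
      f 0 * g 0 * h (suc n) + (((λ m → f 0 * g (suc m)) *ₛ h) n + ((tail f *ₛ g) *ₛ h) n)
        ≈⟨ +-congˡ (+-cong (scale-*ₛ (f 0) (tail g) h n) (*ₛ-assoc (tail f) g h n)) ⟩
      f 0 * g 0 * h (suc n) + (f 0 * (tail g *ₛ h) n + (tail f *ₛ (g *ₛ h)) n)
        ≈⟨ solve 5 (λ a b c d e → a :* b :* c :+ (a :* d :+ e) := a :* (b :* c :+ d) :+ e) refl _ _ _ _ _ ⟩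
      (f *ₛ (g *ₛ h)) (suc n) ∎

    *ₛ-identityˡ : ∀ f → const 1# *ₛ f ≈ₛ f
    *ₛ-identityˡ f n = trans (const-*ₛ 1# f n) (*-identityˡ _)

    isCommutativeSemiringₛ : IsCommutativeSemiring _≈ₛ_ _+ₛ_ _*ₛ_ (const 0#) (const 1#)
    isCommutativeSemiringₛ = record
      { isSemiring = record
        { isSemiringWithoutAnnihilatingZero = record
          { +-isCommutativeMonoid = record
            { isMonoid = record
              { isSemigroup = record
                { isMagma = record
                  { isEquivalence = record
                    { refl = λ _ → refl ; sym = λ p n → sym (p n) ; trans = λ p q n → trans (p n) (q n) }
                  ; ∙-cong = λ p q n → +-cong (p n) (q n) }
                ; assoc = λ f g h n → +-assoc _ _ _ }
              ; identity = (λ f n → trans (+-congʳ (const-0# n)) (+-identityˡ _))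
                         , (λ f n → trans (+-congˡ (const-0# n)) (+-identityʳ _)) }
            ; comm = λ f g n → +-comm _ _ }
          ; *-cong = *ₛ-cong
          ; *-assoc = *ₛ-assoc
          ; *-identity = *ₛ-identityˡ
                       , (λ f n → trans (*ₛ-comm f (const 1#) n) (*ₛ-identityˡ f n))
          ; distrib = (λ f g h n → trans (*ₛ-comm f (g +ₛ h) n)
                          (trans (*ₛ-distribʳ f g h n) (+-cong (*ₛ-comm g f n) (*ₛ-comm h f n))))
                    , *ₛ-distribʳ }
        ; zero = zeroˡₛ , (λ f n → trans (*ₛ-comm f (const 0#) n) (zeroˡₛ f n)) }
      ; *-comm = *ₛ-comm }
      where
      zeroˡₛ : ∀ f → const 0# *ₛ f ≈ₛ const 0#
      zeroˡₛ f n = trans (zero-*ₛ (const 0#) f const-0# n) (sym (const-0# n))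

    const-+ : ∀ c d → const (c + d) ≈ₛ const c +ₛ const d
    const-+ c d zero    = refl
    const-+ c d (suc n) = sym (+-identityˡ _)

    const-* : ∀ c d → const (c * d) ≈ₛ const c *ₛ const d
    const-* c d zero    = refl
    const-* c d (suc n) = sym (trans (const-*ₛ c (const d) (suc n)) (zeroʳ _))

    const-cong : ∀ {c d} → c ≈ d → const c ≈ₛ const d
    const-cong p zero    = p
    const-cong p (suc n) = refl

    shift : ℕ → Series → Series
    shift k f i = f (k ℕ.+ i)

    -- The p + q + 2 products in this coefficient fall into those whose index in f is at most q and
    -- those whose index in g is at most p. The index p + q + 1 is what makes these two ranges
    -- disjoint and exhaustive.
    *ₛ-split : ∀ f g p q → (f *ₛ g) (suc (q ℕ.+ p)) ≈ (f *ₛ shift (suc p) g) q + (shift (suc q) f *ₛ g) p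
    *ₛ-split f g p zero    = +-congʳ (*-congˡ (reflexive (≡.cong g (≡.sym (ℕₚ.+-identityʳ (suc p))))))
    *ₛ-split f g p (suc q) = begin
      f 0 * g (suc (suc q ℕ.+ p)) + (tail f *ₛ g) (suc (q ℕ.+ p))
        ≈⟨ +-cong (*-congˡ (reflexive (≡.cong (λ k → g (suc k)) (ℕₚ.+-comm (suc q) p)))) (*ₛ-split (tail f) g p q) ⟩
      f 0 * shift (suc p) g (suc q) + ((tail f *ₛ shift (suc p) g) q + (shift (suc (suc q)) f *ₛ g) p)
        ≈⟨ +-assoc _ _ _ ⟨
      (f *ₛ shift (suc p) g) (suc q) + (shift (suc (suc q)) f *ₛ g) p ∎

    series : CommutativeSemiring 0ℓ 0ℓ
    series = record { isCommutativeSemiring = isCommutativeSemiringₛ }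

  -- The kernel method, with the solution guessed: N a b is the generating
  -- function of the ways to complete a face whose state is (a , b).
  module Kernel (R : CommutativeSemiring 0ℓ 0ℓ) where
    open CommutativeSemiring R
    open SemiringSolver R using (solve; _:+_; _:*_; _:=_; con)
    open SetoidReasoning setoid

    pow : Carrier → ℕ → Carrier
    pow r zero    = 1#
    pow r (suc a) = r * pow r a

    -- The quotient (r^a - 1)/(r - 1), written as a sum. For r = 1 + y, `geo-sum` is the identity
    -- that replaces the division by y.
    geo : Carrier → ℕ → Carrier
    geo r zero    = 0#
    geo r (suc a) = geo r a + pow r a

    geo-sum : ∀ y a → 1# + y * geo (1# + y) a ≈ pow (1# + y) a
    geo-sum y zero    = trans (+-congˡ (zeroʳ _)) (+-identityʳ _)
    geo-sum y (suc a) = begin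
      1# + y * (geo (1# + y) a + pow (1# + y) a)
        ≈⟨ solve 3 (λ y g p → con 1 :+ y :* (g :+ p) := (con 1 :+ y :* g) :+ y :* p) refl _ _ _ ⟩
      (1# + y * geo (1# + y) a) + y * pow (1# + y) a
        ≈⟨ +-congʳ (geo-sum y a) ⟩
      pow (1# + y) a + y * pow (1# + y) a
        ≈⟨ solve 2 (λ y p → p :+ y :* p := (con 1 :+ y) :* p) refl _ _ ⟩
      (1# + y) * pow (1# + y) a ∎

    -- Σ over nonempty sets of ranks in {1..a}, with weight u per element and h at the least rank
    choose : Carrier → (ℕ → Carrier) → ℕ → Carrier
    choose u h zero    = 0#
    choose u h (suc a) = choose u h a + (u * choose u h a + u * h (suc a))

    choose-cong : ∀ u {h k} → (∀ a → h a ≈ k a) → ∀ a → choose u h a ≈ choose u k a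
    choose-cong u p zero    = refl
    choose-cong u p (suc a) =
      +-cong (choose-cong u p a) (+-cong (*-congˡ (choose-cong u p a)) (*-congˡ (p (suc a))))

    module _ (x u v y z b : Carrier)
             (y-eq : y ≈ u + x * (y * (1# + y)))
             (z-eq : z ≈ v + x * (z * (1# + z)))
             (b-eq : b ≈ 1# + x * (b * (1# + (y + z)))) where

      -- By `geo-sum`, this is 1 + xb((1 + y)^i + (1 + z)^j - 1), symmetric in the two colours; the
      -- lopsided form avoids the subtraction.
      N : ℕ → ℕ → Carrier
      N i j = 1# + x * (b * (pow (1# + y) i + z * geo (1# + z) j))

      -- Covers the states in which one colour has collapsed to a single available node: `M i` is
      -- `N i 1`, and it is `N 1 i` once the colours are exchanged.
      module OneColour (u y z : Carrier) (y-eq : y ≈ u + x * (y * (1# + y)))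
                       (b-eq : b ≈ 1# + x * (b * (1# + (y + z)))) where
        M : ℕ → Carrier
        M i = 1# + x * (b * (pow (1# + y) i + z))

        -- From a to a + 1 the left side grows by b(1 + y)^a (u + xy(1 + y)). By `y-eq` the last
        -- factor is y, so the growth is that of b(1 + y)^a. The case a = 0 is `b-eq`.
        complete : ∀ a → u * (b * geo (1# + y) a) + M (suc a) ≈ b * pow (1# + y) a
        complete zero = begin
          u * (b * 0#) + (1# + x * (b * ((1# + y) * 1# + z)))
            ≈⟨ solve 5 (λ u b x y z → u :* (b :* con 0) :+ (con 1 :+ x :* (b :* ((con 1 :+ y) :* con 1 :+ z)))
                       := con 1 :+ x :* (b :* (con 1 :+ (y :+ z)))) refl _ _ _ _ _ ⟩
          1# + x * (b * (1# + (y + z))) ≈⟨ b-eq ⟨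
          b ≈⟨ *-identityʳ _ ⟨
          b * 1# ∎
        complete (suc a) = begin
          u * (b * (g + p)) + (1# + x * (b * ((1# + y) * ((1# + y) * p) + z)))
            ≈⟨ solve 7 (λ u b g p x y z →
                  u :* (b :* (g :+ p)) :+ (con 1 :+ x :* (b :* ((con 1 :+ y) :* ((con 1 :+ y) :* p) :+ z)))
                  := (u :* (b :* g) :+ (con 1 :+ x :* (b :* ((con 1 :+ y) :* p :+ z))))
                     :+ b :* p :* (u :+ x :* (y :* (con 1 :+ y)))) refl _ _ _ _ _ _ _ ⟩
          (u * (b * g) + M (suc a)) + b * p * (u + x * (y * (1# + y)))
            ≈⟨ +-cong (complete a) (*-congˡ (sym y-eq)) ⟩
          b * p + b * p * y
            ≈⟨ solve 3 (λ b p y → b :* p :+ b :* p :* y := b :* ((con 1 :+ y) :* p)) refl _ _ _ ⟩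
          b * ((1# + y) * p) ∎
          where
          p = pow (1# + y) a
          g = geo (1# + y) a

        choose-M : ∀ a → choose u M a ≈ u * (b * geo (1# + y) a)
        choose-M zero    = sym (trans (*-congˡ (zeroʳ _)) (zeroʳ _))
        choose-M (suc a) = begin
          choose u M a + (u * choose u M a + u * M (suc a))
            ≈⟨ +-cong (choose-M a) (+-congʳ (*-congˡ (choose-M a))) ⟩
          s + (u * s + u * M (suc a))
            ≈⟨ +-congˡ (distribˡ _ _ _) ⟨
          s + u * (s + M (suc a))
            ≈⟨ +-congˡ (*-congˡ (complete a)) ⟩
          s + u * (b * pow (1# + y) a)
            ≈⟨ solve 4 (λ u b g p → u :* (b :* g) :+ u :* (b :* p) := u :* (b :* (g :+ p))) refl _ _ _ _ ⟩
          u * (b * (geo (1# + y) a + pow (1# + y) a)) ∎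
          where s = u * (b * geo (1# + y) a)

      private
        module Y = OneColour u y z y-eq b-eq
        module Z = OneColour v z y z-eq (trans b-eq (+-congˡ (*-congˡ (*-congˡ (+-congˡ (+-comm _ _))))))

      -- The functional equation: a face stops growing, or one more node, marked by x, is added with
      -- no arrow, with arrows out, or with arrows in. `complete` rewrites (1 + y)^i and splits off
      -- the choices of heads; substituting `z-eq` for the factor z splits off the choices of tails;
      -- what remains regroups to `N (suc i) (suc j)`.
      N-step : ∀ i j → N i j ≈ 1# + x * (N (suc i) (suc j) + (choose u (λ k → N k 1) i + choose v (λ k → N 1 k) j))
      N-step i j = +-congˡ (*-congˡ (begin
        b * (pow (1# + y) i + z * g)
          ≈⟨ distribˡ _ _ _ ⟩
        b * pow (1# + y) i + b * (z * g)
          ≈⟨ +-cong (sym (Y.complete i)) (*-congˡ (*-congʳ z-eq)) ⟩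
        (u * (b * geo (1# + y) i) + Y.M (suc i)) + b * ((v + x * (z * (1# + z))) * g)
          ≈⟨ solve 8 (λ u v x b z g h p →
               (u :* h :+ (con 1 :+ x :* (b :* (p :+ z)))) :+ b :* ((v :+ x :* (z :* (con 1 :+ z))) :* g)
               := (con 1 :+ x :* (b :* (p :+ z :* (g :+ (con 1 :+ z :* g)))))
                  :+ (u :* h :+ v :* (b :* g))) refl u v x b z g (b * geo (1# + y) i) (pow (1# + y) (suc i)) ⟩
        (1# + x * (b * (pow (1# + y) (suc i) + z * (g + (1# + z * g))))) + (u * (b * geo (1# + y) i) + v * (b * g))
          ≈⟨ +-cong (+-congˡ (*-congˡ (*-congˡ (+-congˡ (*-congˡ (+-congˡ (geo-sum z j)))))))
                    (+-cong (trans (sym (Y.choose-M i)) (choose-cong u N-left i))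
                            (trans (sym (Z.choose-M j)) (choose-cong v N-right j))) ⟩
        N (suc i) (suc j) + (choose u (λ k → N k 1) i + choose v (λ k → N 1 k) j) ∎))
        where
        g = geo (1# + z) j
        N-left : ∀ k → Y.M k ≈ N k 1
        N-left k = +-congˡ (*-congˡ (*-congˡ (+-congˡ
          (solve 1 (λ z → z := z :* (con 0 :+ con 1)) refl z))))
        N-right : ∀ k → Z.M k ≈ N 1 k
        N-right k = +-congˡ (*-congˡ (*-congˡ (begin
          pow (1# + z) k + y                ≈⟨ +-congʳ (geo-sum z k) ⟨
          (1# + z * geo (1# + z) k) + y
            ≈⟨ solve 3 (λ z g y → (con 1 :+ z :* g) :+ y := (con 1 :+ y) :* con 1 :+ z :* g) refl _ _ _ ⟩
          (1# + y) * 1# + z * geo (1# + z) k ∎)))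

      N-one-one : N 1 1 ≈ b
      N-one-one = begin
        1# + x * (b * ((1# + y) * 1# + z * (0# + 1#)))
          ≈⟨ solve 4 (λ x b y z → con 1 :+ x :* (b :* ((con 1 :+ y) :* con 1 :+ z :* (con 0 :+ con 1)))
               := con 1 :+ x :* (b :* (con 1 :+ (y :+ z)))) refl _ _ _ _ ⟩
        1# + x * (b * (1# + (y + z))) ≈⟨ b-eq ⟨
        b ∎

  -- The coefficients of the powers of A: recursion, factorial formula, binomial form.

  -- ballot t m k is the coefficient of xᵐuᵏ in Aᵗ, where A = 1 + xA + xuA².
  ballot : ℕ → ℕ → ℕ → ℕ
  ballot zero    zero    zero    = 1
  ballot zero    zero    (suc k) = 0
  ballot zero    (suc m) k       = 0
  ballot (suc t) zero    zero    = 1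
  ballot (suc t) zero    (suc k) = 0
  ballot (suc t) (suc m) zero    = ballot t (suc m) zero ℕ.+ ballot (suc t) m zero
  ballot (suc t) (suc m) (suc k) =
    ballot t (suc m) (suc k) ℕ.+ (ballot (suc t) m (suc k) ℕ.+ ballot (suc (suc t)) m k)

  ballot-vanish : ∀ t m k → m < k → ballot t m k ≡ 0
  ballot-vanish zero    zero    (suc k) _ = ≡.refl
  ballot-vanish zero    (suc m) k       _ = ≡.refl
  ballot-vanish (suc t) zero    (suc k) _ = ≡.refl
  ballot-vanish (suc t) (suc m) (suc k) (s≤s m<k)
    rewrite ballot-vanish t (suc m) (suc k) (s≤s m<k)
          | ballot-vanish (suc t) m (suc k) (ℕₚ.m<n⇒m<1+n m<k)
          | ballot-vanish (suc (suc t)) m k m<k = ≡.refl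

  -- Lagrange inversion gives (t + 1)(d + 2k + t)!/(d! k! (k + t + 1)!) for the coefficient of
  -- x^(d+k) u^k in A^(t+1). With the denominators cleared and m - k named d, it follows by
  -- induction along the recursion of `ballot`.
  ballot-closed : ∀ t d k → ballot (suc t) (d ℕ.+ k) k ℕ.* (d ! ℕ.* k ! ℕ.* (k ℕ.+ suc t) !)
                            ≡ suc t ℕ.* (d ℕ.+ k ℕ.+ k ℕ.+ t) !
  -- The formula one exponent lower, multiplied by k + t + 1 so that the factorials agree with those
  -- of `ballot-closed`. It includes exponent 0, where both sides vanish because A⁰ = 1 has no
  -- positive power of x.
  ballot-closed-pred : ∀ t d k m → suc m ≡ d ℕ.+ k →
    ballot t (suc m) k ℕ.* (d ! ℕ.* k ! ℕ.* (k ℕ.+ suc t) !) ≡ (k ℕ.+ suc t) ℕ.* (t ℕ.* (m ℕ.+ k ℕ.+ t) !)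

  ballot-closed-pred zero    d k m e = ≡.sym (ℕₚ.*-zeroʳ (k ℕ.+ 1))
  ballot-closed-pred (suc t) d k m e = begin
    ballot (suc t) (suc m) k ℕ.* (d ! ℕ.* k ! ℕ.* (k ℕ.+ suc (suc t)) !)
      ≡⟨ ≡.cong₂ (λ a b → ballot (suc t) a k ℕ.* (d ! ℕ.* k ! ℕ.* b !)) e (ℕₚ.+-suc k (suc t)) ⟩
    ballot (suc t) (d ℕ.+ k) k ℕ.* (d ! ℕ.* k ! ℕ.* (suc (k ℕ.+ suc t) ℕ.* (k ℕ.+ suc t) !))
      ≡⟨ shuffle (ballot (suc t) (d ℕ.+ k) k) (d !) (k !) (suc (k ℕ.+ suc t)) ((k ℕ.+ suc t) !) ⟩
    suc (k ℕ.+ suc t) ℕ.* (ballot (suc t) (d ℕ.+ k) k ℕ.* (d ! ℕ.* k ! ℕ.* (k ℕ.+ suc t) !))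
      ≡⟨ ≡.cong₂ ℕ._*_ (≡.sym (ℕₚ.+-suc k (suc t))) (ballot-closed t d k) ⟩
    (k ℕ.+ suc (suc t)) ℕ.* (suc t ℕ.* (d ℕ.+ k ℕ.+ k ℕ.+ t) !)
      ≡⟨ ≡.cong (λ a → (k ℕ.+ suc (suc t)) ℕ.* (suc t ℕ.* a !))
           (≡.trans (≡.cong (λ a → a ℕ.+ k ℕ.+ t) (≡.sym e)) (≡.sym (ℕₚ.+-suc (m ℕ.+ k) t))) ⟩
    (k ℕ.+ suc (suc t)) ℕ.* (suc t ℕ.* (m ℕ.+ k ℕ.+ suc t) !) ∎
    where
    open ≡.≡-Reasoning
    shuffle : ∀ b d k s f → b ℕ.* (d ℕ.* k ℕ.* (s ℕ.* f)) ≡ s ℕ.* (b ℕ.* (d ℕ.* k ℕ.* f))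
    shuffle = solve-∀

  ballot-closed t zero zero = one (t !) t
    where
    one : ∀ f t → 1 ℕ.* (1 ℕ.* 1 ℕ.* (suc t ℕ.* f)) ≡ suc t ℕ.* f
    one = solve-∀
  ballot-closed t (suc d) zero = begin
    (x ℕ.+ y) ℕ.* (suc d ℕ.* e ℕ.* 1 ℕ.* g)
      ≡⟨ lem₁ x y (suc d) e g ⟩
    x ℕ.* (suc d ℕ.* e ℕ.* 1 ℕ.* g) ℕ.+ suc d ℕ.* (y ℕ.* (e ℕ.* 1 ℕ.* g))
      ≡⟨ ≡.cong₂ (λ a b → a ℕ.+ suc d ℕ.* b) (ballot-closed-pred t (suc d) 0 (d ℕ.+ 0) ≡.refl) (ballot-closed t d 0) ⟩
    suc t ℕ.* (t ℕ.* f) ℕ.+ suc d ℕ.* (suc t ℕ.* f)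
      ≡⟨ lem₂ d t f ⟩
    suc t ℕ.* (suc (d ℕ.+ 0 ℕ.+ 0 ℕ.+ t) ℕ.* f) ∎
    where
    open ≡.≡-Reasoning
    x = ballot t (suc d ℕ.+ 0) 0
    y = ballot (suc t) (d ℕ.+ 0) 0
    e = d !
    g = (suc t) !
    f = (d ℕ.+ 0 ℕ.+ 0 ℕ.+ t) !
    lem₁ : ∀ x y s e g → (x ℕ.+ y) ℕ.* (s ℕ.* e ℕ.* 1 ℕ.* g)
           ≡ x ℕ.* (s ℕ.* e ℕ.* 1 ℕ.* g) ℕ.+ s ℕ.* (y ℕ.* (e ℕ.* 1 ℕ.* g))
    lem₁ = solve-∀
    lem₂ : ∀ d t f → suc t ℕ.* (t ℕ.* f) ℕ.+ suc d ℕ.* (suc t ℕ.* f) ≡ suc t ℕ.* (suc (d ℕ.+ 0 ℕ.+ 0 ℕ.+ t) ℕ.* f)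
    lem₂ = solve-∀
  ballot-closed t zero (suc k) = begin
    (x ℕ.+ (y ℕ.+ z)) ℕ.* (1 ℕ.* (suc k ℕ.* e) ℕ.* g)
      -- For d = 0 the middle term asks for a power of u above the power of x, so it vanishes.
      ≡⟨ ≡.cong (λ y → (x ℕ.+ (y ℕ.+ z)) ℕ.* (1 ℕ.* (suc k ℕ.* e) ℕ.* g)) (ballot-vanish (suc t) k (suc k) ℕₚ.≤-refl) ⟩
    (x ℕ.+ z) ℕ.* (1 ℕ.* (suc k ℕ.* e) ℕ.* g)
      ≡⟨ lem₁ x z (suc k) e g ⟩
    x ℕ.* (1 ℕ.* (suc k ℕ.* e) ℕ.* g) ℕ.+ suc k ℕ.* (z ℕ.* (1 ℕ.* e ℕ.* g))
      ≡⟨ ≡.cong₂ (λ a b → a ℕ.+ suc k ℕ.* b) (ballot-closed-pred t 0 (suc k) k ≡.refl) ih ⟩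
    (suc k ℕ.+ suc t) ℕ.* (t ℕ.* f) ℕ.+ suc k ℕ.* (suc (suc t) ℕ.* f)
      ≡⟨ lem₂ k t f ⟩
    suc t ℕ.* (suc (k ℕ.+ suc k ℕ.+ t) ℕ.* f) ∎
    where
    open ≡.≡-Reasoning
    x = ballot t (suc k) (suc k)
    y = ballot (suc t) k (suc k)
    z = ballot (suc (suc t)) k k
    e = k !
    g = (suc k ℕ.+ suc t) !
    f = (k ℕ.+ suc k ℕ.+ t) !
    ih : z ℕ.* (1 ℕ.* e ℕ.* g) ≡ suc (suc t) ℕ.* f
    ih = ≡.trans (≡.cong (λ a → z ℕ.* (1 ℕ.* e ℕ.* a !)) (≡.sym (ℕₚ.+-suc k (suc t))))
         (≡.trans (ballot-closed (suc t) 0 k) (≡.cong (λ a → suc (suc t) ℕ.* a !) (idx k t)))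
      where
      idx : ∀ k t → k ℕ.+ k ℕ.+ suc t ≡ k ℕ.+ suc k ℕ.+ t
      idx = solve-∀
    lem₁ : ∀ x z s e g → (x ℕ.+ z) ℕ.* (1 ℕ.* (s ℕ.* e) ℕ.* g)
           ≡ x ℕ.* (1 ℕ.* (s ℕ.* e) ℕ.* g) ℕ.+ s ℕ.* (z ℕ.* (1 ℕ.* e ℕ.* g))
    lem₁ = solve-∀
    lem₂ : ∀ k t f → (suc k ℕ.+ suc t) ℕ.* (t ℕ.* f) ℕ.+ suc k ℕ.* (suc (suc t) ℕ.* f)
                     ≡ suc t ℕ.* (suc (k ℕ.+ suc k ℕ.+ t) ℕ.* f)
    lem₂ = solve-∀
  ballot-closed t (suc d) (suc k) = begin
    (x ℕ.+ (y ℕ.+ z)) ℕ.* (suc d ℕ.* c ℕ.* (suc k ℕ.* e) ℕ.* g)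
      ≡⟨ lem₁ x y z (suc d) c (suc k) e g ⟩
    x ℕ.* (suc d ℕ.* c ℕ.* (suc k ℕ.* e) ℕ.* g) ℕ.+ suc d ℕ.* (y ℕ.* (c ℕ.* (suc k ℕ.* e) ℕ.* g))
      ℕ.+ suc k ℕ.* (z ℕ.* (suc d ℕ.* c ℕ.* e ℕ.* g))
      ≡⟨ ≡.cong₂ ℕ._+_ (≡.cong₂ (λ a b → a ℕ.+ suc d ℕ.* b)
           (ballot-closed-pred t (suc d) (suc k) (d ℕ.+ suc k) ≡.refl) (ballot-closed t d (suc k)))
           (≡.cong (suc k ℕ.*_) ih) ⟩
    (suc k ℕ.+ suc t) ℕ.* (t ℕ.* f) ℕ.+ suc d ℕ.* (suc t ℕ.* f) ℕ.+ suc k ℕ.* (suc (suc t) ℕ.* f)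
      ≡⟨ lem₂ d k t f ⟩
    suc t ℕ.* (suc (d ℕ.+ suc k ℕ.+ suc k ℕ.+ t) ℕ.* f) ∎
    where
    open ≡.≡-Reasoning
    x = ballot t (suc d ℕ.+ suc k) (suc k)
    y = ballot (suc t) (d ℕ.+ suc k) (suc k)
    z = ballot (suc (suc t)) (d ℕ.+ suc k) k
    c = d !
    e = k !
    g = (suc k ℕ.+ suc t) !
    f = (d ℕ.+ suc k ℕ.+ suc k ℕ.+ t) !
    ih : z ℕ.* (suc d ℕ.* c ℕ.* e ℕ.* g) ≡ suc (suc t) ℕ.* f
    ih = ≡.trans (≡.cong₂ (λ a b → ballot (suc (suc t)) b k ℕ.* (suc d ℕ.* c ℕ.* e ℕ.* a !))
                    (≡.sym (ℕₚ.+-suc k (suc t))) (ℕₚ.+-suc d k))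
         (≡.trans (ballot-closed (suc t) (suc d) k) (≡.cong (λ a → suc (suc t) ℕ.* a !) (idx d k t)))
      where
      idx : ∀ d k t → suc d ℕ.+ k ℕ.+ k ℕ.+ suc t ≡ d ℕ.+ suc k ℕ.+ suc k ℕ.+ t
      idx = solve-∀
    lem₁ : ∀ x y z s c r e g → (x ℕ.+ (y ℕ.+ z)) ℕ.* (s ℕ.* c ℕ.* (r ℕ.* e) ℕ.* g)
           ≡ x ℕ.* (s ℕ.* c ℕ.* (r ℕ.* e) ℕ.* g) ℕ.+ s ℕ.* (y ℕ.* (c ℕ.* (r ℕ.* e) ℕ.* g))
             ℕ.+ r ℕ.* (z ℕ.* (s ℕ.* c ℕ.* e ℕ.* g))
    lem₁ = solve-∀
    lem₂ : ∀ d k t f → (suc k ℕ.+ suc t) ℕ.* (t ℕ.* f) ℕ.+ suc d ℕ.* (suc t ℕ.* f) ℕ.+ suc k ℕ.* (suc (suc t) ℕ.* f)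
                     ≡ suc t ℕ.* (suc (d ℕ.+ suc k ℕ.+ suc k ℕ.+ t) ℕ.* f)
    lem₂ = solve-∀

  nCk*k!*[n∸k]!≡n! : ∀ {n k} → k ≤ n → (n C k) ℕ.* (k ! ℕ.* (n ∸ k) !) ≡ n !
  nCk*k!*[n∸k]!≡n! {n} {k} k≤n =
    ≡.trans (≡.cong (ℕ._* (k ! ℕ.* (n ∸ k) !)) (nCk≡n!/k![n-k]! k≤n)) (m/n*n≡m (k![n∸k]!∣n! k≤n))
    where instance _ = ℕₚ._!*_!≢0 k (n ∸ k)

  ballot-binomial : ∀ n k → suc k ℕ.* ballot 1 n k ≡ ((n ℕ.+ k) C k) ℕ.* (n C k)
  ballot-binomial n k with k ℕₚ.≤? n
  ... | no k≰n
    rewrite ballot-vanish 1 n k (ℕₚ.≰⇒> k≰n) | k>n⇒nCk≡0 {n} {k} (ℕₚ.≰⇒> k≰n) =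
    ≡.trans (ℕₚ.*-zeroʳ (suc k)) (≡.sym (ℕₚ.*-zeroʳ ((n ℕ.+ k) C k)))
  -- This common factor turns both sides into (n + k)! n!.
  ... | yes k≤n = ℕₚ.*-cancelʳ-≡ _ _ (k ! ℕ.* d ! ℕ.* (k ! ℕ.* n !)) {{nz}} (begin
    suc k ℕ.* ballot 1 n k ℕ.* (k ! ℕ.* d ! ℕ.* (k ! ℕ.* n !))
      ≡⟨ lem₁ (suc k) (ballot 1 n k) (k !) (d !) (n !) ⟩
    ballot 1 n k ℕ.* (d ! ℕ.* k ! ℕ.* (suc k) !) ℕ.* n !
      ≡⟨ ≡.cong (ℕ._* n !) closed ⟩
    (n ℕ.+ k) ! ℕ.* n !
      ≡⟨ ≡.cong₂ ℕ._*_ (nCk*k!*[n∸k]!≡n! (ℕₚ.m≤n+m k n)) (nCk*k!*[n∸k]!≡n! k≤n) ⟨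
    ((n ℕ.+ k) C k) ℕ.* (k ! ℕ.* (n ℕ.+ k ∸ k) !) ℕ.* ((n C k) ℕ.* (k ! ℕ.* d !))
      ≡⟨ ≡.cong (λ a → ((n ℕ.+ k) C k) ℕ.* (k ! ℕ.* a !) ℕ.* ((n C k) ℕ.* (k ! ℕ.* d !))) (ℕₚ.m+n∸n≡m n k) ⟩
    ((n ℕ.+ k) C k) ℕ.* (k ! ℕ.* n !) ℕ.* ((n C k) ℕ.* (k ! ℕ.* d !))
      ≡⟨ lem₂ ((n ℕ.+ k) C k) (n C k) (k !) (d !) (n !) ⟩
    ((n ℕ.+ k) C k) ℕ.* (n C k) ℕ.* (k ! ℕ.* d ! ℕ.* (k ! ℕ.* n !)) ∎)
    where
    open ≡.≡-Reasoning
    d = n ∸ k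
    nz : NonZero (k ! ℕ.* d ! ℕ.* (k ! ℕ.* n !))
    nz = ℕₚ.m*n≢0 _ _ {{ℕₚ._!*_!≢0 k d}} {{ℕₚ._!*_!≢0 k n}}
    closed : ballot 1 n k ℕ.* (d ! ℕ.* k ! ℕ.* (suc k) !) ≡ (n ℕ.+ k) !
    closed = ≡.trans
      (≡.cong₂ (λ a b → ballot 1 a k ℕ.* (d ! ℕ.* k ! ℕ.* b !)) (≡.sym (ℕₚ.m∸n+n≡m k≤n)) (≡.sym (ℕₚ.+-comm k 1)))
      (≡.trans (ballot-closed 0 d k) (≡.trans (ℕₚ.*-identityˡ _)
        (≡.cong _! (≡.trans (ℕₚ.+-identityʳ _) (≡.cong (ℕ._+ k) (ℕₚ.m∸n+n≡m k≤n))))))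
    lem₁ : ∀ s b k d n → s ℕ.* b ℕ.* (k ℕ.* d ℕ.* (k ℕ.* n)) ≡ b ℕ.* (d ℕ.* k ℕ.* (s ℕ.* k)) ℕ.* n
    lem₁ = solve-∀
    lem₂ : ∀ a b k d n → a ℕ.* (k ℕ.* n) ℕ.* (b ℕ.* (k ℕ.* d)) ≡ a ℕ.* b ℕ.* (k ℕ.* d ℕ.* (k ℕ.* n))
    lem₂ = solve-∀

  𝟙 : Bool → ℕ
  𝟙 true  = 1
  𝟙 false = 0

  -- A series in x, u, v is indexed by the exponents of v, u, x in this order.
  module PX = PowerSeries ℕₚ.+-*-commutativeSemiring
  module PU = PowerSeries PX.series
  module PV = PowerSeries PU.series

  module QX = CommutativeSemiring PX.series
  module QU = CommutativeSemiring PU.series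
  module QV = CommutativeSemiring PV.series

  -- The one-colour series A and Y = uA.

  module Schröder where
    open QU hiding (zero)
    open SetoidReasoning setoid

    x u : Carrier
    x = PU.const PX.var
    u = PU.var

    A^_ : ℕ → Carrier
    (A^ t) k m = ballot t m k

    A : Carrier
    A = A^ 1

    x-*-zero : ∀ f k → (x * f) k 0 ≡ 0
    x-*-zero f k = ≡.trans (PU.const-*ₛ PX.var f k 0) (PX.var-*ₛ-zero (f k))

    x-*-suc : ∀ f k m → (x * f) k (suc m) ≡ f k m
    x-*-suc f k m = ≡.trans (PU.const-*ₛ PX.var f k (suc m)) (PX.var-*ₛ-suc (f k) m)

    Recursive : (ℕ → Carrier) → Set
    Recursive D = ∀ t → D (suc t) ≈ D t + x * (D (suc t) + u * D (suc (suc t)))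

    -- The higher exponents occur only behind a factor x, and exponent t occurs at the same degree
    -- in x. Induction on that degree, and within it on t, therefore determines the family from its
    -- member at 0.
    recursive-unique : ∀ D E → Recursive D → Recursive E → D 0 ≈ E 0 → ∀ m t k → D t k m ≡ E t k m
    recursive-unique D E dr er z m zero k = z k m
    recursive-unique D E dr er z zero (suc t) k =
      ≡.trans (dr t k 0) (≡.trans (≡.cong₂ ℕ._+_ (recursive-unique D E dr er z zero t k)
        (≡.trans (x-*-zero (D (suc t) + u * D (suc (suc t))) k) (≡.sym (x-*-zero (E (suc t) + u * E (suc (suc t))) k))))
        (≡.sym (er t k 0)))
    recursive-unique D E dr er z (suc m) (suc t) k =
      ≡.trans (dr t k (suc m)) (≡.trans (≡.cong₂ ℕ._+_ (recursive-unique D E dr er z (suc m) t k)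
        (≡.trans (x-*-suc (D (suc t) + u * D (suc (suc t))) k m) (≡.trans
          (≡.cong₂ ℕ._+_ (recursive-unique D E dr er z m (suc t) k) (u-part k))
        (≡.sym (x-*-suc (E (suc t) + u * E (suc (suc t))) k m)))))
        (≡.sym (er t k (suc m))))
      where
      u-part : ∀ k → (u * D (suc (suc t))) k m ≡ (u * E (suc (suc t))) k m
      u-part zero    = ≡.trans (PU.var-*ₛ-zero (D (suc (suc t))) m) (≡.sym (PU.var-*ₛ-zero (E (suc (suc t))) m))
      u-part (suc k) = ≡.trans (PU.var-*ₛ-suc (D (suc (suc t))) k m)
        (≡.trans (recursive-unique D E dr er z m (suc (suc t)) k) (≡.sym (PU.var-*ₛ-suc (E (suc (suc t))) k m)))

    A^0 : A^ 0 ≈ 1#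
    A^0 zero    zero    = ≡.refl
    A^0 zero    (suc m) = ≡.refl
    A^0 (suc k) zero    = ≡.refl
    A^0 (suc k) (suc m) = ≡.refl

    A^-recursive : Recursive A^_
    A^-recursive t k zero = ≡.sym (≡.trans (≡.cong (ballot t 0 k ℕ.+_) (x-*-zero ((A^ suc t) + u * (A^ suc (suc t))) k)) (base t k))
      where
      base : ∀ t k → ballot t 0 k ℕ.+ 0 ≡ ballot (suc t) 0 k
      base zero    zero    = ≡.refl
      base zero    (suc k) = ≡.refl
      base (suc t) zero    = ≡.refl
      base (suc t) (suc k) = ≡.refl
    A^-recursive t zero (suc m) = ≡.sym (≡.cong (ballot t (suc m) 0 ℕ.+_)
      (≡.trans (x-*-suc ((A^ suc t) + u * (A^ suc (suc t))) 0 m)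
      (≡.trans (≡.cong (ballot (suc t) m 0 ℕ.+_) (≡.trans (PU.var-*ₛ-zero (A^ suc (suc t)) m) (PX.const-0# m))) (ℕₚ.+-identityʳ _))))
    A^-recursive t (suc k) (suc m) = ≡.sym (≡.cong (ballot t (suc m) (suc k) ℕ.+_)
      (≡.trans (x-*-suc ((A^ suc t) + u * (A^ suc (suc t))) (suc k) m)
        (≡.cong (ballot (suc t) m (suc k) ℕ.+_) (PU.var-*ₛ-suc (A^ suc (suc t)) k m))))

    -- `A^_` is given by coefficients, so multiplicativity has to be derived: the families A^(t+1)
    -- and A^t · A satisfy the same recursion and agree at t = 0.
    A-squared : A^ 2 ≈ A * A
    A-squared k m = recursive-unique (λ t → A^ suc t) (λ t → (A^ t) * A) (λ t → A^-recursive (suc t)) rec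
      (sym (trans (*-congʳ {A} A^0) (*-identityˡ A))) m 1 k
      where
      open SemiringSolver PU.series using (solve; _:+_; _:*_; _:=_)
      rec : Recursive (λ t → (A^ t) * A)
      rec t = begin
        (A^ suc t) * A ≈⟨ *-congʳ {A} (A^-recursive t) ⟩
        ((A^ t) + x * ((A^ suc t) + u * (A^ suc (suc t)))) * A
          ≈⟨ solve 6 (λ a b c x u z → (a :+ x :* (b :+ u :* c)) :* z := a :* z :+ x :* (b :* z :+ u :* (c :* z)))
               refl (A^ t) (A^ suc t) (A^ suc (suc t)) x u A ⟩
        (A^ t) * A + x * ((A^ suc t) * A + u * ((A^ suc (suc t)) * A)) ∎

    A-eq : A ≈ 1# + x * (A + u * (A * A))
    A-eq = trans (A^-recursive 0) (+-cong A^0 (*-congˡ {x} (+-congˡ {A} (*-congˡ {u} A-squared))))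

    Y : Carrier
    Y = u * A

    Y-eq : Y ≈ u + x * (Y * (1# + Y))
    Y-eq = trans (*-congˡ {u} A-eq)
      (solve 3 (λ u x a → u :* (con 1 :+ x :* (a :+ u :* (a :* a))) := u :+ x :* (u :* a :* (con 1 :+ u :* a)))
        refl u x A)
      where open SemiringSolver PU.series using (solve; _:+_; _:*_; _:=_; con)

  -- The two-colour series b and its equation.

  module TwoColour where
    open Schröder using (Y; A)
    open QV hiding (zero)
    private module P = Schröder
    open SetoidReasoning setoid
    open Kernel PV.series

    -- The substitution of v for u: the coefficient of each power of v is free of u.
    coloured : QU.Carrier → Carrier
    coloured f q = PU.const (f q)

    coloured-* : ∀ f g → coloured (f QU.* g) ≈ coloured f * coloured g
    coloured-* f g zero    = PU.const-* (f 0) (g 0)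
    coloured-* f g (suc q) = QU.trans (PU.const-+ (f 0 QX.* g (suc q)) ((PU.tail f QU.* g) q))
      (QU.+-cong (PU.const-* (f 0) (g (suc q))) (coloured-* (PU.tail f) g q))

    coloured-+ : ∀ f g → coloured (f QU.+ g) ≈ coloured f + coloured g
    coloured-+ f g q = PU.const-+ (f q) (g q)

    -- `b` is (Yᵤ - Yᵥ)/(u - v). Since Y = uA, each power of u contributes (u^(k+1) - v^(k+1))/(u -
    -- v), which is the sum of all u^p v^q with p + q = k; hence the coefficient `A (q ℕ.+ p)`,
    -- without a division.
    x u v y z b : Carrier
    x = PV.const P.x
    u = PV.const P.u
    v = PV.var
    y = PV.const Y
    z = coloured Y
    b q p = A (q ℕ.+ p)

    coloured-u : coloured P.u ≈ v
    coloured-u zero          = QU.refl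
    coloured-u (suc zero)    = QU.refl
    coloured-u (suc (suc q)) = QU.refl

    coloured-x : coloured P.x ≈ x
    coloured-x zero    = QU.refl
    coloured-x (suc q) = QU.refl

    coloured-1 : coloured QU.1# ≈ 1#
    coloured-1 zero    = QU.refl
    coloured-1 (suc q) = QU.refl

    y-eq : y ≈ u + x * (y * (1# + y))
    y-eq = begin
      PV.const Y                                                    ≈⟨ PV.const-cong P.Y-eq ⟩
      PV.const (P.u QU.+ P.x QU.* (Y QU.* (QU.1# QU.+ Y)))           ≈⟨ PV.const-+ _ _ ⟩
      u + PV.const (P.x QU.* (Y QU.* (QU.1# QU.+ Y)))                ≈⟨ +-congˡ {u} (PV.const-* _ _) ⟩
      u + x * PV.const (Y QU.* (QU.1# QU.+ Y))                       ≈⟨ +-congˡ {u} (*-congˡ {x} (PV.const-* _ _)) ⟩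
      u + x * (y * PV.const (QU.1# QU.+ Y))                          ≈⟨ +-congˡ {u} (*-congˡ {x} (*-congˡ {y} (PV.const-+ _ _))) ⟩
      u + x * (y * (1# + y))                                         ∎

    z-eq : z ≈ v + x * (z * (1# + z))
    z-eq = begin
      coloured Y
        ≈⟨ (λ q → PU.const-cong (P.Y-eq q)) ⟩
      coloured (P.u QU.+ P.x QU.* (Y QU.* (QU.1# QU.+ Y)))
        ≈⟨ coloured-+ P.u (P.x QU.* (Y QU.* (QU.1# QU.+ Y))) ⟩
      coloured P.u + coloured (P.x QU.* (Y QU.* (QU.1# QU.+ Y)))
        ≈⟨ +-cong coloured-u (coloured-* P.x (Y QU.* (QU.1# QU.+ Y))) ⟩
      v + coloured P.x * coloured (Y QU.* (QU.1# QU.+ Y))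
        ≈⟨ +-congˡ {v} (*-cong coloured-x (coloured-* Y (QU.1# QU.+ Y))) ⟩
      v + x * (z * coloured (QU.1# QU.+ Y))
        ≈⟨ +-congˡ {v} (*-congˡ {x} (*-congˡ {z} (trans (coloured-+ QU.1# Y) (+-congʳ {z} coloured-1)))) ⟩
      v + x * (z * (1# + z)) ∎

    -- A series in v alone acts separately on the coefficients of each fixed power of u.
    column : ∀ (f : Carrier) g q p → (f * coloured g) q p QX.≈ ((λ s → f s p) QU.* g) q
    column f g zero p = QX.trans (QU.*-comm (f 0) (PU.const (g 0)) p)
      (QX.trans (PU.const-*ₛ (g 0) (f 0) p) (QX.*-comm (g 0) (f 0 p)))
    column f g (suc q) p = QX.+-cong
      (QX.trans (QU.*-comm (f 0) (PU.const (g (suc q))) p)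
        (QX.trans (PU.const-*ₛ (g (suc q)) (f 0) p) (QX.*-comm (g (suc q)) (f 0 p))))
      (column (PV.tail f) g q p)

    -- The coefficient of u^p v^q in b(y + z) is the convolution of A with itself at p + q − 1,
    -- cut at p; this is why b, whose coefficients depend on p + q alone, solves b-eq.
    b-y : ∀ q p → (b * y) q p QX.≈ (PU.shift q A QU.* Y) p
    b-y q p = QX.trans (*-comm b y q p) (QX.trans (PV.const-*ₛ Y b q p) (QU.*-comm Y (b q) p))

    b-z : ∀ q p → (b * z) q p QX.≈ (PU.shift p A QU.* Y) q
    b-z q p = QX.trans (column b Y q p)
      (QU.*-congʳ {Y} (λ s → QX.reflexive (≡.cong A (ℕₚ.+-comm s p))) q)

    *-Y-zero : ∀ f → (f QU.* Y) 0 QX.≈ QX.0#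
    *-Y-zero f = QX.trans (QX.*-congˡ {f 0} (PU.var-*ₛ-zero A)) (QX.zeroʳ (f 0))

    *-Y-suc : ∀ f p → (f QU.* Y) (suc p) QX.≈ (f QU.* A) p
    *-Y-suc f p = QX.trans (QX.trans (QU.*-comm f Y (suc p)) (QU.*-assoc P.u A f (suc p)))
      (QX.trans (PU.var-*ₛ-suc (A QU.* f) p) (QU.*-comm A f p))

    A-suc : ∀ n → A (suc n) QX.≈ PX.var QX.* (A (suc n) QX.+ (A QU.* A) n)
    A-suc n = QX.trans (P.A-eq (suc n)) (QX.trans (QX.+-identityˡ _)
      (QX.trans (PU.const-*ₛ PX.var (A QU.+ P.u QU.* (A QU.* A)) (suc n))
        (QX.*-congˡ {PX.var} (QX.+-congˡ {A (suc n)} (PU.var-*ₛ-suc (A QU.* A) n)))))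

    A-zero : A 0 QX.≈ QX.1# QX.+ PX.var QX.* A 0
    A-zero = QX.trans (P.A-eq 0) (QX.+-congˡ {QX.1#} (QX.trans
      (PU.const-*ₛ PX.var (A QU.+ P.u QU.* (A QU.* A)) 0)
      (QX.*-congˡ {PX.var} (QX.trans (QX.+-congˡ {A 0} (PU.var-*ₛ-zero (A QU.* A))) (QX.+-identityʳ (A 0))))))

    -- Multiplication by Y = uA shifts the index by one, so the two products run over exactly the
    -- two ranges of `*ₛ-split`. If p or q is zero, one of the ranges is empty.
    cut : ∀ q p n → suc n ≡ q ℕ.+ p → (b * y) q p QX.+ (b * z) q p QX.≈ (A QU.* A) n
    cut zero (suc p) .p ≡.refl = QX.trans (QX.+-cong (QX.trans (b-y 0 (suc p)) (*-Y-suc A p))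
      (QX.trans (b-z 0 (suc p)) (*-Y-zero (PU.shift (suc p) A)))) (QX.+-identityʳ _)
    cut (suc q) zero .(q ℕ.+ 0) ≡.refl = QX.trans (QX.+-cong
      (QX.trans (b-y (suc q) 0) (*-Y-zero (PU.shift (suc q) A)))
      (QX.trans (b-z (suc q) 0) (*-Y-suc A q)))
      (QX.trans (QX.+-identityˡ _) (QX.reflexive (≡.cong (A QU.* A) (≡.sym (ℕₚ.+-identityʳ q)))))
    cut (suc q) (suc p) .(q ℕ.+ suc p) ≡.refl = QX.trans (QX.+-cong
      (QX.trans (b-y (suc q) (suc p)) (*-Y-suc (PU.shift (suc q) A) p))
      (QX.trans (b-z (suc q) (suc p)) (QX.trans (*-Y-suc (PU.shift (suc p) A) q) (QU.*-comm (PU.shift (suc p) A) A q))))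
      (QX.trans (QX.+-comm ((PU.shift (suc q) A QU.* A) p) ((A QU.* PU.shift (suc p) A) q)) (QX.trans (QX.sym (PU.*ₛ-split A A p q))
        (QX.reflexive (≡.cong (A QU.* A) (≡.sym (ℕₚ.+-suc q p))))))

    b-eq : b ≈ 1# + x * (b * (1# + (y + z)))
    b-eq = trans b-eq′ (+-congˡ {1#} (*-congˡ {x}
      (solve 3 (λ b y z → b :+ (b :* y :+ b :* z) := b :* (con 1 :+ (y :+ z))) refl b y z)))
      where
      open SemiringSolver PV.series using (solve; _:+_; _:*_; _:=_; con)
      x-coeff : ∀ f q p → (x * f) q p QX.≈ PX.var QX.* f q p
      x-coeff f q p = QX.trans (PV.const-*ₛ P.x f q p) (PU.const-*ₛ PX.var (f q) p)
      positive : ∀ q p n → suc n ≡ q ℕ.+ p → 1# q p QX.≈ QX.0# →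
                 b q p QX.≈ (1# + x * (b + (b * y + b * z))) q p
      positive q p n e o = QX.trans (QX.trans (QX.reflexive (≡.cong A (≡.sym e))) (QX.trans (A-suc n)
        (QX.*-congˡ {PX.var} (QX.+-cong (QX.reflexive (≡.cong A e)) (QX.sym (cut q p n e))))))
        (QX.trans (QX.sym (x-coeff (b + (b * y + b * z)) q p))
          (QX.trans (QX.sym (QX.+-identityˡ _)) (QX.+-congʳ {(x * (b + (b * y + b * z))) q p} (QX.sym o))))
      b-eq′ : b ≈ 1# + x * (b + (b * y + b * z))
      b-eq′ zero zero = QX.trans A-zero (QX.+-congˡ {QX.1#} (QX.trans
        (QX.*-congˡ {PX.var} (QX.trans (QX.sym (QX.+-identityʳ (A 0))) (QX.+-congˡ {A 0} (QX.sym
          (QX.trans (QX.+-cong (QX.trans (b-y 0 0) (*-Y-zero A)) (QX.trans (b-z 0 0) (*-Y-zero A)))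
            (QX.+-identityˡ QX.0#))))))
        (QX.sym (x-coeff (b + (b * y + b * z)) 0 0))))
      b-eq′ zero (suc p) = positive 0 (suc p) p ≡.refl QX.refl
      b-eq′ (suc q) zero = positive (suc q) 0 (q ℕ.+ 0) ≡.refl QX.refl
      b-eq′ (suc q) (suc p) = positive (suc q) (suc p) (q ℕ.+ suc p) ≡.refl QX.refl

  -- Completions of a face one node at a time: w a b p q is the weight of a state with a heads and
  -- b tails available, p forward and q backward arrows.
  chooseℕ : (ℕ → ℕ → ℕ) → ℕ → ℕ
  chooseℕ w zero    = 0
  chooseℕ w (suc a) = chooseℕ w a ℕ.+ (chooseℕ (λ j c → w j (suc c)) a ℕ.+ w (suc a) 1)

  Weight : Set
  Weight = ℕ → ℕ → ℕ → ℕ → ℕ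

  -- The summands are the three ways to add a node. Without arrows it becomes available both as head
  -- and as tail. As the tail of c arrows it leaves j of the heads and itself as the only tail. As
  -- the head of c arrows it does the reverse.
  transfer : Weight → Weight
  transfer w a b p q = w (suc a) (suc b) p q
    ℕ.+ (chooseℕ (λ j c → w j 1 (c ℕ.+ p) q) a ℕ.+ chooseℕ (λ j c → w 1 j p (c ℕ.+ q)) b)

  iterate : ℕ → Weight → Weight
  iterate zero    w = w
  iterate (suc n) w = iterate n (transfer w)

  chooseℕ-cong : ∀ {w w′} → (∀ j c → w j c ≡ w′ j c) → ∀ a → chooseℕ w a ≡ chooseℕ w′ a
  chooseℕ-cong e zero    = ≡.refl
  chooseℕ-cong e (suc a) = ≡.cong₂ ℕ._+_ (chooseℕ-cong e a)
    (≡.cong₂ ℕ._+_ (chooseℕ-cong (λ j c → e j (suc c)) a) (e (suc a) 1))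

  transfer-cong : ∀ {w w′} → (∀ a b p q → w a b p q ≡ w′ a b p q) → ∀ a b p q → transfer w a b p q ≡ transfer w′ a b p q
  transfer-cong e a b p q = ≡.cong₂ ℕ._+_ (e _ _ _ _)
    (≡.cong₂ ℕ._+_ (chooseℕ-cong (λ j c → e j 1 _ q) a) (chooseℕ-cong (λ j c → e 1 j p _) b))

  iterate-cong : ∀ n {w w′} → (∀ a b p q → w a b p q ≡ w′ a b p q) → ∀ a b p q → iterate n w a b p q ≡ iterate n w′ a b p q
  iterate-cong zero    e = e
  iterate-cong (suc n) e = iterate-cong n (transfer-cong e)

  target : ℕ → ℕ → Weight
  target i j a b p q = 𝟙 ((p ≡ᵇ i) ∧ (q ≡ᵇ j))

  -- The coefficients of `N` solve the recursion.

  module Completions (i j : ℕ) where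
    open TwoColour
    open QV hiding (zero)
    open Kernel PV.series
    open SemiringSolver PV.series using (solve; _:+_; _:*_; _:=_; con)

    completed : ℕ → ℕ → Carrier
    completed = N x u v y z b y-eq z-eq b-eq

    coeff : ℕ → Carrier → ℕ
    coeff m r = r j i m

    shifted : ℕ → ℕ → Carrier → Carrier
    shifted p q r = pow u p * (pow v q * r)

    weight : ℕ → Weight
    weight m a b p q = coeff m (shifted p q (completed a b))

    pow-+ : ∀ r c p → pow r (c ℕ.+ p) ≈ pow r c * pow r p
    pow-+ r zero    p = sym (*-identityˡ _)
    pow-+ r (suc c) p = trans (*-congˡ {r} (pow-+ r c p)) (sym (*-assoc _ _ _))

    -- Stated for every additive φ because the induction replaces φ by φ precomposed with
    -- multiplication by t: the greatest rank, once chosen, contributes one factor t.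
    chooseℕ-additive : ∀ (φ : Carrier → ℕ) → (∀ {r s} → r ≈ s → φ r ≡ φ s) → φ 0# ≡ 0 →
      (∀ r s → φ (r + s) ≡ φ r ℕ.+ φ s) →
      ∀ t h a → chooseℕ (λ k c → φ (pow t c * h k)) a ≡ φ (choose t h a)
    chooseℕ-additive φ φ-cong φ-0 φ-+ t h zero    = ≡.sym φ-0
    chooseℕ-additive φ φ-cong φ-0 φ-+ t h (suc a) = ≡.trans
      (≡.cong₂ ℕ._+_ (chooseℕ-additive φ φ-cong φ-0 φ-+ t h a) (≡.cong₂ ℕ._+_
        (≡.trans (chooseℕ-cong (λ k c → φ-cong (*-assoc t (pow t c) (h k))) a)
          (chooseℕ-additive (λ r → φ (t * r)) (λ e → φ-cong (*-congˡ {t} e))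
            (≡.trans (φ-cong (zeroʳ t)) φ-0) (λ r s → ≡.trans (φ-cong (distribˡ t r s)) (φ-+ _ _)) t h a))
        (φ-cong (*-congʳ {h (suc a)} (*-identityʳ t)))))
      (≡.sym (≡.trans (φ-+ _ _) (≡.cong (φ (choose t h a) ℕ.+_) (φ-+ _ _))))

    coeff-x-zero : ∀ r → coeff 0 (x * r) ≡ 0
    coeff-x-zero r = ≡.trans (PV.const-*ₛ Schröder.x r j i 0) (Schröder.x-*-zero (r j) i)

    coeff-x-suc : ∀ r m → coeff (suc m) (x * r) ≡ coeff m r
    coeff-x-suc r m = ≡.trans (PV.const-*ₛ Schröder.x r j i (suc m)) (Schröder.x-*-suc (r j) i m)

  coeff-monomial : ∀ i j m p q → Completions.coeff i j m (Completions.shifted i j p q QV.1#)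
                   ≡ 𝟙 (((p ≡ᵇ i) ∧ (q ≡ᵇ j)) ∧ (0 ≡ᵇ m))
  coeff-monomial i j m zero q = ≡.trans (QV.*-identityˡ (Kernel.pow PV.series PV.var q QV.* QV.1#) j i m) (v-part i j q)
    where
    open Kernel PV.series
    v-part : ∀ i j q → (pow PV.var q QV.* QV.1#) j i m ≡ 𝟙 (((0 ≡ᵇ i) ∧ (q ≡ᵇ j)) ∧ (0 ≡ᵇ m))
    v-part i j zero = ≡.trans (QV.*-identityˡ QV.1# j i m) (one i j m)
      where
      one : ∀ i j m → QV.1# j i m ≡ 𝟙 (((0 ≡ᵇ i) ∧ (0 ≡ᵇ j)) ∧ (0 ≡ᵇ m))
      one zero    zero    zero    = ≡.refl
      one zero    zero    (suc m) = ≡.refl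
      one (suc i) zero    zero    = ≡.refl
      one (suc i) zero    (suc m) = ≡.refl
      one zero    (suc j) zero    = ≡.refl
      one zero    (suc j) (suc m) = ≡.refl
      one (suc i) (suc j) zero    = ≡.refl
      one (suc i) (suc j) (suc m) = ≡.refl
    v-part i zero (suc q) = ≡.trans (QV.*-assoc PV.var (pow PV.var q) QV.1# 0 i m)
      (≡.trans (PV.var-*ₛ-zero (pow PV.var q QV.* QV.1#) i m) (absent i m))
      where
      absent : ∀ i m → QU.0# i m ≡ 𝟙 (((0 ≡ᵇ i) ∧ false) ∧ (0 ≡ᵇ m))
      absent zero    zero    = ≡.refl
      absent zero    (suc m) = ≡.refl
      absent (suc i) zero    = ≡.refl
      absent (suc i) (suc m) = ≡.refl
    v-part i (suc j) (suc q) = ≡.trans (QV.*-assoc PV.var (pow PV.var q) QV.1# (suc j) i m)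
      (≡.trans (PV.var-*ₛ-suc (pow PV.var q QV.* QV.1#) j i m) (v-part i j q))
  coeff-monomial zero j m (suc p) q = ≡.trans (QV.*-assoc TwoColour.u (Kernel.pow PV.series TwoColour.u p) r j 0 m)
    (≡.trans (PV.const-*ₛ PU.var r′ j 0 m) (≡.trans (PU.var-*ₛ-zero (r′ j) m) (PX.const-0# m)))
    where
    r = Kernel.pow PV.series PV.var q QV.* QV.1#
    r′ = Kernel.pow PV.series TwoColour.u p QV.* r
  coeff-monomial (suc i) j m (suc p) q = ≡.trans (QV.*-assoc TwoColour.u (Kernel.pow PV.series TwoColour.u p) r j (suc i) m)
    (≡.trans (PV.const-*ₛ PU.var r′ j (suc i) m) (≡.trans (PU.var-*ₛ-suc (r′ j) i m) (coeff-monomial i j m p q)))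
    where
    r = Kernel.pow PV.series PV.var q QV.* QV.1#
    r′ = Kernel.pow PV.series TwoColour.u p QV.* r

  module _ (i j : ℕ) where
    open Completions i j
    open TwoColour
    open QV hiding (zero)
    open Kernel PV.series
    open SemiringSolver PV.series using (solve; _:+_; _:*_; _:=_; con)

    private
      later : ℕ → ℕ → Carrier
      later a b = completed (suc a) (suc b) + (choose u (λ k → completed k 1) a + choose v (λ k → completed 1 k) b)

      expand : ∀ a b p q → shifted p q (completed a b) ≈ shifted p q 1# + x * shifted p q (later a b)
      expand a b p q = trans (*-congˡ {pow u p} (*-congˡ {pow v q} (N-step x u v y z _ y-eq z-eq b-eq a b)))
        (solve 4 (λ p q x l → p :* (q :* (con 1 :+ x :* l)) := p :* (q :* con 1) :+ x :* (p :* (q :* l)))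
          refl (pow u p) (pow v q) x (later a b))

      coeff-cong : ∀ m {r s} → r ≈ s → coeff m r ≡ coeff m s
      coeff-cong m e = e j i m

      shifted-cong : ∀ p q {r s} → r ≈ s → shifted p q r ≈ shifted p q s
      shifted-cong p q e = *-congˡ {pow u p} (*-congˡ {pow v q} e)

      shifted-+ : ∀ p q r s → shifted p q (r + s) ≈ shifted p q r + shifted p q s
      shifted-+ p q r s = solve 4 (λ p q r s → p :* (q :* (r :+ s)) := p :* (q :* r) :+ p :* (q :* s))
        refl (pow u p) (pow v q) r s

      φ : ℕ → ℕ → ℕ → Carrier → ℕ
      φ m p q r = coeff m (shifted p q r)

      φ-0 : ∀ m p q → φ m p q 0# ≡ 0
      φ-0 m p q = ≡.trans (coeff-cong m (trans (*-congˡ {pow u p} (zeroʳ (pow v q))) (zeroʳ (pow u p)))) (zero-coeff j i m)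
        where
        zero-coeff : ∀ j i m → 0# j i m ≡ 0
        zero-coeff zero    zero    zero    = ≡.refl
        zero-coeff zero    zero    (suc m) = ≡.refl
        zero-coeff zero    (suc i) zero    = ≡.refl
        zero-coeff zero    (suc i) (suc m) = ≡.refl
        zero-coeff (suc j) zero    zero    = ≡.refl
        zero-coeff (suc j) zero    (suc m) = ≡.refl
        zero-coeff (suc j) (suc i) zero    = ≡.refl
        zero-coeff (suc j) (suc i) (suc m) = ≡.refl

      φ-choose : ∀ m p q t h a → chooseℕ (λ k c → φ m p q (pow t c * h k)) a ≡ φ m p q (choose t h a)
      φ-choose m p q = chooseℕ-additive (φ m p q) (λ e → coeff-cong m (shifted-cong p q e))
        (φ-0 m p q) (λ r s → coeff-cong m (shifted-+ p q r s))

      u-shift : ∀ c p q r → shifted (c ℕ.+ p) q r ≈ shifted p q (pow u c * r)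
      u-shift c p q r = trans (*-congʳ {pow v q * r} (pow-+ u c p))
        (solve 4 (λ c p q r → (c :* p) :* (q :* r) := p :* (q :* (c :* r))) refl (pow u c) (pow u p) (pow v q) r)

      v-shift : ∀ c p q r → shifted p (c ℕ.+ q) r ≈ shifted p q (pow v c * r)
      v-shift c p q r = trans (*-congˡ {pow u p} (*-congʳ {r} (pow-+ v c q)))
        (solve 4 (λ c p q r → p :* ((c :* q) :* r) := p :* (q :* (c :* r))) refl (pow v c) (pow u p) (pow v q) r)

    -- This is `N-step` at x^(m+1). Its summand 1 contributes to x⁰ only, where it gives the initial
    -- weight in `weight-zero`.
    weight-suc : ∀ m a b p q → weight (suc m) a b p q ≡ transfer (weight m) a b p q
    weight-suc m a b p q = ≡.trans (coeff-cong (suc m) (expand a b p q))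
      (≡.trans (≡.cong₂ ℕ._+_ monomial (coeff-x-suc (shifted p q (later a b)) m))
      (≡.trans (coeff-cong m (trans (shifted-+ p q _ _) (+-congˡ {shifted p q (completed (suc a) (suc b))} (shifted-+ p q _ _))))
      (≡.cong (weight m (suc a) (suc b) p q ℕ.+_) (≡.cong₂ ℕ._+_
        (≡.sym (≡.trans (chooseℕ-cong (λ k c → coeff-cong m (u-shift c p q (completed k 1))) a)
          (φ-choose m p q u (λ k → completed k 1) a)))
        (≡.sym (≡.trans (chooseℕ-cong (λ k c → coeff-cong m (v-shift c p q (completed 1 k))) b)
          (φ-choose m p q v (λ k → completed 1 k) b)))))))
      where
      monomial : coeff (suc m) (shifted p q 1#) ≡ 0
      monomial = ≡.trans (coeff-monomial i j (suc m) p q) (≡.cong 𝟙 (∧-zeroʳ _))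

    weight-zero : ∀ a b p q → target i j a b p q ≡ weight 0 a b p q
    weight-zero a b p q = ≡.sym (≡.trans (coeff-cong 0 (expand a b p q))
      (≡.trans (≡.cong₂ ℕ._+_ (≡.trans (coeff-monomial i j 0 p q) (≡.cong 𝟙 (∧-identityʳ _)))
        (coeff-x-zero (shifted p q (later a b)))) (ℕₚ.+-identityʳ _)))

    weight-iterate : ∀ n m a b p q → iterate n (weight m) a b p q ≡ weight (n ℕ.+ m) a b p q
    weight-iterate zero    m a b p q = ≡.refl
    weight-iterate (suc n) m a b p q = ≡.trans
      (iterate-cong n (λ a b p q → ≡.sym (weight-suc m a b p q)) a b p q)
      (≡.trans (weight-iterate n (suc m) a b p q) (≡.cong (λ k → weight k a b p q) (ℕₚ.+-suc n m)))

    -- State (1, 1) is a lone node, still available as head and as tail. Its series is b by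
    -- `N-one-one`, and the coefficient of b depends on j + i only.
    iterate-target : ∀ n → iterate n (target i j) 1 1 0 0 ≡ ballot 1 n (j ℕ.+ i)
    iterate-target n = ≡.trans (iterate-cong n weight-zero 1 1 0 0)
      (≡.trans (weight-iterate n 0 1 1 0 0) (≡.trans (≡.cong (λ k → weight k 1 1 0 0) (ℕₚ.+-identityʳ n))
        (coeff-cong n (trans (*-identityˡ _) (trans (*-identityˡ _) (N-one-one x u v y z _ y-eq z-eq b-eq))))))

module Counting where
  open Series using (𝟙; ballot; chooseℕ; Weight; transfer; iterate; target; iterate-target)
  open import Data.Nat using (_+_; _*_; _∸_; _≤_)
  open import Data.Nat.Tactic.RingSolver using (solve-∀)
  open import Data.Fin using (Fin; zero; suc; toℕ; _<_)
  import Data.Fin.Properties as Finₚ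
  open import Data.List using (List; []; _∷_; _++_; map; concatMap; allFin; tabulate; cartesianProduct; filterᵇ; length)
  open import Data.List.Membership.Propositional using (_∈_)
  open import Data.List.Membership.Propositional.Properties using (∈-cartesianProduct⁺; ∈-allFin)
  open import Data.List.Relation.Unary.Any using (here; there)
  open import Data.Vec using (Vec; []; _∷_; lookup; replicate)
  open import Data.Vec.Properties using (lookup-replicate)
  open import Data.Unit using (⊤; tt)
  open import Data.Empty using (⊥-elim)
  open import Function using (_∘_; id)
  open import Function.Bundles using (Equivalence)
  open import Relation.Binary.Definitions using (tri<; tri≈; tri>)
  open ≡ using (refl)
  open ≡.≡-Reasoning

  -- Faces encoded node by node, from right to left.

  Mask : ℕ → Set
  Mask = Vec Bool

  count : ∀ {m} → Mask m → ℕ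
  count []      = 0
  count (b ∷ r) = 𝟙 b + count r

  none : ∀ {m} → Mask m → Bool
  none []      = true
  none (b ∷ r) = not b ∧ none r

  _⊆ᵇ_ : ∀ {m} → Mask m → Mask m → Bool
  []      ⊆ᵇ []      = true
  (b ∷ r) ⊆ᵇ (h ∷ M) = (not b ∨ h) ∧ (r ⊆ᵇ M)

  ∅ : ∀ {m} → Mask m
  ∅ = replicate _ false

  -- keep α r M is the part of M above every element of r if α = true (nesting arrows),
  -- below every element of r if α = false (crossing arrows); both weakly.
  keep : ∀ {m} → Bool → Mask m → Mask m → Mask m
  keep α     []          []      = []
  keep true  (b ∷ r)     (h ∷ M) = (h ∧ none r) ∷ keep true r M
  keep false (true ∷ r)  (h ∷ M) = h ∷ ∅
  keep false (false ∷ r) (h ∷ M) = h ∷ keep false r M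

  -- A set of pairs on m points, the least point removed first: whether it holds the diagonal pair at that
  -- point, then the heads of the arrows out of it, the tails of the arrows into it, and the rest.
  Config : ℕ → Set
  Config zero    = ⊤
  Config (suc m) = Bool × Mask m × Mask m × Config m

  _ᵀ : ∀ {m} → Config m → Config m
  _ᵀ {zero}  tt              = tt
  _ᵀ {suc m} (b , r , s , c) = b , s , r , c ᵀ

  pairs : ∀ {m} → Config m → Fin m → Fin m → Bool
  pairs {suc m} (b , r , s , c) zero    zero    = b
  pairs {suc m} (b , r , s , c) zero    (suc j) = lookup r j
  pairs {suc m} (b , r , s , c) (suc i) zero    = lookup s i
  pairs {suc m} (b , r , s , c) (suc i) (suc j) = pairs c i j

  -- The points that can be the head of an arrow whose tail is a new least point.
  heads : ∀ {m} → Bool → Config m → Mask m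
  heads {zero}  α tt              = []
  heads {suc m} α (b , r , s , c) = none r ∷ (if none s then keep α r (heads α c) else ∅)

  tails : ∀ {m} → Bool → Config m → Mask m
  tails β c = heads β (c ᵀ)

  module _ (α β : Bool) where

    -- Arrows that share the new point as tail, or as head, are always joined, and an arrow out of
    -- it is never joined to one into it. Beyond that, only compatibility with the older arrows has
    -- to be tested, and it is tested for each new arrow separately.
    face : ∀ {m} → Config m → Bool
    face {zero}  tt              = true
    face {suc m} (b , r , s , c) =
      not b ∧ ((none r ∨ none s) ∧ ((r ⊆ᵇ heads α c) ∧ ((s ⊆ᵇ tails β c) ∧ face c)))

  forward backward : ∀ {m} → Config m → ℕ
  forward {zero}  tt              = 0
  forward {suc m} (b , r , s , c) = count r + forward c
  backward {zero}  tt              = 0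
  backward {suc m} (b , r , s , c) = count s + backward c

  -- Sums over masks and configurations, and the law for adding a node.

  sumM : ∀ m → (Mask m → ℕ) → ℕ
  sumM zero    F = F []
  sumM (suc m) F = sumM m (λ r → F (true ∷ r)) + sumM m (λ r → F (false ∷ r))

  sumM⁺ : ∀ m → (Mask m → ℕ) → ℕ
  sumM⁺ zero    F = 0
  sumM⁺ (suc m) F = sumM m (λ r → F (true ∷ r)) + sumM⁺ m (λ r → F (false ∷ r))

  sumC : ∀ m → (Config m → ℕ) → ℕ
  sumC zero    F = F tt
  sumC (suc m) F = sumM m λ r → sumM m λ s → sumC m λ c → F (true , r , s , c) + F (false , r , s , c)

  +-interchange : ∀ a b c d → (a + b) + (c + d) ≡ (a + c) + (b + d)
  +-interchange = solve-∀

  sumM-cong : ∀ m {F G} → (∀ r → F r ≡ G r) → sumM m F ≡ sumM m G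
  sumM-cong zero    e = e []
  sumM-cong (suc m) e = ≡.cong₂ _+_ (sumM-cong m (λ r → e (true ∷ r))) (sumM-cong m (λ r → e (false ∷ r)))

  sumM⁺-cong : ∀ m {F G} → (∀ r → none r ≡ false → F r ≡ G r) → sumM⁺ m F ≡ sumM⁺ m G
  sumM⁺-cong zero    e = ≡.refl
  sumM⁺-cong (suc m) e = ≡.cong₂ _+_ (sumM-cong m (λ r → e (true ∷ r) ≡.refl)) (sumM⁺-cong m (λ r → e (false ∷ r)))

  sumC-cong : ∀ m {F G} → (∀ c → F c ≡ G c) → sumC m F ≡ sumC m G
  sumC-cong zero    e = e tt
  sumC-cong (suc m) e = sumM-cong m λ r → sumM-cong m λ s → sumC-cong m λ c → ≡.cong₂ _+_ (e _) (e _)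

  sumM-+ : ∀ m F G → sumM m (λ r → F r + G r) ≡ sumM m F + sumM m G
  sumM-+ zero    F G = ≡.refl
  sumM-+ (suc m) F G = ≡.trans (≡.cong₂ _+_ (sumM-+ m _ _) (sumM-+ m _ _))
    (+-interchange (sumM m λ r → F (true ∷ r)) (sumM m λ r → G (true ∷ r)) _ _)

  sumC-+ : ∀ m F G → sumC m (λ c → F c + G c) ≡ sumC m F + sumC m G
  sumC-+ zero    F G = ≡.refl
  sumC-+ (suc m) F G = ≡.trans (sumM-cong m λ r → ≡.trans (sumM-cong m λ s → ≡.trans
      (sumC-cong m λ c → +-interchange (F (true , r , s , c)) _ _ _)
      (sumC-+ m (λ c → F (true , r , s , c) + F (false , r , s , c)) (λ c → G (true , r , s , c) + G (false , r , s , c))))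
      (sumM-+ m _ _))
    (sumM-+ m _ _)

  sumM-sumC-swap : ∀ m k (F : Mask m → Config k → ℕ) →
    sumM m (λ r → sumC k (F r)) ≡ sumC k (λ c → sumM m (λ r → F r c))
  sumM-sumC-swap zero    k F = ≡.refl
  sumM-sumC-swap (suc m) k F =
    ≡.trans (≡.cong₂ _+_ (sumM-sumC-swap m k _) (sumM-sumC-swap m k _)) (≡.sym (sumC-+ k _ _))

  sumM-0 : ∀ m {F} → (∀ r → F r ≡ 0) → sumM m F ≡ 0
  sumM-0 zero    e = e []
  sumM-0 (suc m) e = ≡.cong₂ _+_ (sumM-0 m (λ r → e (true ∷ r))) (sumM-0 m (λ r → e (false ∷ r)))

  sumM-split : ∀ m F → sumM m F ≡ F ∅ + sumM⁺ m F
  sumM-split zero    F = ≡.sym (ℕₚ.+-identityʳ _)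
  sumM-split (suc m) F = ≡.trans (≡.cong (sumM m (λ r → F (true ∷ r)) +_) (sumM-split m (λ r → F (false ∷ r))))
    (shuffle (sumM m (λ r → F (true ∷ r))) (F ∅) (sumM⁺ m (λ r → F (false ∷ r))))
    where
    shuffle : ∀ a b c → a + (b + c) ≡ b + (a + c)
    shuffle = solve-∀

  none-∅ : ∀ m → none (∅ {m}) ≡ true
  none-∅ zero    = ≡.refl
  none-∅ (suc m) = none-∅ m

  count-∅ : ∀ m → count (∅ {m}) ≡ 0
  count-∅ zero    = ≡.refl
  count-∅ (suc m) = count-∅ m

  ∅-⊆ : ∀ {m} (M : Mask m) → ∅ ⊆ᵇ M ≡ true
  ∅-⊆ []      = ≡.refl
  ∅-⊆ (h ∷ M) = ∅-⊆ M

  keep-∅ : ∀ {m} α (M : Mask m) → keep α ∅ M ≡ M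
  keep-∅ α     []      = ≡.refl
  keep-∅ {suc m} true  (true  ∷ M) = ≡.cong₂ _∷_ (none-∅ m) (keep-∅ true M)
  keep-∅ {suc m} true  (false ∷ M) = ≡.cong (false ∷_) (keep-∅ true M)
  keep-∅ false (h ∷ M) = ≡.cong (h ∷_) (keep-∅ false M)

  guard : Bool → ℕ → ℕ
  guard b n = if b then n else 0

  subsetsℕ : (ℕ → ℕ) → ℕ → ℕ
  subsetsℕ f zero    = f 0
  subsetsℕ f (suc a) = subsetsℕ f a + subsetsℕ (λ c → f (suc c)) a

  -- chooseℕ removes the greatest rank first; this removes the least.
  chooseℕ-least : ∀ f a → chooseℕ f (suc a) ≡ subsetsℕ (λ c → f 1 (suc c)) a + chooseℕ (λ j → f (suc j)) a
  chooseℕ-least f zero    = ≡.sym (ℕₚ.+-identityʳ _)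
  chooseℕ-least f (suc a) = ≡.trans
    (≡.cong₂ (λ x y → x + (y + f (suc (suc a)) 1)) (chooseℕ-least f a) (chooseℕ-least (λ j c → f j (suc c)) a))
    (shuffle (subsetsℕ (λ c → f 1 (suc c)) a) (chooseℕ (λ j → f (suc j)) a) _ _ _)
    where
    shuffle : ∀ p c p′ c′ e → (p + c) + ((p′ + c′) + e) ≡ (p + p′) + (c + (c′ + e))
    shuffle = solve-∀

  sum-subsets : ∀ {m} f (M : Mask m) → sumM m (λ r → guard (r ⊆ᵇ M) (f (count r))) ≡ subsetsℕ f (count M)
  sum-subsets f []          = ≡.refl
  sum-subsets {suc m} f (true ∷ M)  = ≡.trans (ℕₚ.+-comm (sumM m (λ r → guard (r ⊆ᵇ M) (f (suc (count r))))) _)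
    (≡.cong₂ _+_ (sum-subsets f M) (sum-subsets (λ c → f (suc c)) M))
  sum-subsets {suc m} f (false ∷ M) = ≡.cong₂ _+_ (sumM-0 m (λ r → ≡.refl)) (sum-subsets f M)

  -- The number of points kept is the rank in M of the extreme element of r, counted from the top if
  -- α = true and from the bottom otherwise; over all nonempty r the two give the same distribution.
  -- The least point of M has the greatest rank in the first case, so the induction follows
  -- `chooseℕ`. In the second it has rank 1: once it is chosen the rest of r is free, and
  -- `chooseℕ-least` is the matching recursion.
  sum-keep : ∀ {m} α f (M : Mask m) →
    sumM⁺ m (λ r → guard (r ⊆ᵇ M) (f (count (keep α r M)) (count r))) ≡ chooseℕ f (count M)
  sum-keep α     f []          = ≡.refl
  sum-keep {suc m} true  f (false ∷ M) = ≡.cong₂ _+_ (sumM-0 m (λ r → ≡.refl)) (sum-keep true f M)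
  sum-keep {suc m} false f (false ∷ M) = ≡.cong₂ _+_ (sumM-0 m (λ r → ≡.refl)) (sum-keep false f M)
  sum-keep {suc m} true  f (true ∷ M)  = ≡.trans
    (≡.cong₂ _+_
      (≡.trans (sumM-split m (λ r → guard (r ⊆ᵇ M) (f (𝟙 (none r) + count (keep true r M)) (suc (count r)))))
        (≡.cong₂ _+_ at-∅
          (≡.trans (sumM⁺-cong m (λ r e → ≡.cong (λ b → guard (r ⊆ᵇ M) (f (𝟙 b + count (keep true r M)) (suc (count r)))) e))
            (sum-keep true (λ j c → f j (suc c)) M))))
      (≡.trans (sumM⁺-cong m (λ r e → ≡.cong (λ b → guard (r ⊆ᵇ M) (f (𝟙 b + count (keep true r M)) (count r))) e))
        (sum-keep true f M)))
    (shuffle (f (suc (count M)) 1) _ _)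
    where
    at-∅ : guard (∅ ⊆ᵇ M) (f (𝟙 (none (∅ {m})) + count (keep true ∅ M)) (suc (count (∅ {m})))) ≡ f (suc (count M)) 1
    at-∅ rewrite ∅-⊆ M | none-∅ m | keep-∅ true M | count-∅ m = ≡.refl
    shuffle : ∀ a b c → (a + b) + c ≡ c + (b + a)
    shuffle = solve-∀
  sum-keep {suc m} false f (true ∷ M)  = ≡.trans
    (≡.cong₂ _+_
      (≡.trans (sumM-cong m (λ r → ≡.cong (λ k → guard (r ⊆ᵇ M) (f (suc k) (suc (count r)))) (count-∅ m)))
        (sum-subsets (λ c → f 1 (suc c)) M))
      (sum-keep false (λ j → f (suc j)) M))
    (≡.sym (chooseℕ-least f (count M)))

  module Count (α β : Bool) where

    total : ℕ → Weight → ℕ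
    total m w = sumC m λ c → guard (face α β c) (w (count (heads α c)) (count (tails β c)) (forward c) (backward c))

    -- The case where r and s are both nonempty is excluded; the other three cases are the three
    -- summands of `transfer`.
    extend : ∀ {m} (H T : Mask m) (w : Weight) p q →
      sumM m (λ r → sumM m (λ s → guard ((none r ∨ none s) ∧ ((r ⊆ᵇ H) ∧ (s ⊆ᵇ T)))
        (w (count (none r ∷ (if none s then keep α r H else ∅))) (count (none s ∷ (if none r then keep β s T else ∅)))
           (count r + p) (count s + q))))
      ≡ transfer w (count H) (count T) p q
    extend {m} H T w p q = ≡.trans (sumM-split m (λ r → sumM m (G r)))
      (≡.trans (≡.cong₂ _+_
        (≡.trans (sumM-split m (G ∅)) (≡.cong₂ _+_ at-∅∅
          (≡.trans (sumM⁺-cong m at-∅s) (sum-keep β (λ j c → w 1 j p (c + q)) T))))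
        (≡.trans (sumM⁺-cong m at-r) (sum-keep α (λ j c → w j 1 (c + p) q) H)))
        (shuffle (w (suc (count H)) (suc (count T)) p q) _ _))
      where
      G : Mask m → Mask m → ℕ
      G r s = guard ((none r ∨ none s) ∧ ((r ⊆ᵇ H) ∧ (s ⊆ᵇ T)))
        (w (count (none r ∷ (if none s then keep α r H else ∅))) (count (none s ∷ (if none r then keep β s T else ∅)))
           (count r + p) (count s + q))
      shuffle : ∀ a b c → (a + b) + c ≡ a + (c + b)
      shuffle = solve-∀
      at-∅∅ : G ∅ ∅ ≡ w (suc (count H)) (suc (count T)) p q
      at-∅∅ rewrite none-∅ m | ∅-⊆ H | ∅-⊆ T | keep-∅ α H | keep-∅ β T | count-∅ m = ≡.refl
      at-∅s : ∀ s → none s ≡ false → G ∅ s ≡ guard (s ⊆ᵇ T) (w 1 (count (keep β s T)) p (count s + q))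
      at-∅s s e rewrite none-∅ m | e | ∅-⊆ H | count-∅ m = ≡.refl
      at-r : ∀ r → none r ≡ false → sumM m (G r) ≡ guard (r ⊆ᵇ H) (w (count (keep α r H)) 1 (count r + p) q)
      at-r r e = ≡.trans (sumM-split m (G r)) (≡.trans (≡.cong₂ _+_ at-r∅
        (≡.trans (sumM⁺-cong m at-rs) (sumM⁺-0 m))) (ℕₚ.+-identityʳ _))
        where
        at-r∅ : G r ∅ ≡ guard (r ⊆ᵇ H) (w (count (keep α r H)) 1 (count r + p) q)
        at-r∅ rewrite none-∅ m | e | ∅-⊆ T | count-∅ m with r ⊆ᵇ H
        ... | true  = ≡.refl
        ... | false = ≡.refl
        at-rs : ∀ s → none s ≡ false → G r s ≡ 0
        at-rs s e′ rewrite e | e′ = ≡.refl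
        sumM⁺-0 : ∀ m → sumM⁺ m (λ _ → 0) ≡ 0
        sumM⁺-0 zero    = ≡.refl
        sumM⁺-0 (suc m) = ≡.cong₂ _+_ (sumM-0 m (λ _ → ≡.refl)) (sumM⁺-0 m)

    -- The sums are reordered so that the older configuration is fixed while the arrows at the new
    -- point vary; then `extend` applies.
    total-suc : ∀ m w → total (suc m) w ≡ total m (transfer w)
    total-suc m w = ≡.trans (sumM-cong m λ r → sumM-sumC-swap m m _)
      (≡.trans (sumM-sumC-swap m m _) (sumC-cong m λ c → per c (face α β c)))
      where
      state : Config (suc m) → ℕ
      state c = w (count (heads α c)) (count (tails β c)) (forward c) (backward c)
      per : ∀ c d → sumM m (λ r → sumM m (λ s →
              guard ((none r ∨ none s) ∧ ((r ⊆ᵇ heads α c) ∧ ((s ⊆ᵇ tails β c) ∧ d))) (state (false , r , s , c))))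
            ≡ guard d (transfer w (count (heads α c)) (count (tails β c)) (forward c) (backward c))
      per c true  = ≡.trans (sumM-cong m λ r → sumM-cong m λ s →
          ≡.cong (λ b → guard ((none r ∨ none s) ∧ ((r ⊆ᵇ heads α c) ∧ b)) (state (false , r , s , c)))
            (∧-identityʳ (s ⊆ᵇ tails β c)))
        (extend (heads α c) (tails β c) w (forward c) (backward c))
      per c false = sumM-0 m λ r → sumM-0 m λ s → absurd (none r ∨ none s) (r ⊆ᵇ heads α c) (s ⊆ᵇ tails β c) _
        where
        absurd : ∀ a b d n → guard (a ∧ (b ∧ (d ∧ false))) n ≡ 0
        absurd false b     d     n = ≡.refl
        absurd true  false d     n = ≡.refl
        absurd true  true  false n = ≡.refl
        absurd true  true  true  n = ≡.refl

    total-iterate : ∀ m w → total m w ≡ iterate m w 0 0 0 0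
    total-iterate zero    w = ≡.refl
    total-iterate (suc m) w = ≡.trans (total-suc m w) (total-iterate m (transfer w))

  iterate-transfer : ∀ n w → iterate n (transfer w) ≡ transfer (iterate n w)
  iterate-transfer zero    w = ≡.refl
  iterate-transfer (suc n) w = iterate-transfer n (transfer w)

  -- The rules for edges, and their agreement with `face`.

  Relation : ℕ → Set
  Relation m = Fin m × Fin m → Fin m × Fin m → Bool

  -- The facts on edges needed when a new least point is the tail of its arrows; for heads, reverse all arrows.
  record OutRules {m} (α : Bool) (E : Relation m) : Set where
    field
      symmetric   : ∀ p q → E p q ≡ E q p
      head-tail   : ∀ i j k → i ≢ j → j ≢ k → E (i , j) (j , k) ≡ false
      shared-tail : ∀ a x y → a ≢ x → a ≢ y → x ≢ y → E (a , x) (a , y) ≡ true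
      shared-head : ∀ a b x → a ≢ x → b ≢ x → a ≢ b → E (a , x) (b , x) ≡ true
      TTHH-nest   : ∀ a b c d → a < b → b < c → c < d → E (a , d) (b , c) ≡ α
      TTHH-cross  : ∀ a b c d → a < b → b < c → c < d → E (a , c) (b , d) ≡ not α
      THTH-apart  : ∀ a b c d → a < b → b < c → c < d → E (a , b) (c , d) ≡ true
      THTH-nest   : ∀ a b c d → a < b → b < c → c < d → E (a , d) (c , b) ≡ false
      THHT-apart  : ∀ a b c d → a < b → b < c → c < d → E (a , b) (d , c) ≡ true
      THHT-cross  : ∀ a b c d → a < b → b < c → c < d → E (a , c) (d , b) ≡ false

  reversed : ∀ {m} → Relation m → Relation m
  reversed E p q = E (swap p) (swap q)

  record Rules {m} (α β : Bool) (E : Relation m) : Set where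
    field
      out : OutRules α E
      inn : OutRules β (reversed E)

  up : ∀ {m} → Fin m × Fin m → Fin (suc m) × Fin (suc m)
  up (i , j) = suc i , suc j

  restrict : ∀ {m} → Relation (suc m) → Relation m
  restrict E p q = E (up p) (up q)

  suc-≢ : ∀ {m} {i j : Fin m} → i ≢ j → Fin.suc i ≢ suc j
  suc-≢ ne e = ne (Finₚ.suc-injective e)

  restrict-out : ∀ {m α} {E : Relation (suc m)} → OutRules α E → OutRules α (restrict E)
  restrict-out R = record
    { symmetric   = λ p q → symmetric (up p) (up q)
    ; head-tail   = λ i j k p q → head-tail (suc i) (suc j) (suc k) (suc-≢ p) (suc-≢ q)
    ; shared-tail = λ a x y p q r → shared-tail (suc a) (suc x) (suc y) (suc-≢ p) (suc-≢ q) (suc-≢ r)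
    ; shared-head = λ a b x p q r → shared-head (suc a) (suc b) (suc x) (suc-≢ p) (suc-≢ q) (suc-≢ r)
    ; TTHH-nest   = λ a b c d p q r → TTHH-nest (suc a) (suc b) (suc c) (suc d) (s≤s p) (s≤s q) (s≤s r)
    ; TTHH-cross  = λ a b c d p q r → TTHH-cross (suc a) (suc b) (suc c) (suc d) (s≤s p) (s≤s q) (s≤s r)
    ; THTH-apart  = λ a b c d p q r → THTH-apart (suc a) (suc b) (suc c) (suc d) (s≤s p) (s≤s q) (s≤s r)
    ; THTH-nest   = λ a b c d p q r → THTH-nest (suc a) (suc b) (suc c) (suc d) (s≤s p) (s≤s q) (s≤s r)
    ; THHT-apart  = λ a b c d p q r → THHT-apart (suc a) (suc b) (suc c) (suc d) (s≤s p) (s≤s q) (s≤s r)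
    ; THHT-cross  = λ a b c d p q r → THHT-cross (suc a) (suc b) (suc c) (suc d) (s≤s p) (s≤s q) (s≤s r)
    }
    where open OutRules R

  -- The order behind `keep`: j is at or above l if α = true, at or below l if α = false.
  weakly : ∀ {m} → Bool → Fin m → Fin m → Bool
  weakly α zero    zero    = true
  weakly α zero    (suc l) = not α
  weakly α (suc j) zero    = α
  weakly α (suc j) (suc l) = weakly α j l

  -- Is an arrow from a new least point to j compatible with k → l?  (Junk value true if k = l.)
  arrowTo : ∀ {m} → Bool → Fin m → Fin m → Fin m → Bool
  arrowTo α zero    zero    zero    = true
  arrowTo α zero    zero    (suc l) = false
  arrowTo α zero    (suc k) l       = true
  arrowTo α (suc j) zero    zero    = true
  arrowTo α (suc j) zero    (suc l) = weakly α j l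
  arrowTo α (suc j) (suc k) zero    = false
  arrowTo α (suc j) (suc k) (suc l) = arrowTo α j k l

  weakly-refl : ∀ {m} α (j : Fin m) → weakly α j j ≡ true
  weakly-refl α zero    = refl
  weakly-refl α (suc j) = weakly-refl α j

  weakly-< : ∀ {m} α (j l : Fin m) → j < l → weakly α j l ≡ not α
  weakly-< α zero    (suc l) _       = refl
  weakly-< α (suc j) (suc l) (s≤s p) = weakly-< α j l p

  weakly-> : ∀ {m} α (j l : Fin m) → l < j → weakly α j l ≡ α
  weakly-> α (suc j) zero    _       = refl
  weakly-> α (suc j) (suc l) (s≤s p) = weakly-> α j l p

  arrowTo-j<k : ∀ {m} α (j k l : Fin m) → j < k → j < l → arrowTo α j k l ≡ true
  arrowTo-j<k α zero    (suc k) l       _       _       = refl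
  arrowTo-j<k α (suc j) (suc k) (suc l) (s≤s p) (s≤s q) = arrowTo-j<k α j k l p q

  arrowTo-k<j<l : ∀ {m} α (j k l : Fin m) → k < j → j < l → arrowTo α j k l ≡ not α
  arrowTo-k<j<l α (suc j) zero    (suc l) _       (s≤s q) = weakly-< α j l q
  arrowTo-k<j<l α (suc j) (suc k) (suc l) (s≤s p) (s≤s q) = arrowTo-k<j<l α j k l p q

  arrowTo-k<l<j : ∀ {m} α (j k l : Fin m) → k < l → l < j → arrowTo α j k l ≡ α
  arrowTo-k<l<j α (suc j) zero    (suc l) _       (s≤s q) = weakly-> α j l q
  arrowTo-k<l<j α (suc j) (suc k) (suc l) (s≤s p) (s≤s q) = arrowTo-k<l<j α j k l p q

  arrowTo-l<j : ∀ {m} α (j k l : Fin m) → l < j → l < k → arrowTo α j k l ≡ false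
  arrowTo-l<j α (suc j) (suc k) zero    _       _       = refl
  arrowTo-l<j α (suc j) (suc k) (suc l) (s≤s p) (s≤s q) = arrowTo-l<j α j k l p q

  arrowTo-j≡k : ∀ {m} α (j l : Fin m) → j ≢ l → arrowTo α j j l ≡ false
  arrowTo-j≡k α zero    zero    ne = ⊥-elim (ne refl)
  arrowTo-j≡k α zero    (suc l) ne = refl
  arrowTo-j≡k α (suc j) zero    ne = refl
  arrowTo-j≡k α (suc j) (suc l) ne = arrowTo-j≡k α j l (λ e → ne (≡.cong suc e))

  arrowTo-j≡l : ∀ {m} α (j k : Fin m) → arrowTo α j k j ≡ true
  arrowTo-j≡l α zero    zero    = refl
  arrowTo-j≡l α zero    (suc k) = refl
  arrowTo-j≡l α (suc j) zero    = weakly-refl α j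
  arrowTo-j≡l α (suc j) (suc k) = arrowTo-j≡l α j k

  -- The new least point is a tail, so with four distinct endpoints the type is TTHH, THTH or THHT.
  -- Each type admits two matchings of tails with heads, and these six cases are the six orders of
  -- j, k and l.
  edge-arrowTo : ∀ {m α} {E : Relation (suc m)} → OutRules α E → ∀ j k l → k ≢ l →
    E (zero , suc j) (suc k , suc l) ≡ arrowTo α j k l
  edge-arrowTo {α = α} {E} R j k l k≢l with Finₚ.<-cmp j k | Finₚ.<-cmp j l | Finₚ.<-cmp k l
  ... | _ | _ | tri≈ _ k≡l _ = ⊥-elim (k≢l k≡l)
  ... | tri≈ _ refl _ | _ | _ =
    ≡.trans (OutRules.head-tail R zero (suc j) (suc l) (λ ()) (suc-≢ k≢l)) (≡.sym (arrowTo-j≡k α j l k≢l))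
  ... | _ | tri≈ _ refl _ | _ =
    ≡.trans (OutRules.shared-head R zero (suc k) (suc j) (λ ()) (suc-≢ k≢l) (λ ())) (≡.sym (arrowTo-j≡l α j k))
  ... | tri< j<k _ _ | tri< j<l _ _ | tri< k<l _ _ =
    ≡.trans (OutRules.THTH-apart R zero (suc j) (suc k) (suc l) (s≤s z≤n) (s≤s j<k) (s≤s k<l)) (≡.sym (arrowTo-j<k α j k l j<k j<l))
  ... | tri< j<k _ _ | tri< j<l _ _ | tri> _ _ l<k =
    ≡.trans (OutRules.THHT-apart R zero (suc j) (suc l) (suc k) (s≤s z≤n) (s≤s j<l) (s≤s l<k)) (≡.sym (arrowTo-j<k α j k l j<k j<l))
  ... | tri> _ _ k<j | tri< j<l _ _ | _ =
    ≡.trans (OutRules.TTHH-cross R zero (suc k) (suc j) (suc l) (s≤s z≤n) (s≤s k<j) (s≤s j<l)) (≡.sym (arrowTo-k<j<l α j k l k<j j<l))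
  ... | tri> _ _ k<j | tri> _ _ l<j | tri< k<l _ _ =
    ≡.trans (OutRules.TTHH-nest R zero (suc k) (suc l) (suc j) (s≤s z≤n) (s≤s k<l) (s≤s l<j)) (≡.sym (arrowTo-k<l<j α j k l k<l l<j))
  ... | tri> _ _ k<j | tri> _ _ l<j | tri> _ _ l<k =
    ≡.trans (OutRules.THTH-nest R zero (suc l) (suc k) (suc j) (s≤s z≤n) (s≤s l<k) (s≤s k<j)) (≡.sym (arrowTo-l<j α j k l l<j l<k))
  ... | tri< j<k _ _ | tri> _ _ l<j | _ =
    ≡.trans (OutRules.THHT-cross R zero (suc l) (suc j) (suc k) (s≤s z≤n) (s≤s l<j) (s≤s j<k)) (≡.sym (arrowTo-l<j α j k l l<j (ℕₚ.<-trans l<j j<k)))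

  true≢false : true ≢ false
  true≢false ()

  ∧-true : ∀ {a b} → a ∧ b ≡ true → a ≡ true × b ≡ true
  ∧-true {true} {true} _ = refl , refl

  ∧-intro : ∀ {a b} → a ≡ true → b ≡ true → a ∧ b ≡ true
  ∧-intro refl refl = refl

  none-elim : ∀ {m} (r : Mask m) → none r ≡ true → ∀ j → lookup r j ≢ true
  none-elim (false ∷ r) n zero    ()
  none-elim (false ∷ r) n (suc j) e = none-elim r n j e

  none-intro : ∀ {m} (r : Mask m) → (∀ j → lookup r j ≢ true) → none r ≡ true
  none-intro []          _ = refl
  none-intro (true ∷ r)  f = ⊥-elim (f zero refl)
  none-intro (false ∷ r) f = none-intro r (λ j → f (suc j))

  ⊆-elim : ∀ {m} (r M : Mask m) → r ⊆ᵇ M ≡ true → ∀ j → lookup r j ≡ true → lookup M j ≡ true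
  ⊆-elim (true ∷ r) (true ∷ M) e zero    _ = refl
  ⊆-elim (b ∷ r)    (h ∷ M)    e (suc j) p = ⊆-elim r M (proj₂ (∧-true {not b ∨ h} e)) j p

  ⊆-intro : ∀ {m} (r M : Mask m) → (∀ j → lookup r j ≡ true → lookup M j ≡ true) → r ⊆ᵇ M ≡ true
  ⊆-intro []          []      f = refl
  ⊆-intro (true ∷ r)  (h ∷ M) f rewrite f zero refl = ⊆-intro r M (λ j → f (suc j))
  ⊆-intro (false ∷ r) (h ∷ M) f = ⊆-intro r M (λ j → f (suc j))

  keep-elim : ∀ {m} α (r M : Mask m) j → lookup (keep α r M) j ≡ true →
    lookup M j ≡ true × (∀ x → lookup r x ≡ true → weakly α j x ≡ true)
  keep-elim true (b ∷ r) (h ∷ M) zero e with ∧-true {h} e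
  ... | e₁ , e₂ = e₁ , λ { zero _ → refl ; (suc x) p → ⊥-elim (none-elim r e₂ x p) }
  keep-elim true (b ∷ r) (h ∷ M) (suc j) e with keep-elim true r M j e
  ... | e₁ , f = e₁ , λ { zero _ → refl ; (suc x) p → f x p }
  keep-elim false (true ∷ r) (h ∷ M) zero e = e , λ { zero _ → refl ; (suc x) _ → refl }
  keep-elim false (false ∷ r) (h ∷ M) zero e = e , λ { zero _ → refl ; (suc x) _ → refl }
  keep-elim false (true ∷ r) (h ∷ M) (suc j) e with () ← ≡.trans (≡.sym (lookup-replicate j false)) e
  keep-elim false (false ∷ r) (h ∷ M) (suc j) e with keep-elim false r M j e
  ... | e₁ , f = e₁ , λ { (suc x) p → f x p }

  keep-intro : ∀ {m} α (r M : Mask m) j → lookup M j ≡ true → (∀ x → lookup r x ≡ true → weakly α j x ≡ true) →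
    lookup (keep α r M) j ≡ true
  keep-intro true (b ∷ r) (h ∷ M) zero e f rewrite e = none-intro r (λ x p → true≢false (≡.sym (f (suc x) p)))
  keep-intro true (b ∷ r) (h ∷ M) (suc j) e f = keep-intro true r M j e (λ x → f (suc x))
  keep-intro false (true ∷ r) (h ∷ M) zero e f = e
  keep-intro false (false ∷ r) (h ∷ M) zero e f = e
  keep-intro false (true ∷ r) (h ∷ M) (suc j) e f with () ← f zero refl
  keep-intro false (false ∷ r) (h ∷ M) (suc j) e f = keep-intro false r M j e (λ x → f (suc x))

  none-false : ∀ {m} (r : Mask m) j → lookup r j ≡ true → none r ≡ false
  none-false (true ∷ r)  zero    _ = refl
  none-false (true ∷ r)  (suc j) _ = refl
  none-false (false ∷ r) (suc j) p = none-false r j p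

  -- Together with `heads-intro` it justifies the recursion of `heads`. The decisive case is an
  -- arrow entering the least point of c: any head other than that point would produce a THTH
  -- nesting, a THHT crossing or a head-to-tail pair, so nothing beyond that point survives.
  heads-elim : ∀ {m} α (c : Config m) j → lookup (heads α c) j ≡ true →
    ∀ k l → pairs c k l ≡ true → arrowTo α j k l ≡ true
  heads-elim {suc m} α (b , r , s , c) zero e zero    zero    p = refl
  heads-elim {suc m} α (b , r , s , c) zero e zero    (suc l) p = ⊥-elim (none-elim r e l p)
  heads-elim {suc m} α (b , r , s , c) zero e (suc k) l       p = refl
  heads-elim {suc m} α (b , r , s , c) (suc j) e k l p with none s in ns
  heads-elim {suc m} α (b , r , s , c) (suc j) e k l p | false with () ← ≡.trans (≡.sym (lookup-replicate j false)) e
  heads-elim {suc m} α (b , r , s , c) (suc j) e zero    zero    p | true = refl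
  heads-elim {suc m} α (b , r , s , c) (suc j) e zero    (suc l) p | true = proj₂ (keep-elim α r (heads α c) j e) l p
  heads-elim {suc m} α (b , r , s , c) (suc j) e (suc k) zero    p | true = ⊥-elim (none-elim s ns k p)
  heads-elim {suc m} α (b , r , s , c) (suc j) e (suc k) (suc l) p | true =
    heads-elim α c j (proj₁ (keep-elim α r (heads α c) j e)) k l p

  heads-intro : ∀ {m} α (c : Config m) j → (∀ k l → pairs c k l ≡ true → arrowTo α j k l ≡ true) →
    lookup (heads α c) j ≡ true
  heads-intro {suc m} α (b , r , s , c) zero f = none-intro r (λ l p → true≢false (≡.sym (f zero (suc l) p)))
  heads-intro {suc m} α (b , r , s , c) (suc j) f
    = ≡.trans (≡.cong (λ b → lookup (if b then keep α r (heads α c) else ∅) j)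
        (none-intro s (λ k p → true≢false (≡.sym (f (suc k) zero p)))))
      (keep-intro α r (heads α c) j (heads-intro α c j (λ k l → f (suc k) (suc l))) (λ x → f zero (suc x)))

  pairs-ᵀ : ∀ {m} (c : Config m) i j → pairs (c ᵀ) i j ≡ pairs c j i
  pairs-ᵀ {suc m} (b , r , s , c) zero    zero    = refl
  pairs-ᵀ {suc m} (b , r , s , c) zero    (suc j) = refl
  pairs-ᵀ {suc m} (b , r , s , c) (suc i) zero    = refl
  pairs-ᵀ {suc m} (b , r , s , c) (suc i) (suc j) = pairs-ᵀ c i j

  record Face {m} (E : Relation m) (S : Fin m → Fin m → Bool) : Set where
    field
      arrows : ∀ i j → S i j ≡ true → i ≢ j
      edges  : ∀ i j k l → S i j ≡ true → S k l ≡ true → (i , j) ≢ (k , l) → E (i , j) (k , l) ≡ true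

  module _ {α β : Bool} where

    -- Arrows into the new point are treated as arrows out of it in the transposed configuration
    -- under the reversed relation; this is why rules for both orientations are carried along.
    face-elim : ∀ {m} (c : Config m) {E : Relation m} → OutRules α E → OutRules β (reversed E) →
      face α β c ≡ true → Face E (pairs c)
    face-elim {zero} c R R′ f = record { arrows = λ () ; edges = λ () }
    face-elim {suc m} (false , r , s , c) {E} R R′ f with ∧-true {none r ∨ none s} f
    ... | rs , f₁ with ∧-true {r ⊆ᵇ heads α c} f₁
    ... | r⊆ , f₂ with ∧-true {s ⊆ᵇ tails β c} f₂
    ... | s⊆ , f₃ = record { arrows = arr ; edges = edg }
      where
      rest : Face (restrict E) (pairs c)
      rest = face-elim c (restrict-out R) (restrict-out R′) f₃
      arr : ∀ i j → pairs (false , r , s , c) i j ≡ true → i ≢ j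
      arr zero    (suc j) p ()
      arr (suc i) zero    p ()
      arr (suc i) (suc j) p e = Face.arrows rest i j p (Finₚ.suc-injective e)
      mixed : ∀ {A : Set} j k → lookup r j ≡ true → lookup s k ≡ true → A
      mixed j k p q = ⊥-elim (true≢false (≡.trans (≡.sym rs)
        (≡.cong₂ _∨_ (none-false r j p) (none-false s k q))))
      out : ∀ j k l → lookup r j ≡ true → pairs c k l ≡ true → E (zero , suc j) (suc k , suc l) ≡ true
      out j k l p q = ≡.trans (edge-arrowTo R j k l (Face.arrows rest k l q))
        (heads-elim α c j (⊆-elim r (heads α c) r⊆ j p) k l q)
      inn : ∀ j k l → lookup s j ≡ true → pairs c k l ≡ true → E (suc j , zero) (suc k , suc l) ≡ true
      inn j k l p q = ≡.trans (edge-arrowTo R′ j l k (λ e → Face.arrows rest k l q (≡.sym e)))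
        (heads-elim β (c ᵀ) j (⊆-elim s (tails β c) s⊆ j p) l k (≡.trans (pairs-ᵀ c l k) q))
      edg : ∀ i j k l → pairs (false , r , s , c) i j ≡ true → pairs (false , r , s , c) k l ≡ true →
        (i , j) ≢ (k , l) → E (i , j) (k , l) ≡ true
      edg zero    (suc j) zero    (suc l) p q ne = OutRules.shared-tail R zero (suc j) (suc l) (λ ()) (λ ()) (λ e → ne (≡.cong (zero ,_) e))
      edg zero    (suc j) (suc k) zero    p q ne = mixed j k p q
      edg zero    (suc j) (suc k) (suc l) p q ne = out j k l p q
      edg (suc i) zero    zero    (suc l) p q ne = mixed l i q p
      edg (suc i) zero    (suc k) zero    p q ne = OutRules.shared-head R (suc i) (suc k) zero (λ ()) (λ ()) (λ e → ne (≡.cong (_, zero) e))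
      edg (suc i) zero    (suc k) (suc l) p q ne = inn i k l p q
      edg (suc i) (suc j) zero    (suc l) p q ne = ≡.trans (OutRules.symmetric R _ _) (out l i j q p)
      edg (suc i) (suc j) (suc k) zero    p q ne = ≡.trans (OutRules.symmetric R _ _) (inn k i j q p)
      edg (suc i) (suc j) (suc k) (suc l) p q ne = Face.edges rest i j k l p q (λ e → ne (≡.cong up e))

    face-intro : ∀ {m} (c : Config m) {E : Relation m} → OutRules α E → OutRules β (reversed E) →
      Face E (pairs c) → face α β c ≡ true
    face-intro {zero} c R R′ F = refl
    face-intro {suc m} (true , r , s , c) R R′ F = ⊥-elim (Face.arrows F zero zero refl refl)
    face-intro {suc m} (false , r , s , c) {E} R R′ F
      = ∧-intro rs (∧-intro r⊆ (∧-intro s⊆ (face-intro c (restrict-out R) (restrict-out R′) rest)))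
      where
      rest : Face (restrict E) (pairs c)
      rest = record
        { arrows = λ i j p e → Face.arrows F (suc i) (suc j) p (≡.cong suc e)
        ; edges  = λ i j k l p q ne → Face.edges F (suc i) (suc j) (suc k) (suc l) p q
                     (λ { refl → ne refl }) }
      -- An arrow into the new point followed by one out of it would be a head-to-tail pair, which
      -- is not an edge.
      rs : none r ∨ none s ≡ true
      rs with none r in nr | none s in ns
      ... | true  | _     = refl
      ... | false | true  = refl
      ... | false | false = ⊥-elim (true≢false (≡.trans (≡.sym (none-intro r λ j p →
              true≢false (≡.trans (≡.sym (none-intro s λ k q → true≢false (≡.trans
                (≡.sym (Face.edges F zero (suc j) (suc k) zero p q λ ()))
                (≡.trans (OutRules.symmetric R _ _) (OutRules.head-tail R (suc k) zero (suc j) (λ ()) (λ ())))))) ns))) nr))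
      r⊆ : r ⊆ᵇ heads α c ≡ true
      r⊆ = ⊆-intro r (heads α c) λ j p → heads-intro α c j λ k l q →
        ≡.trans (≡.sym (edge-arrowTo R j k l (Face.arrows rest k l q)))
          (Face.edges F zero (suc j) (suc k) (suc l) p q λ ())
      s⊆ : s ⊆ᵇ tails β c ≡ true
      s⊆ = ⊆-intro s (tails β c) λ j p → heads-intro β (c ᵀ) j λ k l q →
        ≡.trans (≡.sym (edge-arrowTo R′ j k l (λ e → Face.arrows rest l k (≡.trans (≡.sym (pairs-ᵀ c k l)) q) (≡.sym e))))
          (Face.edges F (suc j) zero (suc l) (suc k) p (≡.trans (≡.sym (pairs-ᵀ c k l)) q) λ ())

  -- From the list of all subsets to sums over configurations.

  sumOver : ∀ {A : Set} → List A → (A → ℕ) → ℕ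
  sumOver []       f = 0
  sumOver (x ∷ xs) f = f x + sumOver xs f

  module _ {A : Set} where

    sumOver-cong : ∀ (xs : List A) {f g} → (∀ x → f x ≡ g x) → sumOver xs f ≡ sumOver xs g
    sumOver-cong []       e = refl
    sumOver-cong (x ∷ xs) e = ≡.cong₂ _+_ (e x) (sumOver-cong xs e)

    sumOver-+ : ∀ (xs : List A) f g → sumOver xs (λ x → f x + g x) ≡ sumOver xs f + sumOver xs g
    sumOver-+ []       f g = refl
    sumOver-+ (x ∷ xs) f g = ≡.trans (≡.cong (f x + g x +_) (sumOver-+ xs f g)) (+-interchange (f x) (g x) _ _)

    sumOver-0 : ∀ (xs : List A) → sumOver xs (λ _ → 0) ≡ 0
    sumOver-0 []       = refl
    sumOver-0 (x ∷ xs) = sumOver-0 xs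

    sumOver-++ : ∀ (xs ys : List A) f → sumOver (xs ++ ys) f ≡ sumOver xs f + sumOver ys f
    sumOver-++ []       ys f = refl
    sumOver-++ (x ∷ xs) ys f = ≡.trans (≡.cong (f x +_) (sumOver-++ xs ys f)) (≡.sym (ℕₚ.+-assoc (f x) _ _))

    length-filterᵇ : ∀ (P : A → Bool) xs → length (filterᵇ P xs) ≡ sumOver xs (𝟙 ∘ P)
    length-filterᵇ P []       = refl
    length-filterᵇ P (x ∷ xs) with P x
    ... | true  = ≡.cong suc (length-filterᵇ P xs)
    ... | false = length-filterᵇ P xs

  sumOver-map : ∀ {A B : Set} (g : A → B) xs f → sumOver (map g xs) f ≡ sumOver xs (f ∘ g)
  sumOver-map g []       f = refl
  sumOver-map g (x ∷ xs) f = ≡.cong (f (g x) +_) (sumOver-map g xs f)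

  sumOver-tabulate-∘ : ∀ {A B : Set} {m} (g : Fin m → A) (h : A → B) f →
    sumOver (tabulate (h ∘ g)) f ≡ sumOver (tabulate g) (f ∘ h)
  sumOver-tabulate-∘ {m = zero}  g h f = refl
  sumOver-tabulate-∘ {m = suc m} g h f = ≡.cong (f (h (g zero)) +_) (sumOver-tabulate-∘ (g ∘ suc) h f)

  sumOver-tail : ∀ m (f : Fin (suc m) → ℕ) → sumOver (tabulate Fin.suc) f ≡ sumOver (allFin m) (f ∘ suc)
  sumOver-tail m = sumOver-tabulate-∘ id Fin.suc

  sumOver-concatMap : ∀ {A B : Set} (g : A → List B) xs f → sumOver (concatMap g xs) f ≡ sumOver xs (λ x → sumOver (g x) f)
  sumOver-concatMap g []       f = refl
  sumOver-concatMap g (x ∷ xs) f = ≡.trans (sumOver-++ (g x) _ f) (≡.cong (sumOver (g x) f +_) (sumOver-concatMap g xs f))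

  sumOver-swap : ∀ {A B : Set} (xs : List A) (ys : List B) (f : A → B → ℕ) →
    sumOver xs (λ x → sumOver ys (f x)) ≡ sumOver ys (λ y → sumOver xs (λ x → f x y))
  sumOver-swap []       ys f = ≡.sym (sumOver-0 ys)
  sumOver-swap (x ∷ xs) ys f = ≡.trans (≡.cong (sumOver ys (f x) +_) (sumOver-swap xs ys f)) (≡.sym (sumOver-+ ys (f x) _))

  sumOver-cartesianProduct : ∀ {A B : Set} (xs : List A) (ys : List B) f →
    sumOver (cartesianProduct xs ys) f ≡ sumOver xs (λ x → sumOver ys (λ y → f (x , y)))
  sumOver-cartesianProduct []       ys f = refl
  sumOver-cartesianProduct (x ∷ xs) ys f = ≡.trans (sumOver-++ (map (x ,_) ys) _ f)
    (≡.cong₂ _+_ (sumOver-map (x ,_) ys f) (sumOver-cartesianProduct xs ys f))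

  bools : List Bool
  bools = true ∷ false ∷ []

  sumOver-fns : ∀ {X : Set} (xs : List X) m F →
    sumOver (allFnsOf xs (suc m)) F ≡ sumOver xs (λ x → sumOver (allFnsOf xs m) (λ f → F (consF x f)))
  sumOver-fns xs m F = ≡.trans (sumOver-concatMap (λ x → map (consF x) (allFnsOf xs m)) xs F)
    (sumOver-cong xs (λ x → sumOver-map (consF x) (allFnsOf xs m) F))

  -- The two enumerations produce subsets that agree pointwise without being the same functions, so
  -- the summand has to respect pointwise equality.
  Extensional : ∀ {m} → ((Fin m → Bool) → ℕ) → Set
  Extensional F = ∀ f g → (∀ i → f i ≡ g i) → F f ≡ F g

  Extensional₂ : ∀ {m k} → ((Fin m → Fin k → Bool) → ℕ) → Set
  Extensional₂ F = ∀ f g → (∀ i j → f i j ≡ g i j) → F f ≡ F g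

  consF-cong : ∀ {X : Set} {m} {x y : X} {f g : Fin m → X} → x ≡ y → (∀ i → f i ≡ g i) → ∀ i → consF x f i ≡ consF y g i
  consF-cong e p zero    = e
  consF-cong e p (suc i) = p i

  sumOver-masks : ∀ m F → Extensional F → sumOver (allFnsOf bools m) F ≡ sumM m (F ∘ lookup)
  sumOver-masks zero    F ext = ≡.trans (ℕₚ.+-identityʳ _) (ext _ _ λ ())
  sumOver-masks (suc m) F ext = ≡.trans (sumOver-fns bools m F)
    (≡.cong₂ _+_ (half true) (≡.trans (ℕₚ.+-identityʳ _) (half false)))
    where
    half : ∀ b → sumOver (allFnsOf bools m) (λ f → F (consF b f)) ≡ sumM m (λ r → F (lookup (b ∷ r)))
    half b = ≡.trans (sumOver-masks m (λ f → F (consF b f)) (λ f g e → ext _ _ (consF-cong refl e)))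
      (sumM-cong m (λ r → ext _ _ λ { zero → refl ; (suc i) → refl }))

  rows : (k m : ℕ) → List (Fin m → Fin k → Bool)
  rows k m = allFnsOf (allFnsOf bools k) m

  -- The subsets are listed row by row, while a configuration splits off the first row and the first
  -- column; this detaches the first entry of each row.
  sumOver-column : ∀ k m F → Extensional₂ F →
    sumOver (rows (suc k) m) F
    ≡ sumOver (allFnsOf bools m) (λ s → sumOver (rows k m) (λ g → F (λ i → consF (s i) (g i))))
  sumOver-column k zero F ext = ≡.cong (_+ 0) (≡.trans (ext _ _ λ ()) (≡.sym (ℕₚ.+-identityʳ _)))
  sumOver-column k (suc m) F ext = begin
    sumOver (rows (suc k) (suc m)) F
      ≡⟨ sumOver-fns (allFnsOf bools (suc k)) m F ⟩
    sumOver (allFnsOf bools (suc k)) (λ r → sumOver (rows (suc k) m) (λ g → F (consF r g)))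
      ≡⟨ sumOver-fns bools k _ ⟩
    sumOver bools (λ b → sumOver (allFnsOf bools k) (λ r → sumOver (rows (suc k) m) (λ g → F (consF (consF b r) g))))
      ≡⟨ sumOver-cong bools (λ b → begin
        sumOver (allFnsOf bools k) (λ r → sumOver (rows (suc k) m) (λ g → F (consF (consF b r) g)))
          ≡⟨ sumOver-cong (allFnsOf bools k) (λ r → sumOver-column k m _ λ f g e →
               ext _ _ λ { zero j → refl ; (suc i) j → e i j }) ⟩
        sumOver (allFnsOf bools k) (λ r → sumOver (allFnsOf bools m) (λ s → sumOver (rows k m)
          (λ g → F (consF (consF b r) (λ i → consF (s i) (g i))))))
          ≡⟨ sumOver-swap (allFnsOf bools k) (allFnsOf bools m) _ ⟩
        sumOver (allFnsOf bools m) (λ s → sumOver (allFnsOf bools k) (λ r → sumOver (rows k m)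
          (λ g → F (consF (consF b r) (λ i → consF (s i) (g i))))))
          ≡⟨ sumOver-cong (allFnsOf bools m) (λ s → ≡.trans
               (sumOver-cong (allFnsOf bools k) (λ r → sumOver-cong (rows k m) (λ g → ext _ _
                 λ { zero j → refl ; (suc i) j → refl })))
               (≡.sym (sumOver-fns (allFnsOf bools k) m _))) ⟩
        sumOver (allFnsOf bools m) (λ s → sumOver (rows k (suc m)) (λ g → F (λ i → consF (consF b s i) (g i)))) ∎) ⟩
    sumOver bools (λ b → sumOver (allFnsOf bools m) (λ s → sumOver (rows k (suc m)) (λ g → F (λ i → consF (consF b s i) (g i)))))
      ≡⟨ sumOver-fns bools m _ ⟨
    sumOver (allFnsOf bools (suc m)) (λ s → sumOver (rows k (suc m)) (λ g → F (λ i → consF (s i) (g i)))) ∎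

  sumOver-configs : ∀ m F → Extensional₂ F → sumOver (rows m m) F ≡ sumC m (F ∘ pairs)
  sumOver-configs zero    F ext = ≡.trans (ℕₚ.+-identityʳ _) (ext _ _ λ ())
  sumOver-configs (suc m) F ext = begin
    sumOver (rows (suc m) (suc m)) F
      ≡⟨ sumOver-fns (allFnsOf bools (suc m)) m F ⟩
    sumOver (allFnsOf bools (suc m)) (λ r → sumOver (rows (suc m) m) (λ g → F (consF r g)))
      ≡⟨ sumOver-fns bools m _ ⟩
    half true + (half false + 0)
      ≡⟨ ≡.cong₂ _+_ (half-eq true) (≡.trans (ℕₚ.+-identityʳ _) (half-eq false)) ⟩
    full true + full false
      ≡⟨ sumM-+ m _ _ ⟨
    sumM m (λ r → sumM m (λ s → sumC m (λ c → F (pairs (true , r , s , c)))) + sumM m (λ s → sumC m (λ c → F (pairs (false , r , s , c)))))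
      ≡⟨ sumM-cong m (λ r → ≡.trans (≡.sym (sumM-+ m _ _)) (sumM-cong m (λ s → ≡.sym (sumC-+ m _ _)))) ⟩
    sumC (suc m) (F ∘ pairs) ∎
    where
    half full : Bool → ℕ
    half b = sumOver (allFnsOf bools m) (λ r → sumOver (rows (suc m) m) (λ g → F (consF (consF b r) g)))
    full b = sumM m (λ r → sumM m (λ s → sumC m (λ c → F (pairs (b , r , s , c)))))
    frame : Bool → (r s : Fin m → Bool) → (Fin m → Fin m → Bool) → Fin (suc m) → Fin (suc m) → Bool
    frame b r s g = consF (consF b r) (λ i → consF (s i) (g i))
    frame-cong : ∀ b {r r′ s s′ g g′} → (∀ i → r i ≡ r′ i) → (∀ i → s i ≡ s′ i) → (∀ i j → g i j ≡ g′ i j) →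
      ∀ i j → frame b r s g i j ≡ frame b r′ s′ g′ i j
    frame-cong b er es eg zero    j = consF-cong refl er j
    frame-cong b er es eg (suc i) j = consF-cong (es i) (eg i) j
    half-eq : ∀ b → half b ≡ full b
    half-eq b = begin
      half b
        ≡⟨ sumOver-cong (allFnsOf bools m) (λ r → ≡.trans
             (sumOver-column m m _ λ f g e → ext _ _ λ { zero j → refl ; (suc i) j → e i j })
             (sumOver-cong (allFnsOf bools m) (λ s →
               sumOver-configs m (λ g → F (frame b r s g)) (λ f g e → ext _ _ (frame-cong b (λ _ → refl) (λ _ → refl) e))))) ⟩
      sumOver (allFnsOf bools m) (λ r → sumOver (allFnsOf bools m) (λ s → sumC m (λ c → F (frame b r s (pairs c)))))
        ≡⟨ sumOver-cong (allFnsOf bools m) (λ r → sumOver-masks m _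
             (λ f g e → sumC-cong m (λ c → ext _ _ (frame-cong b (λ _ → refl) e (λ _ _ → refl))))) ⟩
      sumOver (allFnsOf bools m) (λ r → sumM m (λ s → sumC m (λ c → F (frame b r (lookup s) (pairs c)))))
        ≡⟨ sumOver-masks m _ (λ f g e → sumM-cong m (λ s → sumC-cong m (λ c →
             ext _ _ (frame-cong b e (λ _ → refl) (λ _ _ → refl))))) ⟩
      sumM m (λ r → sumM m (λ s → sumC m (λ c → F (frame b (lookup r) (lookup s) (pairs c)))))
        ≡⟨ sumM-cong m (λ r → sumM-cong m (λ s → sumC-cong m (λ c → ext _ _
             λ { zero zero → refl ; zero (suc j) → refl ; (suc i) zero → refl ; (suc i) (suc j) → refl }))) ⟩
      full b ∎

  ≡ᵇ-refl : ∀ n → (n ≡ᵇ n) ≡ true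
  ≡ᵇ-refl zero    = refl
  ≡ᵇ-refl (suc n) = ≡ᵇ-refl n

  ≡ᵇ-sound : ∀ {m n} → (m ≡ᵇ n) ≡ true → m ≡ n
  ≡ᵇ-sound {m} {n} e = ℕₚ.≡ᵇ⇒≡ m n (Equivalence.from T-≡ e)

  bool-ext : ∀ {a b} → (a ≡ true → b ≡ true) → (b ≡ true → a ≡ true) → a ≡ b
  bool-ext {true}  {true}  f g = refl
  bool-ext {true}  {false} f g = ≡.sym (f refl)
  bool-ext {false} {true}  f g = g refl
  bool-ext {false} {false} f g = refl

  allᵇ-elim : ∀ {A : Set} (P : A → Bool) xs → allᵇ P xs ≡ true → ∀ {x} → x ∈ xs → P x ≡ true
  allᵇ-elim P (x ∷ xs) e (here refl) = proj₁ (∧-true e)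
  allᵇ-elim P (x ∷ xs) e (there p)   = allᵇ-elim P xs (proj₂ (∧-true {P x} e)) p

  allᵇ-intro : ∀ {A : Set} (P : A → Bool) xs → (∀ x → P x ≡ true) → allᵇ P xs ≡ true
  allᵇ-intro P []       f = refl
  allᵇ-intro P (x ∷ xs) f = ∧-intro (f x) (allᵇ-intro P xs f)

  ∈-pts : ∀ {n} (p : Pt n) → p ∈ pts n
  ∈-pts (i , j) = ∈-cartesianProduct⁺ (∈-allFin i) (∈-allFin j)

  imply : ∀ {a b} → not a ∨ b ≡ true → a ≡ true → b ≡ true
  imply {true} e _ = e

  implied : ∀ {a b} → (a ≡ true → b ≡ true) → not a ∨ b ≡ true
  implied {true}  f = f refl
  implied {false} f = refl

  isArrow-elim : ∀ {n} {p : Pt n} → isArrow p ≡ true → tl p ≢ hd p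
  isArrow-elim {p = i , .i} e refl rewrite ≡ᵇ-refl (toℕ i) with () ← e

  isArrow-intro : ∀ {n} {p : Pt n} → tl p ≢ hd p → isArrow p ≡ true
  isArrow-intro {p = i , j} ne with toℕ i ≡ᵇ toℕ j in e
  ... | true  = ⊥-elim (ne (Finₚ.toℕ-injective (≡ᵇ-sound e)))
  ... | false = refl

  samePt-refl : ∀ {n} (p : Pt n) → samePt p p ≡ true
  samePt-refl (i , j) = ∧-intro (≡ᵇ-refl (toℕ i)) (≡ᵇ-refl (toℕ j))

  samePt-sound : ∀ {n} {p q : Pt n} → samePt p q ≡ true → p ≡ q
  samePt-sound {p = i , j} {k , l} e with ∧-true {toℕ i ≡ᵇ toℕ k} e
  ... | e₁ , e₂ = ≡.cong₂ _,_ (Finₚ.toℕ-injective (≡ᵇ-sound e₁)) (Finₚ.toℕ-injective (≡ᵇ-sound e₂))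

  isFace-elim : ∀ {n} (E : EdgeRel n) (S : Sub n) → isFace E S ≡ true → Face E (λ i j → S (i , j))
  isFace-elim {n} E S e with ∧-true {allᵇ (λ p → not (S p) ∨ isArrow p) (pts n)} e
  ... | e₁ , e₂ = record
    { arrows = λ i j p → isArrow-elim (imply (allᵇ-elim _ (pts n) e₁ (∈-pts (i , j))) p)
    ; edges  = λ i j k l p q ne → distinct (i , j) (k , l) ne
        (imply {S (k , l)} (imply {S (i , j)} (allᵇ-elim _ (pts n) (allᵇ-elim _ (pts n) e₂ (∈-pts (i , j))) (∈-pts (k , l))) p) q) }
    where
    distinct : ∀ p q → p ≢ q → samePt p q ∨ E p q ≡ true → E p q ≡ true
    distinct p q ne e with samePt p q in s
    ... | true  = ⊥-elim (ne (samePt-sound s))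
    ... | false = e

  isFace-intro : ∀ {n} (E : EdgeRel n) (S : Sub n) → Face E (λ i j → S (i , j)) → isFace E S ≡ true
  isFace-intro {n} E S F = ∧-intro
    (allᵇ-intro _ (pts n) (λ p → implied (λ Sp → isArrow-intro (Face.arrows F (tl p) (hd p) Sp))))
    (allᵇ-intro _ (pts n) (λ p → allᵇ-intro _ (pts n) (λ q → implied {S p} (λ Sp → implied {S q} (λ Sq → same p q Sp Sq)))))
    where
    same : ∀ p q → S p ≡ true → S q ≡ true → samePt p q ∨ E p q ≡ true
    same p q Sp Sq with samePt p q in s
    ... | true  = refl
    ... | false = Face.edges F (tl p) (hd p) (tl q) (hd q) Sp Sq
      (λ e → true≢false (≡.trans (≡.sym (samePt-refl p)) (≡.trans (≡.cong (samePt p) e) s)))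

  Face-cong : ∀ {m} {E : Relation m} {S S′} → (∀ i j → S i j ≡ S′ i j) → Face E S → Face E S′
  Face-cong e F = record
    { arrows = λ i j p → Face.arrows F i j (≡.trans (e i j) p)
    ; edges  = λ i j k l p q → Face.edges F i j k l (≡.trans (e i j) p) (≡.trans (e k l) q) }

  isFace-cong : ∀ {n} (E : EdgeRel n) {S S′ : Sub n} → (∀ p → S p ≡ S′ p) → isFace E S ≡ isFace E S′
  isFace-cong E {S} {S′} e = bool-ext
    (λ f → isFace-intro E S′ (Face-cong (λ i j → e (i , j)) (isFace-elim E S f)))
    (λ f → isFace-intro E S (Face-cong (λ i j → ≡.sym (e (i , j))) (isFace-elim E S′ f)))

  -- Counting forward and backward arrows.

  card-sum : ∀ {n} (P : Pt n → Bool) →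
    card P ≡ sumOver (allFin (suc n)) (λ i → sumOver (allFin (suc n)) (λ j → 𝟙 (P (i , j))))
  card-sum {n} P = ≡.trans (length-filterᵇ P (pts n)) (sumOver-cartesianProduct (allFin (suc n)) (allFin (suc n)) (𝟙 ∘ P))

  card-cong : ∀ {n} {P Q : Pt n → Bool} → (∀ p → P p ≡ Q p) → card P ≡ card Q
  card-cong {n} {P} {Q} e = ≡.trans (length-filterᵇ P (pts n))
    (≡.trans (sumOver-cong (pts n) (λ p → ≡.cong 𝟙 (e p))) (≡.sym (length-filterᵇ Q (pts n))))

  ∧-true-𝟙 : ∀ b → 𝟙 (b ∧ true) ≡ 𝟙 b
  ∧-true-𝟙 true  = refl
  ∧-true-𝟙 false = refl

  sum-lookup : ∀ {m} (r : Mask m) → sumOver (allFin m) (λ j → 𝟙 (lookup r j ∧ true)) ≡ count r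
  sum-lookup []      = refl
  sum-lookup {suc m} (b ∷ r) = ≡.cong₂ _+_ (∧-true-𝟙 b) (≡.trans (sumOver-tail m _) (sum-lookup r))

  sum-∧-false : ∀ {A : Set} (xs : List A) (b : A → Bool) → sumOver xs (λ x → 𝟙 (b x ∧ false)) ≡ 0
  sum-∧-false xs b = ≡.trans (sumOver-cong xs (λ x → ≡.cong 𝟙 (∧-zeroʳ (b x)))) (sumOver-0 xs)

  sum-forward : ∀ {m} (c : Config m) →
    sumOver (allFin m) (λ i → sumOver (allFin m) (λ j → 𝟙 (pairs c i j ∧ (toℕ i <ᵇ toℕ j)))) ≡ forward c
  sum-forward {zero}  c = refl
  sum-forward {suc m} (b , r , s , c) = ≡.cong₂ _+_
    (≡.cong₂ _+_ (≡.cong 𝟙 (∧-zeroʳ b)) (≡.trans (sumOver-tail m _) (sum-lookup r)))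
    (≡.trans (sumOver-tail m _) (≡.trans
      (sumOver-cong (allFin m) (λ i → ≡.cong₂ _+_ (≡.cong 𝟙 (∧-zeroʳ (lookup s i))) (sumOver-tail m _)))
      (sum-forward c)))

  sum-backward : ∀ {m} (c : Config m) →
    sumOver (allFin m) (λ i → sumOver (allFin m) (λ j → 𝟙 (pairs c i j ∧ (toℕ j <ᵇ toℕ i)))) ≡ backward c
  sum-backward {zero}  c = refl
  sum-backward {suc m} (b , r , s , c) = ≡.cong₂ _+_
    (≡.cong₂ _+_ (≡.cong 𝟙 (∧-zeroʳ b)) (≡.trans (sumOver-tail m _) (sum-∧-false (allFin m) (lookup r))))
    (≡.trans (sumOver-tail m _) (≡.trans
      (sumOver-cong (allFin m) (λ i → ≡.cong (𝟙 (lookup s i ∧ true) +_) (sumOver-tail m _)))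
      (≡.trans (sumOver-+ (allFin m) (λ i → 𝟙 (lookup s i ∧ true)) _)
        (≡.cong₂ _+_ (sum-lookup s) (sum-backward c)))))

  forwards backwards : ∀ {n} → Sub n → ℕ
  forwards  S = card (λ p → S p ∧ isForward p)
  backwards S = card (λ p → S p ∧ isBackward p)

  module _ {n α β} (E : EdgeRel n) (R : OutRules α E) (R′ : OutRules β (reversed E)) where

    fFB-ballot : ∀ i j → fFB E i j ≡ ballot 1 n (j + i)
    fFB-ballot i j = begin
      fFB E i j
        ≡⟨ length-filterᵇ _ (allSubs n) ⟩
      sumOver (allSubs n) F
        ≡⟨ sumOver-map _ (rows (suc n) (suc n)) F ⟩
      sumOver (rows (suc n) (suc n)) (λ g → F (λ p → g (proj₁ p) (proj₂ p)))
        ≡⟨ sumOver-configs (suc n) _ (λ f g e → ≡.cong 𝟙 (≡.cong₂ _∧_ (isFace-cong E (λ p → e (proj₁ p) (proj₂ p)))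
             (≡.cong₂ (λ a b → (a ≡ᵇ i) ∧ (b ≡ᵇ j))
               (card-cong (λ p → ≡.cong (_∧ isForward p) (e (proj₁ p) (proj₂ p))))
               (card-cong (λ p → ≡.cong (_∧ isBackward p) (e (proj₁ p) (proj₂ p))))))) ⟩
      sumC (suc n) (λ c → F (λ p → pairs c (proj₁ p) (proj₂ p)))
        ≡⟨ sumC-cong (suc n) per-config ⟩
      Count.total α β (suc n) (target i j)
        ≡⟨ Count.total-iterate α β (suc n) (target i j) ⟩
      iterate n (transfer (target i j)) 0 0 0 0
        ≡⟨ ≡.cong (λ w → w 0 0 0 0) (iterate-transfer n (target i j)) ⟩
      -- The first node has nothing to be joined to: at state (0, 0) both `chooseℕ` sums are empty.
      -- So n + 1 nodes amount to n steps from state (1, 1).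
      iterate n (target i j) 1 1 0 0 + 0
        ≡⟨ ℕₚ.+-identityʳ _ ⟩
      iterate n (target i j) 1 1 0 0
        ≡⟨ iterate-target i j n ⟩
      ballot 1 n (j + i) ∎
      where
      F : Sub n → ℕ
      F S = 𝟙 (isFace E S ∧ (forwards S ≡ᵇ i) ∧ (backwards S ≡ᵇ j))
      isFace-face : ∀ c → isFace E (λ p → pairs c (proj₁ p) (proj₂ p)) ≡ face α β c
      isFace-face c = bool-ext (λ f → face-intro c R R′ (isFace-elim E S f)) (λ f → isFace-intro E S (face-elim c R R′ f))
        where S = λ p → pairs c (proj₁ p) (proj₂ p)
      guard-𝟙 : ∀ a b → 𝟙 (a ∧ b) ≡ guard a (𝟙 b)
      guard-𝟙 true  b = refl
      guard-𝟙 false b = refl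
      per-config : ∀ c → F (λ p → pairs c (proj₁ p) (proj₂ p)) ≡ guard (face α β c) (𝟙 ((forward c ≡ᵇ i) ∧ (backward c ≡ᵇ j)))
      per-config c = let S = λ p → pairs c (proj₁ p) (proj₂ p) in ≡.trans (≡.cong 𝟙 (≡.cong₂ _∧_ (isFace-face c) (≡.cong₂ (λ a b → (a ≡ᵇ i) ∧ (b ≡ᵇ j))
        (≡.trans (card-sum (λ p → S p ∧ isForward p)) (sum-forward c)) (≡.trans (card-sum (λ p → S p ∧ isBackward p)) (sum-backward c)))))
        (guard-𝟙 (face α β c) _)

  sumTo : ℕ → (ℕ → ℕ) → ℕ
  sumTo zero    h = h 0
  sumTo (suc k) h = h 0 + sumTo k (h ∘ suc)

  sumTo-0 : ∀ k {h} → (∀ i → h i ≡ 0) → sumTo k h ≡ 0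
  sumTo-0 zero    e = e 0
  sumTo-0 (suc k) e = ≡.cong₂ _+_ (e 0) (sumTo-0 k (e ∘ suc))

  sumTo-const : ∀ k h c → (∀ i → i ≤ k → h i ≡ c) → sumTo k h ≡ suc k * c
  sumTo-const zero    h c e = ≡.trans (e 0 z≤n) (≡.sym (ℕₚ.+-identityʳ c))
  sumTo-const (suc k) h c e = ≡.cong₂ _+_ (e 0 z≤n) (sumTo-const k (h ∘ suc) c (λ i i≤k → e (suc i) (s≤s i≤k)))

  sumOver-sumTo : ∀ {A : Set} (xs : List A) k (h : A → ℕ → ℕ) →
    sumOver xs (λ x → sumTo k (h x)) ≡ sumTo k (λ i → sumOver xs (λ x → h x i))
  sumOver-sumTo xs zero    h = refl
  sumOver-sumTo xs (suc k) h = ≡.trans (sumOver-+ xs (λ x → h x 0) _)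
    (≡.cong (sumOver xs (λ x → h x 0) +_) (sumOver-sumTo xs k (λ x i → h x (suc i))))

  sum-splits : ∀ f g k → 𝟙 (f + g ≡ᵇ k) ≡ sumTo k (λ i → 𝟙 ((f ≡ᵇ i) ∧ (g ≡ᵇ k ∸ i)))
  sum-splits zero    g zero    = refl
  sum-splits zero    g (suc k) = ≡.sym (≡.trans (≡.cong (𝟙 (g ≡ᵇ suc k) +_) (sumTo-0 k (λ i → refl))) (ℕₚ.+-identityʳ _))
  sum-splits (suc f) g zero    = refl
  sum-splits (suc f) g (suc k) = sum-splits f g k

  card-face : ∀ {n} (E : EdgeRel n) (S : Sub n) → isFace E S ≡ true → card S ≡ forwards S + backwards S
  card-face {n} E S f = begin
    card S                                    ≡⟨ length-filterᵇ S (pts n) ⟩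
    sumOver (pts n) (𝟙 ∘ S)                   ≡⟨ sumOver-cong (pts n) split ⟩
    sumOver (pts n) (λ p → 𝟙 (S p ∧ isForward p) + 𝟙 (S p ∧ isBackward p)) ≡⟨ sumOver-+ (pts n) (λ p → 𝟙 (S p ∧ isForward p)) _ ⟩
    sumOver (pts n) (λ p → 𝟙 (S p ∧ isForward p)) + sumOver (pts n) (λ p → 𝟙 (S p ∧ isBackward p))
      ≡⟨ ≡.cong₂ _+_ (length-filterᵇ (λ p → S p ∧ isForward p) (pts n)) (length-filterᵇ (λ p → S p ∧ isBackward p) (pts n)) ⟨
    forwards S + backwards S ∎
    where
    <ᵇ-split : ∀ a b → a ≢ b → 1 ≡ 𝟙 (a <ᵇ b) + 𝟙 (b <ᵇ a)
    <ᵇ-split zero    zero    ne = ⊥-elim (ne refl)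
    <ᵇ-split zero    (suc b) ne = refl
    <ᵇ-split (suc a) zero    ne = refl
    <ᵇ-split (suc a) (suc b) ne = <ᵇ-split a b (ne ∘ ≡.cong suc)
    split : ∀ p → 𝟙 (S p) ≡ 𝟙 (S p ∧ isForward p) + 𝟙 (S p ∧ isBackward p)
    split (i , j) with S (i , j) in e
    ... | true  = <ᵇ-split (toℕ i) (toℕ j) (λ t → Face.arrows (isFace-elim E S f) i j e (Finₚ.toℕ-injective t))
    ... | false = refl

  fK-sum : ∀ {n} (E : EdgeRel n) k → fK E k ≡ sumTo k (λ i → fFB E i (k ∸ i))
  fK-sum {n} E k = begin
    fK E k ≡⟨ length-filterᵇ _ (allSubs n) ⟩
    sumOver (allSubs n) (λ S → 𝟙 (isFace E S ∧ (card S ≡ᵇ k)))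
      ≡⟨ sumOver-cong (allSubs n) per-set ⟩
    sumOver (allSubs n) (λ S → sumTo k (λ i → 𝟙 (isFace E S ∧ (forwards S ≡ᵇ i) ∧ (backwards S ≡ᵇ k ∸ i))))
      ≡⟨ sumOver-sumTo (allSubs n) k _ ⟩
    sumTo k (λ i → sumOver (allSubs n) (λ S → 𝟙 (isFace E S ∧ (forwards S ≡ᵇ i) ∧ (backwards S ≡ᵇ k ∸ i))))
      ≡⟨ sumTo-cong k (λ i → length-filterᵇ _ (allSubs n)) ⟨
    sumTo k (λ i → fFB E i (k ∸ i)) ∎
    where
    sumTo-cong : ∀ k {h h′} → (∀ i → h i ≡ h′ i) → sumTo k h ≡ sumTo k h′
    sumTo-cong zero    e = e 0
    sumTo-cong (suc k) e = ≡.cong₂ _+_ (e 0) (sumTo-cong k (e ∘ suc))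
    per-set : ∀ S → 𝟙 (isFace E S ∧ (card S ≡ᵇ k)) ≡ sumTo k (λ i → 𝟙 (isFace E S ∧ (forwards S ≡ᵇ i) ∧ (backwards S ≡ᵇ k ∸ i)))
    per-set S with isFace E S in f
    ... | true  = ≡.trans (≡.cong (λ c → 𝟙 (c ≡ᵇ k)) (card-face E S f)) (sum-splits (forwards S) (backwards S) k)
    ... | false = ≡.sym (sumTo-0 k (λ i → refl))

module Geometry where
  open Counting using (OutRules; reversed; Face; true≢false; ∧-true; ∈-pts; isFace-elim; isFace-intro;
    samePt-refl; samePt-sound; isArrow-elim; isArrow-intro; ≡ᵇ-refl; ≡ᵇ-sound)
  open import Data.Fin as Fin using (Fin; zero; suc; toℕ)
  import Data.Fin.Properties as Finₚ
  open import Data.List using (List; []; _∷_; _++_; map; allFin; tabulate; cartesianProduct)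
  open import Data.List.Properties using (map-tabulate)
  open import Data.List.Membership.Propositional using (_∈_)
  open import Data.List.Relation.Unary.Any using (here; there)
  open import Data.Sum using (_⊎_; inj₁; inj₂)
  open import Data.Empty using (⊥; ⊥-elim)
  open import Data.Unit using (tt)
  open import Function using (_∘_; id)
  open import Relation.Nullary.Decidable using (from-yes)
  import Data.Integer as ℤ
  open import Data.Rational as ℚ using (ℚ; 0ℚ; 1ℚ; ½; _+_; _*_; _-_; -_; _≤_; _<_)
  import Data.Rational.Properties as ℚₚ
  open import Data.Rational.Solver using (module +-*-Solver)
  open +-*-Solver using (solve; _:+_; _:*_; :-_; _:-_; _:=_; con)
  open ≡ using (refl)
  open ≡.≡-Reasoning

  -- Rational sums, convex hulls and linear functionals.

  ⅓ ⅔ 2ℚ : ℚ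
  ⅓  = ℤ.+ 1 ℚ./ 3
  ⅔  = ⅓ + ⅓
  2ℚ = 1ℚ + 1ℚ

  ΣQ : ∀ {A : Set} → List A → (A → ℚ) → ℚ
  ΣQ xs f = sumℚ (map f xs)

  module _ {A : Set} where

    ΣQ-cong : ∀ (xs : List A) {f g} → (∀ x → f x ≡ g x) → ΣQ xs f ≡ ΣQ xs g
    ΣQ-cong []       e = refl
    ΣQ-cong (x ∷ xs) e = ≡.cong₂ _+_ (e x) (ΣQ-cong xs e)

    ΣQ-+ : ∀ (xs : List A) f g → ΣQ xs (λ x → f x + g x) ≡ ΣQ xs f + ΣQ xs g
    ΣQ-+ []       f g = refl
    ΣQ-+ (x ∷ xs) f g = ≡.trans (≡.cong (f x + g x +_) (ΣQ-+ xs f g))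
      (solve 4 (λ a b c d → (a :+ b) :+ (c :+ d) := (a :+ c) :+ (b :+ d)) refl (f x) (g x) (ΣQ xs f) (ΣQ xs g))

    ΣQ-* : ∀ (xs : List A) c f → ΣQ xs (λ x → c * f x) ≡ c * ΣQ xs f
    ΣQ-* []       c f = ≡.sym (ℚₚ.*-zeroʳ c)
    ΣQ-* (x ∷ xs) c f = ≡.trans (≡.cong (c * f x +_) (ΣQ-* xs c f)) (≡.sym (ℚₚ.*-distribˡ-+ c _ _))

    ΣQ-linear : ∀ (xs : List A) a b f g → ΣQ xs (λ x → a * f x + b * g x) ≡ a * ΣQ xs f + b * ΣQ xs g
    ΣQ-linear xs a b f g = ≡.trans (ΣQ-+ xs (λ x → a * f x) (λ x → b * g x)) (≡.cong₂ _+_ (ΣQ-* xs a f) (ΣQ-* xs b g))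

    ΣQ-0 : ∀ (xs : List A) {f} → (∀ x → f x ≡ 0ℚ) → ΣQ xs f ≡ 0ℚ
    ΣQ-0 []       e = refl
    ΣQ-0 (x ∷ xs) e = ≡.cong₂ _+_ (e x) (ΣQ-0 xs e)

    ΣQ-++ : ∀ (xs ys : List A) f → ΣQ (xs ++ ys) f ≡ ΣQ xs f + ΣQ ys f
    ΣQ-++ []       ys f = ≡.sym (ℚₚ.+-identityˡ _)
    ΣQ-++ (x ∷ xs) ys f = ≡.trans (≡.cong (f x +_) (ΣQ-++ xs ys f)) (≡.sym (ℚₚ.+-assoc (f x) _ _))

    ΣQ-nonneg : ∀ (xs : List A) {f} → (∀ x → 0ℚ ≤ f x) → 0ℚ ≤ ΣQ xs f
    ΣQ-nonneg []       p = ℚₚ.≤-refl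
    ΣQ-nonneg (x ∷ xs) p = ℚₚ.+-mono-≤ (p x) (ΣQ-nonneg xs p)

    ΣQ-mono : ∀ (xs : List A) {f g} → (∀ x → f x ≤ g x) → ΣQ xs f ≤ ΣQ xs g
    ΣQ-mono []       p = ℚₚ.≤-refl
    ΣQ-mono (x ∷ xs) p = ℚₚ.+-mono-≤ (p x) (ΣQ-mono xs p)

    ΣQ-vanish : ∀ (xs : List A) {f} → (∀ x → 0ℚ ≤ f x) → ΣQ xs f ≡ 0ℚ → ∀ {x} → x ∈ xs → f x ≡ 0ℚ
    ΣQ-vanish (y ∷ xs) {f} p e (here refl) = ℚₚ.≤-antisym
      (≡.subst (f y ≤_) e (≡.subst (_≤ f y + ΣQ xs f) (ℚₚ.+-identityʳ (f y)) (ℚₚ.+-monoʳ-≤ (f y) (ΣQ-nonneg xs p)))) (p y)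
    ΣQ-vanish (y ∷ xs) {f} p e (there x∈) = ΣQ-vanish xs p (ℚₚ.≤-antisym
      (≡.subst (ΣQ xs f ≤_) e (≡.subst (_≤ f y + ΣQ xs f) (ℚₚ.+-identityˡ (ΣQ xs f)) (ℚₚ.+-monoˡ-≤ (ΣQ xs f) (p y))))
      (ΣQ-nonneg xs p)) x∈

  ΣQ-swap : ∀ {A B : Set} (xs : List A) (ys : List B) (f : A → B → ℚ) →
    ΣQ xs (λ x → ΣQ ys (f x)) ≡ ΣQ ys (λ y → ΣQ xs (λ x → f x y))
  ΣQ-swap []       ys f = ≡.sym (ΣQ-0 ys (λ _ → refl))
  ΣQ-swap (x ∷ xs) ys f = ≡.trans (≡.cong (ΣQ ys (f x) +_) (ΣQ-swap xs ys f))
    (≡.sym (ΣQ-+ ys (f x) (λ y → ΣQ xs (λ x → f x y))))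

  ΣQ-map : ∀ {A B : Set} (g : A → B) xs f → ΣQ (map g xs) f ≡ ΣQ xs (f ∘ g)
  ΣQ-map g []       f = refl
  ΣQ-map g (x ∷ xs) f = ≡.cong (f (g x) +_) (ΣQ-map g xs f)

  ΣQ-product : ∀ {A B : Set} (xs : List A) (ys : List B) (f : A × B → ℚ) →
    ΣQ (cartesianProduct xs ys) f ≡ ΣQ xs (λ x → ΣQ ys (λ y → f (x , y)))
  ΣQ-product []       ys f = refl
  ΣQ-product (x ∷ xs) ys f = ≡.trans (ΣQ-++ (map (x ,_) ys) _ f) (≡.cong₂ _+_ (ΣQ-map (x ,_) ys f) (ΣQ-product xs ys f))

  ΣQ-tail : ∀ m (f : Fin (suc m) → ℚ) → ΣQ (tabulate Fin.suc) f ≡ ΣQ (allFin m) (f ∘ suc)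
  ΣQ-tail m f = ≡.cong sumℚ (≡.trans (map-tabulate suc f) (≡.sym (map-tabulate id (f ∘ suc))))

  ΣP : ∀ {n} → (Pt n → ℚ) → ℚ
  ΣP {n} f = ΣQ (pts n) f

  ΣP-swap : ∀ {n} (f : Pt n → ℚ) → ΣP (f ∘ swap) ≡ ΣP f
  ΣP-swap {n} f = ≡.trans (ΣQ-product (allFin (suc n)) (allFin (suc n)) (f ∘ swap))
    (≡.trans (ΣQ-swap (allFin (suc n)) (allFin (suc n)) (λ i j → f (j , i))) (≡.sym (ΣQ-product (allFin (suc n)) (allFin (suc n)) f)))

  δ-refl : ∀ {n} (a : Fin (suc n)) → δ a a ≡ 1ℚ
  δ-refl a rewrite ≡ᵇ-refl (toℕ a) = refl

  δ-≢ : ∀ {n} {a b : Fin (suc n)} → a ≢ b → δ a b ≡ 0ℚ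
  δ-≢ {a = a} {b} ne with toℕ a ≡ᵇ toℕ b in e
  ... | true  = ⊥-elim (ne (Finₚ.toℕ-injective (≡ᵇ-sound e)))
  ... | false = refl

  δ-sym : ∀ {n} (a b : Fin (suc n)) → δ a b ≡ δ b a
  δ-sym a b with a Finₚ.≟ b
  ... | yes refl = refl
  ... | no  a≢b  = ≡.trans (δ-≢ a≢b) (≡.sym (δ-≢ (λ e → a≢b (≡.sym e))))

  δ-nonneg : ∀ {n} (a b : Fin (suc n)) → 0ℚ ≤ δ a b
  δ-nonneg a b with toℕ a ≡ᵇ toℕ b
  ... | true  = from-yes (0ℚ ℚₚ.≤? 1ℚ)
  ... | false = ℚₚ.≤-refl

  ΣQ-δ : ∀ {n} (a : Fin (suc n)) (f : Fin (suc n) → ℚ) → ΣQ (allFin (suc n)) (λ i → δ a i * f i) ≡ f a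
  ΣQ-δ {n} zero f = ≡.trans (≡.cong₂ _+_ (ℚₚ.*-identityˡ (f zero))
    (≡.trans (ΣQ-tail n (λ i → δ zero i * f i)) (ΣQ-0 (allFin n) (λ i → ℚₚ.*-zeroˡ (f (suc i)))))) (ℚₚ.+-identityʳ (f zero))
  ΣQ-δ {suc n} (suc a) f = ≡.trans (≡.cong₂ _+_ (ℚₚ.*-zeroˡ (f zero))
    (≡.trans (ΣQ-tail (suc n) (λ i → δ (suc a) i * f i)) (ΣQ-δ a (f ∘ suc)))) (ℚₚ.+-identityˡ (f (suc a)))

  mass : ∀ {n} → Pt n → Pt n → ℚ
  mass (a , b) (i , j) = δ a i * δ b j

  ΣP-mass : ∀ {n} (p : Pt n) (f : Pt n → ℚ) → ΣP (λ q → mass p q * f q) ≡ f p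
  ΣP-mass {n} (a , b) f = begin
    ΣP (λ q → mass (a , b) q * f q)
      ≡⟨ ΣQ-product (allFin (suc n)) (allFin (suc n)) (λ q → mass (a , b) q * f q) ⟩
    ΣQ (allFin (suc n)) (λ i → ΣQ (allFin (suc n)) (λ j → δ a i * δ b j * f (i , j)))
      ≡⟨ ΣQ-cong (allFin (suc n)) (λ i → ≡.trans (ΣQ-cong (allFin (suc n)) (λ j → ℚₚ.*-assoc (δ a i) (δ b j) (f (i , j))))
           (≡.trans (ΣQ-* (allFin (suc n)) (δ a i) (λ j → δ b j * f (i , j))) (≡.cong (δ a i *_) (ΣQ-δ b (λ j → f (i , j)))))) ⟩
    ΣQ (allFin (suc n)) (λ i → δ a i * f (i , b))
      ≡⟨ ΣQ-δ a (λ i → f (i , b)) ⟩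
    f (a , b) ∎

  mass-≢ : ∀ {n} {p q : Pt n} → p ≢ q → mass p q ≡ 0ℚ
  mass-≢ {p = a , b} {i , j} ne with a Finₚ.≟ i | b Finₚ.≟ j
  ... | yes refl | yes refl = ⊥-elim (ne refl)
  ... | no a≢i   | _        = ≡.trans (≡.cong (_* δ b j) (δ-≢ a≢i)) (ℚₚ.*-zeroˡ (δ b j))
  ... | yes _    | no b≢j   = ≡.trans (≡.cong (δ a i *_) (δ-≢ b≢j)) (ℚₚ.*-zeroʳ (δ a i))

  *-nonneg : ∀ {a b} → 0ℚ ≤ a → 0ℚ ≤ b → 0ℚ ≤ a * b
  *-nonneg {a} {b} p q = ≡.subst (_≤ a * b) (ℚₚ.*-zeroʳ a) (ℚₚ.*-monoˡ-≤-nonNeg a {{ℚ.nonNegative p}} q)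

  vertex : ∀ {n} (S : Sub n) p → S p ≡ true → InConv S (vec p)
  vertex {n} S p Sp = mass p
    , (λ q → *-nonneg (δ-nonneg (tl p) (tl q)) (δ-nonneg (hd p) (hd q)))
    , (λ q Sq → mass-≢ (λ e → true≢false (≡.trans (≡.sym Sp) (≡.trans (≡.cong S e) Sq))))
    , ≡.trans (ΣQ-cong (pts n) (λ q → ≡.sym (ℚₚ.*-identityʳ (mass p q)))) (ΣP-mass p (λ _ → 1ℚ))
    , (λ t → ΣP-mass p (λ q → vec q t))

  convex : ∀ {n} (S : Sub n) {x y : Vec𝐐 n} a b → 0ℚ ≤ a → 0ℚ ≤ b → a + b ≡ 1ℚ → InConv S x → InConv S y →
    InConv S (λ t → a * x t + b * y t)
  convex {n} S a b 0≤a 0≤b a+b≡1 (c , c≥0 , cS , Σc , cx) (d , d≥0 , dS , Σd , dy) =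
    (λ p → a * c p + b * d p)
    , (λ p → ℚₚ.+-mono-≤ (*-nonneg 0≤a (c≥0 p)) (*-nonneg 0≤b (d≥0 p)))
    , (λ p Sp → ≡.trans (≡.cong₂ (λ x y → a * x + b * y) (cS p Sp) (dS p Sp))
        (solve 2 (λ a b → a :* con 0ℚ :+ b :* con 0ℚ := con 0ℚ) refl a b))
    , ≡.trans (ΣQ-linear (pts n) a b c d) (≡.trans (≡.cong₂ (λ x y → a * x + b * y) Σc Σd)
        (≡.trans (≡.cong₂ _+_ (ℚₚ.*-identityʳ a) (ℚₚ.*-identityʳ b)) a+b≡1))
    , (λ t → ≡.trans (ΣQ-cong (pts n) (λ p → solve 5 (λ a b c d v → (a :* c :+ b :* d) :* v := a :* (c :* v) :+ b :* (d :* v))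
          refl a b (c p) (d p) (vec p t)))
        (≡.trans (ΣQ-linear (pts n) a b (λ p → c p * vec p t) (λ p → d p * vec p t))
          (≡.cong₂ (λ x y → a * x + b * y) (cx t) (dy t))))

  InConv-resp : ∀ {n} (S : Sub n) {x y : Vec𝐐 n} → (∀ t → x t ≡ y t) → InConv S x → InConv S y
  InConv-resp S e (c , c≥0 , cS , Σc , cx) = c , c≥0 , cS , Σc , (λ t → ≡.trans (cx t) (e t))

  isArrow-swap : ∀ {n} {p : Pt n} → isArrow (swap p) ≡ false → isArrow p ≡ false
  isArrow-swap {p = p} e with isArrow p in a
  ... | false = refl
  ... | true  = ⊥-elim (true≢false (≡.trans (≡.sym (isArrow-intro {p = swap p} (λ s → isArrow-elim {p = p} a (≡.sym s)))) e))

  -- Reversing an arrow negates its vector, so the weights are carried over along `swap`.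
  InP-neg : ∀ {n} {x : Vec𝐐 n} → InP x → InP (λ t → - x t)
  InP-neg {n} {x} (c , c≥0 , cS , Σc , cx) =
    (c ∘ swap) , (λ p → c≥0 (swap p)) , (λ p e → cS (swap p) (isArrow-swap {p = swap p} e)) , ≡.trans (ΣP-swap c) Σc
    , (λ t → begin
        ΣP (λ p → c (swap p) * vec p t)
          ≡⟨ ΣP-swap (λ p → c p * vec (swap p) t) ⟩
        ΣP (λ p → c p * vec (swap p) t)
          ≡⟨ ΣQ-cong (pts n) (λ p → solve 3 (λ c a b → c :* (a :- b) := con (- 1ℚ) :* (c :* (b :- a))) refl (c p) (δ t (tl p)) (δ t (hd p))) ⟩
        ΣP (λ p → - 1ℚ * (c p * vec p t))
          ≡⟨ ΣQ-* (pts n) (- 1ℚ) (λ p → c p * vec p t) ⟩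
        - 1ℚ * combo c t
          ≡⟨ ≡.cong (- 1ℚ *_) (cx t) ⟩
        - 1ℚ * x t
          ≡⟨ solve 1 (λ x → con (- 1ℚ) :* x := :- x) refl (x t) ⟩
        - x t ∎)

  midpoint : ∀ {n} → Pt n → Pt n → Vec𝐐 n
  midpoint p q t = ½ * vec p t + ½ * vec q t

  0≤½ : 0ℚ ≤ ½
  0≤½ = from-yes (0ℚ ℚₚ.≤? ½)

  midpoint-in : ∀ {n} (S : Sub n) p q → S p ≡ true → S q ≡ true → InConv S (midpoint p q)
  midpoint-in S p q Sp Sq = convex S ½ ½ 0≤½ 0≤½ refl (vertex S p Sp) (vertex S q Sq)

  edgeFace : ∀ {n} → Pt n → Pt n → Sub n
  edgeFace p q r = samePt p r ∨ samePt q r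

  edgeFace-elim : ∀ {n} (p q r : Pt n) → edgeFace p q r ≡ true → p ≡ r ⊎ q ≡ r
  edgeFace-elim p q r e with samePt p r in s
  ... | true  = inj₁ (samePt-sound s)
  ... | false = inj₂ (samePt-sound e)

  edgeFace-left : ∀ {n} (p q : Pt n) → edgeFace p q p ≡ true
  edgeFace-left p q rewrite samePt-refl p = refl

  edgeFace-right : ∀ {n} (p q : Pt n) → edgeFace p q q ≡ true
  edgeFace-right p q rewrite samePt-refl q = ∨-zeroʳ (samePt p q)

  edgeFace-isFace : ∀ {n} (E : EdgeRel n) → IsSymmetric E → ∀ p q → tl p ≢ hd p → tl q ≢ hd q → E p q ≡ true →
    isFace E (edgeFace p q) ≡ true
  edgeFace-isFace E sy p q ap aq e = isFace-intro E (edgeFace p q) (record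
    { arrows = λ i j s → arr (i , j) (edgeFace-elim p q (i , j) s)
    ; edges  = λ i j k l s s′ ne → edg (i , j) (k , l) ne (edgeFace-elim p q (i , j) s) (edgeFace-elim p q (k , l) s′) })
    where
    arr : ∀ r → p ≡ r ⊎ q ≡ r → tl r ≢ hd r
    arr r (inj₁ refl) = ap
    arr r (inj₂ refl) = aq
    edg : ∀ r s → r ≢ s → p ≡ r ⊎ q ≡ r → p ≡ s ⊎ q ≡ s → E r s ≡ true
    edg r s ne (inj₁ refl) (inj₁ refl) = ⊥-elim (ne refl)
    edg r s ne (inj₁ refl) (inj₂ refl) = e
    edg r s ne (inj₂ refl) (inj₁ refl) = ≡.trans (sy q p) e
    edg r s ne (inj₂ refl) (inj₂ refl) = ⊥-elim (ne refl)

  φ : ∀ {n} → (Fin (suc n) → ℚ) → Vec𝐐 n → ℚ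
  φ {n} σ z = ΣQ (allFin (suc n)) (λ t → σ t * z t)

  φ-vec : ∀ {n} (σ : Fin (suc n) → ℚ) p → φ σ (vec p) ≡ σ (hd p) - σ (tl p)
  φ-vec {n} σ (i , j) = begin
    ΣQ (allFin (suc n)) (λ t → σ t * (δ t j - δ t i))
      ≡⟨ ΣQ-cong (allFin (suc n)) (λ t → ≡.trans (≡.cong₂ (λ a b → σ t * (a - b)) (δ-sym t j) (δ-sym t i))
          (solve 3 (λ s a b → s :* (a :- b) := con 1ℚ :* (a :* s) :+ con (- 1ℚ) :* (b :* s)) refl (σ t) (δ j t) (δ i t))) ⟩
    ΣQ (allFin (suc n)) (λ t → 1ℚ * (δ j t * σ t) + - 1ℚ * (δ i t * σ t))
      ≡⟨ ΣQ-linear (allFin (suc n)) 1ℚ (- 1ℚ) (λ t → δ j t * σ t) (λ t → δ i t * σ t) ⟩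
    1ℚ * ΣQ (allFin (suc n)) (λ t → δ j t * σ t) + - 1ℚ * ΣQ (allFin (suc n)) (λ t → δ i t * σ t)
      ≡⟨ ≡.cong₂ (λ a b → 1ℚ * a + - 1ℚ * b) (ΣQ-δ j σ) (ΣQ-δ i σ) ⟩
    1ℚ * σ j + - 1ℚ * σ i
      ≡⟨ solve 2 (λ a b → con 1ℚ :* a :+ con (- 1ℚ) :* b := a :- b) refl (σ j) (σ i) ⟩
    σ j - σ i ∎

  φ-combo : ∀ {n} (σ : Fin (suc n) → ℚ) c → φ σ (combo c) ≡ ΣP (λ p → c p * (σ (hd p) - σ (tl p)))
  φ-combo {n} σ c = begin
    ΣQ (allFin (suc n)) (λ t → σ t * ΣP (λ p → c p * vec p t))
      ≡⟨ ΣQ-cong (allFin (suc n)) (λ t → ≡.sym (ΣQ-* (pts n) (σ t) (λ p → c p * vec p t))) ⟩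
    ΣQ (allFin (suc n)) (λ t → ΣP (λ p → σ t * (c p * vec p t)))
      ≡⟨ ΣQ-swap (allFin (suc n)) (pts n) (λ t p → σ t * (c p * vec p t)) ⟩
    ΣP (λ p → ΣQ (allFin (suc n)) (λ t → σ t * (c p * vec p t)))
      ≡⟨ ΣQ-cong (pts n) (λ p → ≡.trans (ΣQ-cong (allFin (suc n)) (λ t →
          solve 3 (λ s c v → s :* (c :* v) := c :* (s :* v)) refl (σ t) (c p) (vec p t)))
          (≡.trans (ΣQ-* (allFin (suc n)) (c p) (λ t → σ t * vec p t)) (≡.cong (c p *_) (φ-vec σ p)))) ⟩
    ΣP (λ p → c p * (σ (hd p) - σ (tl p))) ∎

  φ-cong : ∀ {n} (σ : Fin (suc n) → ℚ) {x y : Vec𝐐 n} → (∀ t → x t ≡ y t) → φ σ x ≡ φ σ y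
  φ-cong {n} σ e = ΣQ-cong (allFin (suc n)) (λ t → ≡.cong (σ t *_) (e t))

  φ-linear : ∀ {n} (σ : Fin (suc n) → ℚ) a b (x y : Vec𝐐 n) → φ σ (λ t → a * x t + b * y t) ≡ a * φ σ x + b * φ σ y
  φ-linear {n} σ a b x y = ≡.trans (ΣQ-cong (allFin (suc n)) (λ t →
    solve 5 (λ s a b x y → s :* (a :* x :+ b :* y) := a :* (s :* x) :+ b :* (s :* y)) refl (σ t) a b (x t) (y t)))
    (ΣQ-linear (allFin (suc n)) a b (λ t → σ t * x t) (λ t → σ t * y t))

  -- The edges forced or excluded by the geometry.

  head-tail-nonedge : ∀ {n} (E : EdgeRel n) → IsSymmetric E → IsTriangulationOfBoundary E →
    ∀ i j k → i ≢ j → j ≢ k → E (i , j) (j , k) ≡ false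
  head-tail-nonedge E sy (_ , inside , _) i j k i≢j j≢k = ¬-not λ e →
    proj₂ (inside (edgeFace p q) (edgeFace-isFace E sy p q i≢j j≢k e) (midpoint p q)
      (midpoint-in (edgeFace p q) p q (edgeFace-left p q) (edgeFace-right p q)))
      (midpoint-in isArrow p q (isArrow-intro {p = p} i≢j) (isArrow-intro {p = q} j≢k) , λ y yP →
        -- With m = ½(v + w), the point m + ⅓(m - y) equals ⅔(v + w) + ⅓(-y), a convex combination
        -- of two points of the polytope.
        ⅓ , from-yes (0ℚ ℚₚ.<? ⅓) , InConv-resp isArrow (λ t →
          solve 3 (λ v w y → con ⅔ :* (v :+ w) :+ con ⅓ :* (:- y)
            := (con ½ :* v :+ con ½ :* w) :+ con ⅓ :* ((con ½ :* v :+ con ½ :* w) :- y)) refl (vec p t) (vec q t) (y t))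
          (convex isArrow ⅔ ⅓ (from-yes (0ℚ ℚₚ.≤? ⅔)) (from-yes (0ℚ ℚₚ.≤? ⅓)) refl sum-in (InP-neg yP)))
    where
    p q : _
    p = i , j
    q = j , k
    sum-in : InP (λ t → vec p t + vec q t)
    sum-in with i Finₚ.≟ k
    ... | no i≢k   = InConv-resp isArrow (λ t →
      solve 3 (λ i j k → k :- i := (j :- i) :+ (k :- j)) refl (δ t i) (δ t j) (δ t k))
      (vertex isArrow (i , k) (isArrow-intro {p = i , k} i≢k))
    -- Here the arrows are opposite and their sum is the origin, which is also their midpoint.
    ... | yes refl = InConv-resp isArrow (λ t →
      solve 2 (λ i j → con ½ :* (j :- i) :+ con ½ :* (i :- j) := (j :- i) :+ (i :- j)) refl (δ t i) (δ t j))
      (midpoint-in isArrow p q (isArrow-intro {p = p} i≢j) (isArrow-intro {p = q} j≢k))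

  data Sign : Set where
    ⊕ ⊖ ⊙ : Sign

  value : Sign → ℚ
  value ⊕ = 1ℚ
  value ⊖ = - 1ℚ
  value ⊙ = 0ℚ

  value-gap : ∀ s s′ → value s - value s′ ≤ 2ℚ
  value-gap ⊕ ⊕ = ℚₚ.≤ᵇ⇒≤ tt
  value-gap ⊕ ⊖ = ℚₚ.≤ᵇ⇒≤ tt
  value-gap ⊕ ⊙ = ℚₚ.≤ᵇ⇒≤ tt
  value-gap ⊖ ⊕ = ℚₚ.≤ᵇ⇒≤ tt
  value-gap ⊖ ⊖ = ℚₚ.≤ᵇ⇒≤ tt
  value-gap ⊖ ⊙ = ℚₚ.≤ᵇ⇒≤ tt
  value-gap ⊙ ⊕ = ℚₚ.≤ᵇ⇒≤ tt
  value-gap ⊙ ⊖ = ℚₚ.≤ᵇ⇒≤ tt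
  value-gap ⊙ ⊙ = ℚₚ.≤ᵇ⇒≤ tt

  value-tight : ∀ s s′ → (s ≡ ⊕ × s′ ≡ ⊖) ⊎ value s - value s′ ≤ 1ℚ
  value-tight ⊕ ⊖ = inj₁ (refl , refl)
  value-tight ⊕ ⊕ = inj₂ (ℚₚ.≤ᵇ⇒≤ tt)
  value-tight ⊕ ⊙ = inj₂ (ℚₚ.≤ᵇ⇒≤ tt)
  value-tight ⊖ ⊕ = inj₂ (ℚₚ.≤ᵇ⇒≤ tt)
  value-tight ⊖ ⊖ = inj₂ (ℚₚ.≤ᵇ⇒≤ tt)
  value-tight ⊖ ⊙ = inj₂ (ℚₚ.≤ᵇ⇒≤ tt)
  value-tight ⊙ ⊕ = inj₂ (ℚₚ.≤ᵇ⇒≤ tt)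
  value-tight ⊙ ⊖ = inj₂ (ℚₚ.≤ᵇ⇒≤ tt)
  value-tight ⊙ ⊙ = inj₂ (ℚₚ.≤ᵇ⇒≤ tt)

  -- Applied with d a Kronecker delta: ½ + ½d is, up to sign, a coordinate of the midpoint at one of
  -- the four endpoints. The delta allows coinciding tails or coinciding heads.
  half-pos : ∀ d → 0ℚ ≤ d → ½ + ½ * d ≢ 0ℚ
  half-pos d p e = ℚₚ.<⇒≢ (ℚₚ.<-≤-trans (from-yes (0ℚ ℚₚ.<? ½))
    (≡.subst (_≤ ½ + ½ * d) (ℚₚ.+-identityʳ ½) (ℚₚ.+-monoʳ-≤ ½ (*-nonneg 0≤½ p)))) (≡.sym e)

  -- The functional with value 1 at x and y, −1 at a and b, and 0 elsewhere is at most 2 on the polytope,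
  -- and the face where it equals 2 is spanned by the arrows from {a , b} to {x , y}.
  module Exposed {n} (a b x y : Fin (suc n)) (a≢x : a ≢ x) (a≢y : a ≢ y) (b≢x : b ≢ x) (b≢y : b ≢ y) where

    sign : Fin (suc n) → Sign
    sign t with t Finₚ.≟ x | t Finₚ.≟ y | t Finₚ.≟ a | t Finₚ.≟ b
    ... | yes _ | _     | _     | _     = ⊕
    ... | no _  | yes _ | _     | _     = ⊕
    ... | no _  | no _  | yes _ | _     = ⊖
    ... | no _  | no _  | no _  | yes _ = ⊖
    ... | no _  | no _  | no _  | no _  = ⊙

    sign-⊕ : ∀ {t} → sign t ≡ ⊕ → t ≡ x ⊎ t ≡ y
    sign-⊕ {t} e with t Finₚ.≟ x | t Finₚ.≟ y | t Finₚ.≟ a | t Finₚ.≟ b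
    ... | yes p | _     | _     | _     = inj₁ p
    ... | no _  | yes p | _     | _     = inj₂ p
    sign-⊕ () | no _ | no _ | yes _ | _
    sign-⊕ () | no _ | no _ | no _ | yes _
    sign-⊕ () | no _ | no _ | no _ | no _

    sign-⊖ : ∀ {t} → sign t ≡ ⊖ → t ≡ a ⊎ t ≡ b
    sign-⊖ {t} e with t Finₚ.≟ x | t Finₚ.≟ y | t Finₚ.≟ a | t Finₚ.≟ b
    ... | no _ | no _ | yes p | _     = inj₁ p
    ... | no _ | no _ | no _  | yes p = inj₂ p
    sign-⊖ () | yes _ | _     | _    | _
    sign-⊖ () | no _  | yes _ | _    | _
    sign-⊖ () | no _  | no _  | no _ | no _

    sign-head : ∀ {t} → t ≡ x ⊎ t ≡ y → sign t ≡ ⊕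
    sign-head {t} h with t Finₚ.≟ x | t Finₚ.≟ y | t Finₚ.≟ a | t Finₚ.≟ b
    ... | yes _ | _     | _ | _ = refl
    ... | no _  | yes _ | _ | _ = refl
    sign-head (inj₁ p) | no ¬p | no _  | _ | _ = ⊥-elim (¬p p)
    sign-head (inj₂ p) | no _  | no ¬p | _ | _ = ⊥-elim (¬p p)

    tail≢head : ∀ {t} → t ≡ a ⊎ t ≡ b → t ≡ x ⊎ t ≡ y → ⊥
    tail≢head (inj₁ refl) (inj₁ e) = a≢x e
    tail≢head (inj₁ refl) (inj₂ e) = a≢y e
    tail≢head (inj₂ refl) (inj₁ e) = b≢x e
    tail≢head (inj₂ refl) (inj₂ e) = b≢y e

    sign-tail : ∀ {t} → t ≡ a ⊎ t ≡ b → sign t ≡ ⊖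
    sign-tail {t} h with t Finₚ.≟ x | t Finₚ.≟ y | t Finₚ.≟ a | t Finₚ.≟ b
    ... | yes p | _     | _     | _     = ⊥-elim (tail≢head h (inj₁ p))
    ... | no _  | yes p | _     | _     = ⊥-elim (tail≢head h (inj₂ p))
    ... | no _  | no _  | yes _ | _     = refl
    ... | no _  | no _  | no _  | yes _ = refl
    sign-tail (inj₁ p) | no _ | no _ | no ¬p | no _  = ⊥-elim (¬p p)
    sign-tail (inj₂ p) | no _ | no _ | no _  | no ¬p = ⊥-elim (¬p p)

    σ : Fin (suc n) → ℚ
    σ = value ∘ sign

    gap : Pt n → ℚ
    gap p = σ (hd p) - σ (tl p)

    m : Vec𝐐 n
    m = midpoint (a , x) (b , y)

    m-in : InP m
    m-in = midpoint-in isArrow (a , x) (b , y) (isArrow-intro {p = a , x} a≢x) (isArrow-intro {p = b , y} b≢y)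

    φ-m : φ σ m ≡ 2ℚ
    φ-m = ≡.trans (φ-linear σ ½ ½ (vec (a , x)) (vec (b , y)))
      (≡.trans (≡.cong₂ (λ u v → ½ * u + ½ * v) (φ-vec σ (a , x)) (φ-vec σ (b , y))) values)
      where
      values : ½ * (σ x - σ a) + ½ * (σ y - σ b) ≡ 2ℚ
      values rewrite sign-head {x} (inj₁ refl) | sign-head {y} (inj₂ refl) | sign-tail {a} (inj₁ refl) | sign-tail {b} (inj₂ refl) = refl

    φ-bound : ∀ {z} → InP z → φ σ z ≤ 2ℚ
    φ-bound {z} (c , c≥0 , _ , Σc , cz) = ≡.subst₂ _≤_
      (≡.trans (≡.sym (φ-combo σ c)) (φ-cong σ cz))
      (≡.trans (ΣQ-* (pts n) 2ℚ c) (≡.trans (≡.cong (2ℚ *_) Σc) (ℚₚ.*-identityʳ 2ℚ)))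
      (ΣQ-mono (pts n) (λ p → ≡.subst (c p * gap p ≤_) (ℚₚ.*-comm (c p) 2ℚ)
        (ℚₚ.*-monoˡ-≤-nonNeg (c p) {{ℚ.nonNegative (c≥0 p)}} (value-gap (sign (hd p)) (sign (tl p))))))

    m-boundary : InBoundary m
    -- Testing against y = -m suffices: m + ε(m + m) has value 2 + 4ε under the functional, above
    -- its maximum 2 on the polytope.
    m-boundary = m-in , λ (_ , extend) → beyond (extend (λ t → - m t) (InP-neg m-in))
      where
      beyond : Σ ℚ (λ ε → (0ℚ < ε) × InP (λ t → m t + ε * (m t - (- m t)))) → ⊥
      beyond (ε , ε>0 , z) = ℚₚ.<-irrefl refl (ℚₚ.<-≤-trans larger (φ-bound z))
        where
        φ-value : φ σ (λ t → m t + ε * (m t - (- m t))) ≡ 2ℚ + ((ε + ε) + (ε + ε))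
        φ-value = begin
          φ σ (λ t → m t + ε * (m t - (- m t)))
            ≡⟨ φ-cong σ (λ t → solve 2 (λ e m → m :+ e :* (m :- (:- m)) := con 1ℚ :* m :+ (e :+ e) :* m) refl ε (m t)) ⟩
          φ σ (λ t → 1ℚ * m t + (ε + ε) * m t)
            ≡⟨ φ-linear σ 1ℚ (ε + ε) m m ⟩
          1ℚ * φ σ m + (ε + ε) * φ σ m
            ≡⟨ ≡.cong (λ f → 1ℚ * f + (ε + ε) * f) φ-m ⟩
          1ℚ * 2ℚ + (ε + ε) * 2ℚ
            ≡⟨ solve 1 (λ e → con 1ℚ :* con 2ℚ :+ (e :+ e) :* con 2ℚ := con 2ℚ :+ ((e :+ e) :+ (e :+ e))) refl ε ⟩
          2ℚ + ((ε + ε) + (ε + ε)) ∎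
        larger : 2ℚ < φ σ (λ t → m t + ε * (m t - (- m t)))
        larger = ≡.subst₂ _<_ (ℚₚ.+-identityʳ 2ℚ) (≡.sym φ-value)
          (ℚₚ.+-monoʳ-< 2ℚ {0ℚ} (ℚₚ.+-mono-< {0ℚ} {ε + ε} {0ℚ} {ε + ε} (ℚₚ.+-mono-< {0ℚ} {ε} {0ℚ} ε>0 ε>0) (ℚₚ.+-mono-< {0ℚ} {ε} {0ℚ} ε>0 ε>0)))

    module Cover (S : Sub n) (c : Pt n → ℚ) (c≥0 : ∀ p → 0ℚ ≤ c p) (cS : supportedIn S c)
                 (Σc : ΣP c ≡ 1ℚ) (cm : ∀ t → combo c t ≡ m t) where

      -- Complementary slackness: the total 2 - φ(m) is zero and every term is nonnegative.
      slack : ∀ p → c p * (2ℚ - gap p) ≡ 0ℚ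
      slack p = ΣQ-vanish (pts n) (λ p → *-nonneg (c≥0 p) (slack-nonneg p)) total (∈-pts p)
        where
        slack-nonneg : ∀ p → 0ℚ ≤ 2ℚ - gap p
        slack-nonneg p = ≡.subst (_≤ 2ℚ - gap p) (ℚₚ.+-inverseʳ (gap p))
          (ℚₚ.+-monoˡ-≤ (- gap p) (value-gap (sign (hd p)) (sign (tl p))))
        total : ΣP (λ p → c p * (2ℚ - gap p)) ≡ 0ℚ
        total = begin
          ΣP (λ p → c p * (2ℚ - gap p))
            ≡⟨ ΣQ-cong (pts n) (λ p → solve 2 (λ c g → c :* (con 2ℚ :- g) := con 2ℚ :* c :+ con (- 1ℚ) :* (c :* g)) refl (c p) (gap p)) ⟩
          ΣP (λ p → 2ℚ * c p + - 1ℚ * (c p * gap p))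
            ≡⟨ ΣQ-linear (pts n) 2ℚ (- 1ℚ) c (λ p → c p * gap p) ⟩
          2ℚ * ΣP c + - 1ℚ * ΣP (λ p → c p * gap p)
            ≡⟨ ≡.cong₂ (λ u v → 2ℚ * u + - 1ℚ * v) Σc (≡.trans (≡.sym (φ-combo σ c)) (≡.trans (φ-cong σ cm) φ-m)) ⟩
          2ℚ * 1ℚ + - 1ℚ * 2ℚ
            ≡⟨⟩
          0ℚ ∎

      support : ∀ p → c p ≡ 0ℚ ⊎ ((tl p ≡ a ⊎ tl p ≡ b) × (hd p ≡ x ⊎ hd p ≡ y))
      support p with value-tight (sign (hd p)) (sign (tl p))
      ... | inj₁ (h , t) = inj₂ (sign-⊖ t , sign-⊕ h)
      -- The slack factor is at least 1 here, so the vanishing product bounds `c p` above by 0.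
      ... | inj₂ gap≤1   = inj₁ (ℚₚ.≤-antisym (≡.subst₂ _≤_ (ℚₚ.*-identityʳ (c p)) (slack p)
        (ℚₚ.*-monoˡ-≤-nonNeg (c p) {{ℚ.nonNegative (c≥0 p)}} 1≤)) (c≥0 p))
        where
        1≤ : 1ℚ ≤ 2ℚ - gap p
        1≤ = ℚₚ.+-monoʳ-≤ 2ℚ (ℚₚ.neg-antimono-≤ gap≤1)

      vanish : ∀ t → (∀ p → c p ≡ 0ℚ ⊎ vec p t ≡ 0ℚ) → m t ≡ 0ℚ
      vanish t f = ≡.trans (≡.sym (cm t)) (ΣQ-0 (pts n) term)
        where
        term : ∀ p → c p * vec p t ≡ 0ℚ
        term p with f p
        ... | inj₁ e = ≡.trans (≡.cong (_* vec p t) e) (ℚₚ.*-zeroˡ (vec p t))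
        ... | inj₂ e = ≡.trans (≡.cong (c p *_) e) (ℚₚ.*-zeroʳ (c p))

      vec-0 : ∀ {t : Fin (suc n)} (p : Pt n) → t ≢ hd p → t ≢ tl p → vec p t ≡ 0ℚ
      vec-0 p ne ne′ = ≡.cong₂ _-_ (δ-≢ ne) (δ-≢ ne′)

      -- The midpoint has a nonzero coordinate at h. Among arrows from {a , b} to {x , y}, only
      -- those with head h affect that coordinate, so one of the two must be in the simplex.
      head-covered : ∀ h → h ≡ x ⊎ h ≡ y → S (a , h) ≡ false → S (b , h) ≡ false → ⊥
      head-covered h h∈ Sa Sb = value-h h∈ (vanish h λ p → term p (support p))
        where
        term : ∀ p → c p ≡ 0ℚ ⊎ ((tl p ≡ a ⊎ tl p ≡ b) × (hd p ≡ x ⊎ hd p ≡ y)) → c p ≡ 0ℚ ⊎ vec p h ≡ 0ℚ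
        term p (inj₁ e) = inj₁ e
        term p (inj₂ (t∈ , _)) with h Finₚ.≟ hd p
        term p (inj₂ (inj₁ refl , _)) | yes refl = inj₁ (cS p Sa)
        term p (inj₂ (inj₂ refl , _)) | yes refl = inj₁ (cS p Sb)
        ... | no ne = inj₂ (vec-0 {h} p ne λ e → tail≢head (≡.subst (λ t → t ≡ a ⊎ t ≡ b) (≡.sym e) t∈) h∈)
        value-h : h ≡ x ⊎ h ≡ y → m h ≢ 0ℚ
        value-h (inj₁ refl) e = half-pos (δ x y) (δ-nonneg x y) (≡.trans (≡.sym (begin
          ½ * (δ x x - δ x a) + ½ * (δ x y - δ x b)
            ≡⟨ ≡.cong₂ (λ u v → ½ * (u - v) + ½ * (δ x y - δ x b)) (δ-refl x) (δ-≢ (a≢x ∘ ≡.sym)) ⟩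
          ½ * (1ℚ - 0ℚ) + ½ * (δ x y - δ x b)
            ≡⟨ ≡.cong (λ u → ½ * (1ℚ - 0ℚ) + ½ * (δ x y - u)) (δ-≢ (b≢x ∘ ≡.sym)) ⟩
          ½ * (1ℚ - 0ℚ) + ½ * (δ x y - 0ℚ)
            ≡⟨ solve 1 (λ d → con ½ :* (con 1ℚ :- con 0ℚ) :+ con ½ :* (d :- con 0ℚ) := con ½ :+ con ½ :* d) refl (δ x y) ⟩
          ½ + ½ * δ x y ∎)) e)
        value-h (inj₂ refl) e = half-pos (δ y x) (δ-nonneg y x) (≡.trans (≡.sym (begin
          ½ * (δ y x - δ y a) + ½ * (δ y y - δ y b)
            ≡⟨ ≡.cong₂ (λ u v → ½ * (δ y x - δ y a) + ½ * (u - v)) (δ-refl y) (δ-≢ (b≢y ∘ ≡.sym)) ⟩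
          ½ * (δ y x - δ y a) + ½ * (1ℚ - 0ℚ)
            ≡⟨ ≡.cong (λ u → ½ * (δ y x - u) + ½ * (1ℚ - 0ℚ)) (δ-≢ (a≢y ∘ ≡.sym)) ⟩
          ½ * (δ y x - 0ℚ) + ½ * (1ℚ - 0ℚ)
            ≡⟨ solve 1 (λ d → con ½ :* (d :- con 0ℚ) :+ con ½ :* (con 1ℚ :- con 0ℚ) := con ½ :+ con ½ :* d) refl (δ y x) ⟩
          ½ + ½ * δ y x ∎)) e)

      tail-covered : ∀ g → g ≡ a ⊎ g ≡ b → S (g , x) ≡ false → S (g , y) ≡ false → ⊥
      tail-covered g g∈ Sx Sy = value-g g∈ (vanish g λ p → term p (support p))
        where
        term : ∀ p → c p ≡ 0ℚ ⊎ ((tl p ≡ a ⊎ tl p ≡ b) × (hd p ≡ x ⊎ hd p ≡ y)) → c p ≡ 0ℚ ⊎ vec p g ≡ 0ℚ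
        term p (inj₁ e) = inj₁ e
        term p (inj₂ (_ , h∈)) with g Finₚ.≟ tl p
        term p (inj₂ (_ , inj₁ refl)) | yes refl = inj₁ (cS p Sx)
        term p (inj₂ (_ , inj₂ refl)) | yes refl = inj₁ (cS p Sy)
        ... | no ne = inj₂ (vec-0 {g} p (λ e → tail≢head g∈ (≡.subst (λ t → t ≡ x ⊎ t ≡ y) (≡.sym e) h∈)) ne)
        neg-0 : ∀ u d → u ≡ - (½ + ½ * d) → u ≡ 0ℚ → ½ + ½ * d ≡ 0ℚ
        neg-0 u d e e′ = ℚₚ.neg-injective (≡.trans (≡.sym e) e′)
        value-g : g ≡ a ⊎ g ≡ b → m g ≢ 0ℚ
        value-g (inj₁ refl) e = half-pos (δ a b) (δ-nonneg a b) (neg-0 (m a) (δ a b) (begin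
          ½ * (δ a x - δ a a) + ½ * (δ a y - δ a b)
            ≡⟨ ≡.cong₂ (λ u v → ½ * (u - v) + ½ * (δ a y - δ a b)) (δ-≢ a≢x) (δ-refl a) ⟩
          ½ * (0ℚ - 1ℚ) + ½ * (δ a y - δ a b)
            ≡⟨ ≡.cong (λ u → ½ * (0ℚ - 1ℚ) + ½ * (u - δ a b)) (δ-≢ a≢y) ⟩
          ½ * (0ℚ - 1ℚ) + ½ * (0ℚ - δ a b)
            ≡⟨ solve 1 (λ d → con ½ :* (con 0ℚ :- con 1ℚ) :+ con ½ :* (con 0ℚ :- d) := :- (con ½ :+ con ½ :* d)) refl (δ a b) ⟩
          - (½ + ½ * δ a b) ∎) e)
        value-g (inj₂ refl) e = half-pos (δ b a) (δ-nonneg b a) (neg-0 (m b) (δ b a) (begin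
          ½ * (δ b x - δ b a) + ½ * (δ b y - δ b b)
            ≡⟨ ≡.cong₂ (λ u v → ½ * (δ b x - δ b a) + ½ * (u - v)) (δ-≢ b≢y) (δ-refl b) ⟩
          ½ * (δ b x - δ b a) + ½ * (0ℚ - 1ℚ)
            ≡⟨ ≡.cong (λ u → ½ * (u - δ b a) + ½ * (0ℚ - 1ℚ)) (δ-≢ b≢x) ⟩
          ½ * (0ℚ - δ b a) + ½ * (0ℚ - 1ℚ)
            ≡⟨ solve 1 (λ d → con ½ :* (con 0ℚ :- d) :+ con ½ :* (con 0ℚ :- con 1ℚ) := :- (con ½ :+ con ½ :* d)) refl (δ b a) ⟩
          - (½ + ½ * δ b a) ∎) e)

    record Covering (E : EdgeRel n) : Set where
      field
        S     : Sub n
        isF   : Face E (λ i j → S (i , j))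
        heads : ∀ h → h ≡ x ⊎ h ≡ y → S (a , h) ≡ false → S (b , h) ≡ false → ⊥
        tails : ∀ g → g ≡ a ⊎ g ≡ b → S (g , x) ≡ false → S (g , y) ≡ false → ⊥

    covering : (E : EdgeRel n) → IsTriangulationOfBoundary E → Covering E
    covering E (_ , _ , cover , _) = from-cover (cover m m-boundary)
      where
      from-cover : Σ (Sub n) (λ S → (isFace E S ≡ true) × InConv S m) → Covering E
      from-cover (S , isF , c , c≥0 , cS , Σc , cm) = record
        { S = S ; isF = isFace-elim E S isF
        ; heads = Cover.head-covered S c c≥0 cS Σc cm ; tails = Cover.tail-covered S c c≥0 cS Σc cm }

  ≢false : ∀ {b} → (b ≡ false → ⊥) → b ≡ true
  ≢false = ¬-not

  -- `Exposed` with a = b: the exposed face is the segment joining the two arrows, so a simplex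
  -- covering its midpoint contains both. Dually, `shared-head-edge` takes x = y.
  shared-tail-edge : ∀ {n} (E : EdgeRel n) → IsTriangulationOfBoundary E →
    ∀ a x y → a ≢ x → a ≢ y → x ≢ y → E (a , x) (a , y) ≡ true
  shared-tail-edge E tri a x y a≢x a≢y x≢y = Face.edges isF a x a y (≢false λ e → heads x (inj₁ refl) e e) (≢false λ e → heads y (inj₂ refl) e e)
    (λ e → x≢y (≡.cong proj₂ e))
    where open Exposed.Covering (Exposed.covering a a x y a≢x a≢y a≢x a≢y E tri)

  shared-head-edge : ∀ {n} (E : EdgeRel n) → IsTriangulationOfBoundary E →
    ∀ a b x → a ≢ x → b ≢ x → a ≢ b → E (a , x) (b , x) ≡ true
  shared-head-edge E tri a b x a≢x b≢x a≢b = Face.edges isF a x b x (≢false λ e → tails a (inj₁ refl) e e) (≢false λ e → tails b (inj₂ refl) e e)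
    (λ e → a≢b (≡.cong proj₁ e))
    where open Exposed.Covering (Exposed.covering a b x x a≢x a≢x b≢x b≢x E tri)

  -- The two matchings are disjoint pairs of arrows with the same midpoint. If both were edges, the
  -- intersection property would put this point in the hull of the empty set. If neither were, no
  -- face could cover it.
  exchange-edge : ∀ {n} (E : EdgeRel n) → IsSymmetric E → IsTriangulationOfBoundary E →
    ∀ a b x y → a ≢ x → a ≢ y → b ≢ x → b ≢ y → a ≢ b → x ≢ y → E (a , x) (b , y) ≡ not (E (a , y) (b , x))
  exchange-edge {n} E sy tri@(_ , _ , _ , meet) a b x y a≢x a≢y b≢x b≢y a≢b x≢y =
    differ (E (a , x) (b , y)) (E (a , y) (b , x)) refl refl
    where
    S T : Sub n
    S = edgeFace (a , x) (b , y)
    T = edgeFace (a , y) (b , x)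
    apart : ∀ r → (a , x) ≡ r ⊎ (b , y) ≡ r → (a , y) ≡ r ⊎ (b , x) ≡ r → ⊥
    apart r (inj₁ refl) (inj₁ e) = x≢y (≡.sym (≡.cong proj₂ e))
    apart r (inj₁ refl) (inj₂ e) = a≢b (≡.sym (≡.cong proj₁ e))
    apart r (inj₂ refl) (inj₁ e) = a≢b (≡.cong proj₁ e)
    apart r (inj₂ refl) (inj₂ e) = x≢y (≡.cong proj₂ e)
    empty : ∀ r → inter S T r ≡ false
    empty r = ¬-not λ e → apart r (edgeFace-elim (a , x) (b , y) r (proj₁ (∧-true {S r} e)))
                                  (edgeFace-elim (a , y) (b , x) r (proj₂ (∧-true {S r} e)))
    disjoint : ∀ {z : Vec𝐐 n} → InConv (inter S T) z → ⊥
    disjoint (c , _ , cST , Σc , _) = ℚₚ.<⇒≢ (from-yes (0ℚ ℚₚ.<? 1ℚ)) (≡.trans (≡.sym (ΣQ-0 (pts n) (λ p → cST p (empty p)))) Σc)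
    open Exposed.Covering (Exposed.covering a b x y a≢x a≢y b≢x b≢y E tri) renaming (S to U)
    -- A subset of the 2 × 2 grid {a , b} × {x , y} that meets every row and every column contains a
    -- diagonal, that is, one of the two matchings.
    none-covers : E (a , x) (b , y) ≡ false → E (a , y) (b , x) ≡ false →
      ∀ ax by ay bx → U (a , x) ≡ ax → U (b , y) ≡ by → U (a , y) ≡ ay → U (b , x) ≡ bx → ⊥
    none-covers e₁ e₂ true  true  _     _     p q _ _ = true≢false (≡.trans (≡.sym (Face.edges isF a x b y p q (λ e → a≢b (≡.cong proj₁ e)))) e₁)
    none-covers e₁ e₂ _     _     true  true  _ _ p q = true≢false (≡.trans (≡.sym (Face.edges isF a y b x p q (λ e → a≢b (≡.cong proj₁ e)))) e₂)
    none-covers e₁ e₂ false _     false _     p _ q _ = tails a (inj₁ refl) p q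
    none-covers e₁ e₂ false _     _     false p _ _ q = heads x (inj₁ refl) p q
    none-covers e₁ e₂ _     false false _     _ p q _ = heads y (inj₂ refl) q p
    none-covers e₁ e₂ _     false _     false _ p _ q = tails b (inj₂ refl) q p
    differ : ∀ u v → E (a , x) (b , y) ≡ u → E (a , y) (b , x) ≡ v → E (a , x) (b , y) ≡ not (E (a , y) (b , x))
    differ true  false e₁ e₂ = ≡.trans e₁ (≡.cong not (≡.sym e₂))
    differ false true  e₁ e₂ = ≡.trans e₁ (≡.cong not (≡.sym e₂))
    differ true  true  e₁ e₂ = ⊥-elim (disjoint (meet S T
      (edgeFace-isFace E sy (a , x) (b , y) a≢x b≢y e₁) (edgeFace-isFace E sy (a , y) (b , x) a≢y b≢x e₂)
      (midpoint (a , x) (b , y))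
      (midpoint-in S (a , x) (b , y) (edgeFace-left (a , x) (b , y)) (edgeFace-right (a , x) (b , y)))
      (InConv-resp T (λ t → solve 4 (λ a b x y → con ½ :* (y :- a) :+ con ½ :* (x :- b) := con ½ :* (x :- a) :+ con ½ :* (y :- b))
          refl (δ t a) (δ t b) (δ t x) (δ t y))
        (midpoint-in T (a , y) (b , x) (edgeFace-left (a , y) (b , x)) (edgeFace-right (a , y) (b , x))))))
    differ false false e₁ e₂ = ⊥-elim (none-covers e₁ e₂ _ _ _ _ refl refl refl refl)

  -- From the geometry to the rules for edges.

  -- What the counting needs of Δ, in a form invariant under reversal of all arrows.
  record LexRelation {n} (E : EdgeRel n) : Set where
    field
      symmetric   : IsSymmetric E
      uniform     : IsUniform E
      head-tail   : ∀ i j k → i ≢ j → j ≢ k → E (i , j) (j , k) ≡ false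
      shared-tail : ∀ a x y → a ≢ x → a ≢ y → x ≢ y → E (a , x) (a , y) ≡ true
      shared-head : ∀ a b x → a ≢ x → b ≢ x → a ≢ b → E (a , x) (b , x) ≡ true
      exchange    : ∀ a b x y → a ≢ x → a ≢ y → b ≢ x → b ≢ y → a ≢ b → x ≢ y → E (a , x) (b , y) ≡ not (E (a , y) (b , x))
      lex         : InLexClass E

  lexRelation : ∀ {n} (Δ : UniformFlagTriangulation n) → InLexClass (UniformFlagTriangulation.edge Δ) →
    LexRelation (UniformFlagTriangulation.edge Δ)
  lexRelation Δ lex = record
    { symmetric   = symmetric
    ; uniform     = uniform
    ; head-tail   = head-tail-nonedge edge symmetric triang
    ; shared-tail = shared-tail-edge edge triang
    ; shared-head = shared-head-edge edge triang
    ; exchange    = exchange-edge edge symmetric triang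
    ; lex         = lex }
    where open UniformFlagTriangulation Δ

  -- Reversal exchanges the types THTH and HTHT and the types THHT and HTTH, and keeps nesting and
  -- crossing, so the lex conditions are permuted among themselves.
  reversed-lex : ∀ {n} {E : EdgeRel n} → LexRelation E → LexRelation (reversed E)
  reversed-lex {n} {E} L = record
    { symmetric   = λ p q → symmetric (swap p) (swap q)
    ; uniform     = λ p q p′ q′ ap aq ap′ aq′ same → uniform (swap p) (swap q) (swap p′) (swap q′)
                      (swap-arrow p ap) (swap-arrow q aq) (swap-arrow p′ ap′) (swap-arrow q′ aq′)
                      (λ r s → ≡.subst₂ _≡_ (≡.sym (≡.cong₂ _<ᵇ_ (four-swap p q r) (four-swap p q s)))
                        (≡.sym (≡.cong₂ _<ᵇ_ (four-swap p′ q′ r) (four-swap p′ q′ s))) (same (σ₄ r) (σ₄ s)))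
    ; head-tail   = λ i j k p q → ≡.trans (symmetric (j , i) (k , j)) (head-tail k j i (q ∘ ≡.sym) (p ∘ ≡.sym))
    ; shared-tail = λ a x y p q r → shared-head x y a (p ∘ ≡.sym) (q ∘ ≡.sym) r
    ; shared-head = λ a b x p q r → shared-tail x a b (p ∘ ≡.sym) (q ∘ ≡.sym) r
    ; exchange    = λ a b x y p q r s t u → ≡.trans (exchange x y a b (p ∘ ≡.sym) (r ∘ ≡.sym) (q ∘ ≡.sym) (s ∘ ≡.sym) u t)
                      (≡.cong not (symmetric (x , b) (y , a)))
    ; lex         = λ a b c d p q r → let (nest , nest′ , cross , cross′) = lex a b c d p q r
                                      in nest′ , nest , cross′ , cross }
    where
    open LexRelation L
    -- The permutation of the four endpoints that exchanges tail and head in both arrows.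
    σ₄ : Fin 4 → Fin 4
    σ₄ zero                   = suc zero
    σ₄ (suc zero)             = zero
    σ₄ (suc (suc zero))       = suc (suc (suc zero))
    σ₄ (suc (suc (suc zero))) = suc (suc zero)
    four-swap : ∀ (p q : Pt n) r → four (swap p) (swap q) r ≡ four p q (σ₄ r)
    four-swap p q zero                   = refl
    four-swap p q (suc zero)             = refl
    four-swap p q (suc (suc zero))       = refl
    four-swap p q (suc (suc (suc zero))) = refl
    swap-arrow : ∀ (p : Pt n) → isArrow p ≡ true → isArrow (swap p) ≡ true
    swap-arrow p ap = isArrow-intro {p = swap p} (λ e → isArrow-elim {p = p} ap (≡.sym e))

  <ᵇ-true : ∀ {m n} → m ℕ.< n → (m <ᵇ n) ≡ true
  <ᵇ-true {zero}  (s≤s _) = refl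
  <ᵇ-true {suc m} (s≤s p) = <ᵇ-true p

  <ᵇ-false : ∀ {m n} → n ℕ.≤ m → (m <ᵇ n) ≡ false
  <ᵇ-false z≤n     = refl
  <ᵇ-false (s≤s p) = <ᵇ-false p

  -- The order type of a pair of arrows p₁ → p₄, p₂ → p₃ with p₁ < p₂ < p₃ < p₄.
  nest-order : Fin 4 → Fin 4 → Bool
  nest-order zero                   zero                   = false
  nest-order zero                   (suc _)                = true
  nest-order (suc zero)             _                      = false
  nest-order (suc (suc zero))       zero                   = false
  nest-order (suc (suc zero))       (suc zero)             = true
  nest-order (suc (suc zero))       (suc (suc zero))       = false
  nest-order (suc (suc zero))       (suc (suc (suc zero))) = true
  nest-order (suc (suc (suc zero))) (suc zero)             = true
  nest-order (suc (suc (suc zero))) zero                   = false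
  nest-order (suc (suc (suc zero))) (suc (suc _))          = false

  module _ {n} {a b c d : Fin (suc n)} (a<b : a Fin.< b) (b<c : b Fin.< c) (c<d : c Fin.< d) where
    private
      a<c = ℕₚ.<-trans a<b b<c
      b<d = ℕₚ.<-trans b<c c<d
      a<d = ℕₚ.<-trans a<c c<d

    nest-order-correct : ∀ r s → (four (a , d) (b , c) r <ᵇ four (a , d) (b , c) s) ≡ nest-order r s
    nest-order-correct zero                   zero                   = <ᵇ-false (ℕₚ.≤-refl {toℕ a})
    nest-order-correct zero                   (suc zero)             = <ᵇ-true a<d
    nest-order-correct zero                   (suc (suc zero))       = <ᵇ-true a<b
    nest-order-correct zero                   (suc (suc (suc zero))) = <ᵇ-true a<c
    nest-order-correct (suc zero)             zero                   = <ᵇ-false (ℕₚ.<⇒≤ a<d)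
    nest-order-correct (suc zero)             (suc zero)             = <ᵇ-false (ℕₚ.≤-refl {toℕ d})
    nest-order-correct (suc zero)             (suc (suc zero))       = <ᵇ-false (ℕₚ.<⇒≤ b<d)
    nest-order-correct (suc zero)             (suc (suc (suc zero))) = <ᵇ-false (ℕₚ.<⇒≤ c<d)
    nest-order-correct (suc (suc zero))       zero                   = <ᵇ-false (ℕₚ.<⇒≤ a<b)
    nest-order-correct (suc (suc zero))       (suc zero)             = <ᵇ-true b<d
    nest-order-correct (suc (suc zero))       (suc (suc zero))       = <ᵇ-false (ℕₚ.≤-refl {toℕ b})
    nest-order-correct (suc (suc zero))       (suc (suc (suc zero))) = <ᵇ-true b<c
    nest-order-correct (suc (suc (suc zero))) zero                   = <ᵇ-false (ℕₚ.<⇒≤ a<c)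
    nest-order-correct (suc (suc (suc zero))) (suc zero)             = <ᵇ-true c<d
    nest-order-correct (suc (suc (suc zero))) (suc (suc zero))       = <ᵇ-false (ℕₚ.<⇒≤ b<c)
    nest-order-correct (suc (suc (suc zero))) (suc (suc (suc zero))) = <ᵇ-false (ℕₚ.≤-refl {toℕ c})

  <⇒≢ : ∀ {m} {i j : Fin m} → i Fin.< j → i ≢ j
  <⇒≢ p refl = ℕₚ.<-irrefl refl p


  few-points : ∀ {n} → n ℕ.< 3 → ∀ {a b c d : Fin (suc n)} → a Fin.< b → b Fin.< c → c Fin.< d → ⊥
  few-points {n} n<3 {d = d} p q r = ℕₚ.<-irrefl refl (ℕₚ.<-≤-trans (ℕₚ.≤-<-trans
    (ℕₚ.≤-trans (s≤s (ℕₚ.≤-trans (s≤s (ℕₚ.≤-trans (s≤s z≤n) p)) q)) r) (Finₚ.toℕ<n d)) n<3)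

  module _ {n} {E : EdgeRel n} (L : LexRelation E) where
    open LexRelation L

    -- All nested TTHH pairs have one order type, so uniformity compares each of them with the pair
    -- on the first four points.
    nest-constant : ∃ λ α → ∀ a b c d → a Fin.< b → b Fin.< c → c Fin.< d → E (a , d) (b , c) ≡ α
    nest-constant with 3 ℕₚ.≤? n
    -- With fewer than four points there is no nested pair, and the value is an arbitrary default.
    ... | no  n<3 = true , λ a b c d p q r → ⊥-elim (few-points (ℕₚ.≰⇒> n<3) p q r)
    ... | yes (s≤s (s≤s (s≤s z≤n))) = E (1st , 4th) (2nd , 3rd) , λ a b c d p q r →
      uniform (a , d) (b , c) (1st , 4th) (2nd , 3rd)
        (isArrow-intro {p = a , d} (<⇒≢ (ℕₚ.<-trans p (ℕₚ.<-trans q r)))) (isArrow-intro {p = b , c} (<⇒≢ q)) refl refl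
        (λ i j → ≡.trans (nest-order-correct p q r i j)
          (≡.sym (nest-order-correct {a = 1st} {2nd} {3rd} {4th} (s≤s z≤n) (s≤s (s≤s z≤n)) (s≤s (s≤s (s≤s z≤n))) i j)))
      where
      1st 2nd 3rd 4th : Fin (suc n)
      1st = zero
      2nd = suc zero
      3rd = suc (suc zero)
      4th = suc (suc (suc zero))

    -- For each type with least endpoint a tail, `exchange` makes the two matchings complementary:
    -- for THTH and THHT the lex condition settles one of them, for TTHH the nesting constant does.
    outRules : ∃ λ α → OutRules α E
    outRules with nest-constant
    ... | α , nest = α , record
      { symmetric   = symmetric
      ; head-tail   = head-tail
      ; shared-tail = shared-tail
      ; shared-head = shared-head
      ; TTHH-nest   = nest
      ; TTHH-cross  = λ a b c d p q r → ≡.trans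
          (exchange a b c d (<⇒≢ (<-trans p q)) (<⇒≢ (<-trans p (<-trans q r))) (<⇒≢ q) (<⇒≢ (<-trans q r)) (<⇒≢ p) (<⇒≢ r))
          (≡.cong not (nest a b c d p q r))
      ; THTH-apart  = λ a b c d p q r → ≡.trans
          (exchange a c b d (<⇒≢ p) (<⇒≢ (<-trans p (<-trans q r))) (<⇒≢ q ∘ ≡.sym) (<⇒≢ r) (<⇒≢ (<-trans p q)) (<⇒≢ (<-trans q r)))
          (≡.cong not (proj₁ (lex a b c d p q r)))
      ; THTH-nest   = λ a b c d p q r → proj₁ (lex a b c d p q r)
      ; THHT-apart  = λ a b c d p q r → ≡.trans
          (exchange a d b c (<⇒≢ p) (<⇒≢ (<-trans p q)) (<⇒≢ (<-trans q r) ∘ ≡.sym) (<⇒≢ r ∘ ≡.sym) (<⇒≢ (<-trans p (<-trans q r))) (<⇒≢ q))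
          (≡.cong not (proj₁ (proj₂ (proj₂ (lex a b c d p q r)))))
      ; THHT-cross  = λ a b c d p q r → proj₁ (proj₂ (proj₂ (lex a b c d p q r))) }
      where
      <-trans : ∀ {i j k : ℕ} → i ℕ.< j → j ℕ.< k → i ℕ.< k
      <-trans = ℕₚ.<-trans

open import Data.Nat using (ℕ; suc; _+_; _*_; _∸_; _≤_)
open import Data.Nat.Combinatorics using (_C_)

theorem9p1 : (n : ℕ) (Δ : UniformFlagTriangulation n) →
    InLexClass (UniformFlagTriangulation.edge Δ) →
    (i k : ℕ) → i ≤ k →
    (suc k * fFB (UniformFlagTriangulation.edge Δ) i (k ∸ i) ≡ fK (UniformFlagTriangulation.edge Δ) k)
    × (suc k * fFB (UniformFlagTriangulation.edge Δ) i (k ∸ i) ≡ ((n + k) C k) * (n C k))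
theorem9p1 n Δ lex i k i≤k =
  ≡.trans (≡.cong (suc k *_) (count i i≤k))
    (≡.sym (≡.trans (fK-sum edge k) (sumTo-const k (λ j → fFB edge j (k ∸ j)) (ballot 1 n k) count))) ,
  ≡.trans (≡.cong (suc k *_) (count i i≤k)) (ballot-binomial n k)
  where
  open Series using (ballot; ballot-binomial)
  open Counting using (fFB-ballot; fK-sum; sumTo-const)
  open Geometry using (LexRelation; lexRelation; reversed-lex; outRules)
  open UniformFlagTriangulation Δ using (edge)
  rules : LexRelation edge
  rules = lexRelation Δ lex
  -- `α` is read off from the relation and `β` from its reversal; the count is the same for every
  -- combination of the two.
  count : ∀ j → j ≤ k → fFB edge j (k ∸ j) ≡ ballot 1 n k
  count j j≤k = ≡.trans (fFB-ballot edge (proj₂ (outRules rules)) (proj₂ (outRules (reversed-lex rules))) j (k ∸ j))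
    (≡.cong (ballot 1 n) (ℕₚ.m∸n+n≡m j≤k))
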